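{- Let $G$ be the arrangement graph of a simple intersecting arrangement $\mathcal{A}$ of $n$ pseudocircles. Then $\chi_f(G)\le 3+\frac{6}{3n-2}=3+\frac{2}{n}+o\!\left(\frac{1}{n}\right)$. In particular, if $v$ denotes the number of vertices of $G$, then $\chi_f(G)\le 3+\frac{2}{\sqrt{v}}+o\!\left(\frac{1}{\sqrt{v}}\right)$.
   Context: An arrangement of pseudocircles is a finite family of simple closed curves on the sphere (or in the plane) such that each pair intersects at most twice, crossing at intersection points; it is simple if no three curves pass through a common point and intersecting if every pair of curves intersects. The arrangement graph has the intersection points as vertices and the pieces of curves between them as edges. A $b$-fold coloring of a graph with $m$ colors assigns to each vertex a $b$-element subset of $\{1,\dots,m\}$ such that adjacent vertices receive disjoint sets; $\chi_b(G)$ is the least such $m$, and the fractional chromatic number is $\chi_f(G)=\lim_{b\to\infty}\chi_b(G)/b=\inf_b \chi_b(G)/b$. -}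

module Defs where

open import Data.Nat using (ℕ; zero; suc; _+_; _*_; _∸_; _≤_)
open import Data.Fin using (Fin; zero; suc)
open import Data.Fin.Subset using (Subset; _∈_; _∉_; ∣_∣)
open import Data.Product using (Σ; ∃; ∃-syntax; _×_; _,_)
open import Data.Sum using (_⊎_)
open import Relation.Binary.PropositionalEquality using (_≡_; _≢_)
open import Function.Bundles using (_⇔_)

-- A finite graph on vertex set Fin nv with an adjacency relation
-- (parallel edges are irrelevant for colourings).
record Graph : Set₁ where
  field
    nv  : ℕ
    Adj : Fin nv → Fin nv → Set

record BFoldColouring (G : Graph) (b m : ℕ) : Set where
  open Graph G
  field
    col      : Fin nv → Subset m
    col-size : ∀ v → ∣ col v ∣ ≡ b
    col-disj : ∀ u w → Adj u w → ∀ x → x ∈ col u → x ∉ col w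

-- χ_f(G) ≤ p / q  (q ≥ 1), with χ_f(G) = inf_b χ_b(G)/b.
-- Literally: for every ε = 1/k > 0 there is b ≥ 1 and a b-fold
-- colouring with m colours such that m / b ≤ p / q + 1 / k,
-- i.e.  m * k * q ≤ p * k * b + b * q.
FracChromaticAtMost : Graph → ℕ → ℕ → Set
FracChromaticAtMost G p q =
  ∀ k → 1 ≤ k →
    ∃[ b ] ∃[ m ] (1 ≤ b × BFoldColouring G b m × (m * k * q ≤ p * k * b + b * q))

-- Combinatorial (map) encoding of simple intersecting arrangements of
-- pseudocircles on the sphere.
--
-- The arrangement graph is 4-regular. A dart (v , i) is the i-th
-- half-edge at vertex v in the cyclic (rotation) order around v.
-- Opposite half-edges (i and i+2) continue the same pseudocircle
-- through v, and the two pseudocircles through v alternate, i.e. cross.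

Dart : ℕ → Set
Dart nv = Fin nv × Fin 4

rot4 : Fin 4 → Fin 4
rot4 zero = suc zero
rot4 (suc zero) = suc (suc zero)
rot4 (suc (suc zero)) = suc (suc (suc zero))
rot4 (suc (suc (suc zero))) = zero

σ : ∀ {nv} → Dart nv → Dart nv
σ (v , i) = (v , rot4 i)

opp : ∀ {nv} → Dart nv → Dart nv
opp (v , i) = (v , rot4 (rot4 i))

iter : ∀ {A : Set} → (A → A) → ℕ → A → A
iter f zero    x = x
iter f (suc k) x = f (iter f k x)

i0 i1 : Fin 4
i0 = zero
i1 = suc zero

Meets : ∀ {nv n} → (Dart nv → Fin n) → Fin n → Fin n → Fin nv → Set
Meets cv c c' x = (cv (x , i0) ≡ c × cv (x , i1) ≡ c') ⊎ (cv (x , i0) ≡ c' × cv (x , i1) ≡ c)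

record Arrangement (n : ℕ) : Set where
  field
    nv      : ℕ
    -- edge involution: pairs the two half-edges of each edge
    α       : Dart nv → Dart nv
    α-invol : ∀ d → α (α d) ≡ d
    α-nofix : ∀ d → α d ≢ d
    curve     : Dart nv → Fin n
    curve-α   : ∀ d → curve (α d) ≡ curve d
    curve-opp : ∀ d → curve (opp d) ≡ curve d
    -- each pseudocircle is a single closed curve: going straight ahead
    -- (τ d = opp (α d)) from any of its half-edges, in one of the two
    -- directions, reaches every half-edge of that pseudocircle
    curve-closed : ∀ d d' → curve d ≡ curve d' →
      (∃[ k ] iter (λ e → opp (α e)) k d ≡ d') ⊎
      (∃[ k ] iter (λ e → opp (α e)) k (opp d) ≡ d')
    -- the two curves through a vertex are distinct
    -- (no self-intersections; simplicity is built into 4-regularity)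
    two-curves : ∀ v → curve (v , i0) ≢ curve (v , i1)
    crosses-twice : ∀ c c' → c ≢ c' →
      ∃[ u ] ∃[ w ] (u ≢ w × Meets curve c c' u × Meets curve c c' w ×
        (∀ x → Meets curve c c' x → x ≡ u ⊎ x ≡ w))
    nfaces     : ℕ
    face       : Dart nv → Fin nfaces
    face-surj  : ∀ f → ∃[ d ] face d ≡ f
    face-orbit : ∀ d d' → (face d ≡ face d') ⇔ (∃[ k ] iter (λ e → σ (α e)) k d ≡ d')
    -- the map lies on the sphere: Euler's formula V - E + F = 2 with
    -- E = 2V (the graph is connected when nonempty)
    spherical  : nv ≡ 0 ⊎ nfaces ≡ nv + 2

arrGraph : ∀ {n} → Arrangement n → Graph
arrGraph A = record
  { nv  = Arrangement.nv A
  ; Adj = λ u w → ∃[ i ] ∃[ j ] Arrangement.α A (u , i) ≡ (w , j) }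

-- Fix a pseudocircle C.  The vertices off C induce a 2-degenerate, hence 3-colourable, graph.  Indeed, if every
-- vertex of a nonempty set H off C had at most one edge leaving H, the boundary of the face of H containing C
-- would contain a closed walk bounding a disc away from C, all of whose corners but one are straight or reflex.
-- In a minimal such disc extend the sides into the disc at the reflex corners: by minimality the forward
-- extensions leave the disc later on the boundary and the backward ones earlier, and no forward extension
-- crosses the backward extension at a later corner.  Going from corner to corner it follows that each side meets
-- the backward extension of its successor, so it cannot meet that successor a third time and its own forward
-- extension passes beyond it; at the last corner there is nothing beyond.  The discs come from the fact that on
-- the sphere every even set of edges bounds a set of faces, proved from Euler's formula by a tree-cotree argument.
--
-- Since the curves meet pairwise, on at least one side of C, called the inside, no edge joins two vertices of C.
-- Any 3-colouring of the vertices outside C extends to the even cycle C.  Shifting the colours inside cyclically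
-- in three ways, each vertex of C conflicts with its unique inner neighbour for exactly one shift.  With 9 colours
-- for each C, a vertex thus receives 3 colours from each of the n - 2 curves not through it and 2 from each of its
-- two curves, which makes 3n - 2 colours out of 9n.

module Submission where

open import Defs
open import Data.Bool using (Bool; true; false; not; _∧_; _∨_; _xor_; if_then_else_)
open import Data.Bool.Properties using (xor-same; xor-comm; xor-assoc; xor-identityʳ; not-involutive; ¬-not) renaming (_≟_ to _≟ᵇ_)
open import Data.Empty using (⊥; ⊥-elim)
open import Data.Fin using (Fin; zero; suc) renaming (_≟_ to _≟ᶠ_)
open import Data.Fin.Patterns using (0F; 1F; 2F; 3F)
open import Data.Fin.Properties using (any?)
open import Data.Fin.Subset using (Subset; _∈_; _∉_; ∣_∣; _⊆_)
open import Data.List using (List; []; _∷_; [_]; _++_; map; length; allFin; cartesianProduct)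
open import Data.List.Properties using (length-++; length-map; length-tabulate; map-++; ++-assoc; ++-identityʳ; ∷ʳ-injectiveʳ)
open import Data.List.Membership.Propositional using () renaming (_∈_ to _∈ˡ_; _∉_ to _∉ˡ_)
open import Data.List.Membership.Propositional.Properties using (∈-map⁺; ∈-map⁻; ∈-++⁺ˡ; ∈-++⁺ʳ; ∈-++⁻; ∈-∃++; ∈-allFin; ∈-cartesianProduct⁺)
open import Data.List.Relation.Unary.All as All using (All; []; _∷_)
open import Data.List.Relation.Unary.Any using (here; there)
open import Data.List.Relation.Unary.AllPairs using ([]; _∷_)
open import Data.List.Relation.Unary.Linked as Linked using (Linked; []; [-]; _∷_)
open import Data.List.Relation.Unary.Unique.Propositional using (Unique)
import Data.List.Relation.Unary.Unique.Propositional.Properties as Uniqueₚ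
open import Data.Maybe using (Maybe; just; nothing)
open import Data.Nat using (ℕ; zero; suc; _+_; _*_; _∸_; _≤_; _<_; z≤n; s≤s)
open import Data.Nat.Properties using (≤-refl; ≤-trans; ≤-reflexive; <-irrefl; +-suc; +-comm; +-identityʳ; suc-injective; m≤n⇒m≤1+n; n≤1+n; +-mono-≤; *-comm; m≤m+n; m≤n+m; <-cmp; n<1+n; <⇒≤; ≤-antisym; ≤-total; m∸n+n≡m; m+[n∸m]≡n; m∸n≤m; m<n⇒0<n∸m; m∸[m∸n]≡n; ∸-monoʳ-<; m≤n⇒m<n∨m≡n; m≤n+o⇒m∸n≤o; module ≤-Reasoning)
open import Data.Nat.Solver using (module +-*-Solver)
open import Data.Product using (∃; ∃₂; _×_; _,_; proj₁; proj₂)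
open import Data.Product.Properties using (≡-dec)
open import Data.Sum using (_⊎_; inj₁; inj₂)
open import Data.Unit using (⊤; tt)
open import Data.Vec as Vec using ([]; _∷_)
open import Function using (_∘_; id; case_of_)
open import Function.Bundles using (Equivalence)
open import Relation.Binary.Definitions using (tri<; tri≈; tri>)
open import Relation.Binary.PropositionalEquality using (_≡_; _≢_; refl; sym; trans; cong; cong₂; subst; subst₂; module ≡-Reasoning)
open import Relation.Nullary using (¬_; Dec; yes; no; ¬?)
open import Relation.Nullary.Decidable using (_×-dec_; _⊎-dec_; map′; does; dec-true; dec-false)

-- The encoding contains no topology. A set of faces is a Boolean function on darts that is
-- invariant under `σ ∘ α`, and Euler's formula enters only through `bounds`. What stands in for a
-- disc away from C is a `Region`: a set of faces that has one simple closed walk as boundary and no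
-- face at a vertex of C. That last condition makes the argument run, because every curve meets C
-- and so any curve that enters a region must leave it again. A loop is a list of darts in which
-- consecutive ones go straight or turn right. Its one exceptional corner is where the list closes
-- up, so the choice of starting point matters, and each short-cut loop has to be rotated to put
-- that corner in the right place. In extending a colouring to C, the obstacle is that outer edges
-- may join two vertices of C. Alternating along C must respect these chords too; this is why parity
-- is read off a chequerboard colouring of the faces and not off the length of C. The constants fit
-- because 9n = 3(3n - 2) + 6. Finding a side of C without chords takes a third curve, so one and
-- two curves are treated separately.

private
  variable
    X Y : Set

-- Sums modulo 2, lists without repetition, counting

true≢false : true ≢ false
true≢false ()

false-or-true : ∀ b → b ≡ false ⊎ b ≡ true
false-or-true false = inj₁ refl
false-or-true true  = inj₂ refl

xor-≡ : ∀ {a b} → a xor b ≡ false → a ≡ b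
xor-≡ {false} {false} _ = refl
xor-≡ {true}  {true}  _ = refl

xor-≢ : ∀ {a b} → a xor b ≡ true → b ≡ not a
xor-≢ {false} {true}  _ = refl
xor-≢ {true}  {false} _ = refl

xor-interchange : ∀ a b c d → (a xor b) xor (c xor d) ≡ (a xor c) xor (b xor d)
xor-interchange a b c d = begin
  (a xor b) xor (c xor d) ≡⟨ xor-assoc a b (c xor d) ⟩
  a xor (b xor (c xor d)) ≡⟨ cong (a xor_) (sym (xor-assoc b c d)) ⟩
  a xor ((b xor c) xor d) ≡⟨ cong (λ z → a xor (z xor d)) (xor-comm b c) ⟩
  a xor ((c xor b) xor d) ≡⟨ cong (a xor_) (xor-assoc c b d) ⟩
  a xor (c xor (b xor d)) ≡⟨ sym (xor-assoc a c (b xor d)) ⟩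
  (a xor c) xor (b xor d) ∎
  where open ≡-Reasoning

does-true : ∀ {P : Set} (P? : Dec P) → does P? ≡ true → P
does-true (yes p) _ = p

does-false : ∀ {P : Set} (P? : Dec P) → does P? ≡ false → ¬ P
does-false (no ¬p) _ = ¬p

-- Summation in the field with two elements: edge sets are chains modulo 2, and evenness at a vertex
-- is the vanishing of such a sum.
⨁ : List X → (X → Bool) → Bool
⨁ []       g = false
⨁ (x ∷ xs) g = g x xor ⨁ xs g

⨁-cong : (xs : List X) {g h : X → Bool} → (∀ x → g x ≡ h x) → ⨁ xs g ≡ ⨁ xs h
⨁-cong []       eq = refl
⨁-cong (x ∷ xs) eq = cong₂ _xor_ (eq x) (⨁-cong xs eq)

⨁-false : (xs : List X) {g : X → Bool} → (∀ x → x ∈ˡ xs → g x ≡ false) → ⨁ xs g ≡ false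
⨁-false []       eq = refl
⨁-false (x ∷ xs) eq = cong₂ _xor_ (eq x (here refl)) (⨁-false xs (λ y y∈ → eq y (there y∈)))

⨁-xor : (xs : List X) (g h : X → Bool) → ⨁ xs (λ x → g x xor h x) ≡ ⨁ xs g xor ⨁ xs h
⨁-xor []       g h = refl
⨁-xor (x ∷ xs) g h = trans (cong ((g x xor h x) xor_) (⨁-xor xs g h)) (xor-interchange (g x) (h x) (⨁ xs g) (⨁ xs h))

⨁-swap : (xs : List X) (ys : List Y) (g : X → Y → Bool) →
  ⨁ xs (λ x → ⨁ ys (g x)) ≡ ⨁ ys (λ y → ⨁ xs (λ x → g x y))
⨁-swap []       ys g = sym (⨁-false ys (λ _ _ → refl))
⨁-swap (x ∷ xs) ys g = trans (cong (⨁ ys (g x) xor_) (⨁-swap xs ys g)) (sym (⨁-xor ys (g x) _))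

⨁-single : ∀ {xs : List X} {x} (g : X → Bool) → Unique xs → x ∈ˡ xs →
  (∀ y → y ≢ x → g y ≡ false) → ⨁ xs g ≡ g x
⨁-single {x = x} g (x∉ ∷ u) (here refl) off =
  trans (cong (g x xor_) (⨁-false _ (λ y y∈ → off y (λ { refl → All.lookup x∉ y∈ refl })))) (xor-identityʳ _)
⨁-single {xs = y ∷ ys} g (y∉ ∷ u) (there x∈) off =
  trans (cong (_xor ⨁ ys g) (off _ (λ { refl → All.lookup y∉ x∈ refl }))) (⨁-single g u x∈ off)

∉⇒All≢ : ∀ {x : X} {xs} → x ∉ˡ xs → All (x ≢_) xs
∉⇒All≢ x∉ = All.tabulate (λ y∈ x≡y → x∉ (subst (_∈ˡ _) (sym x≡y) y∈))

Unique-∷ : ∀ {x : X} {xs} → x ∉ˡ xs → Unique xs → Unique (x ∷ xs)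
Unique-∷ x∉ u = ∉⇒All≢ x∉ ∷ u

Unique-head : ∀ {x : X} {xs} → Unique (x ∷ xs) → x ∉ˡ xs
Unique-head (x∉ ∷ _) x∈ = All.lookup x∉ x∈ refl

Unique-++ : ∀ {xs ys : List X} → Unique xs → Unique ys → (∀ {x} → x ∈ˡ xs → x ∈ˡ ys → ⊥) → Unique (xs ++ ys)
Unique-++ u v disj = Uniqueₚ.++⁺ u v (λ { (a , b) → disj a b })

Unique-++⁻ : ∀ (xs : List X) {ys} → Unique (xs ++ ys) →
  Unique xs × Unique ys × (∀ {x} → x ∈ˡ xs → x ∈ˡ ys → ⊥)
Unique-++⁻ []       u = [] , u , λ ()
Unique-++⁻ (x ∷ xs) (x∉ ∷ u) with Unique-++⁻ xs u
... | ux , uy , disj = Unique-∷ (λ x∈ → All.lookup x∉ (∈-++⁺ˡ x∈) refl) ux , uy ,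
  λ { (here refl) y∈ → All.lookup x∉ (∈-++⁺ʳ xs y∈) refl ; (there x∈) y∈ → disj x∈ y∈ }

Unique-rotate : ∀ (xs : List X) {ys} → Unique (xs ++ ys) → Unique (ys ++ xs)
Unique-rotate xs u with Unique-++⁻ xs u
... | ux , uy , disj = Unique-++ uy ux (λ a b → disj b a)

Unique-length-≤ : ∀ {xs ys : List X} → Unique xs → (∀ {x} → x ∈ˡ xs → x ∈ˡ ys) → length xs ≤ length ys
Unique-length-≤ {xs = []}     u        sub = z≤n
Unique-length-≤ {xs = x ∷ xs} (x∉ ∷ u) sub with ∈-∃++ (sub (here refl))
... | as , bs , refl = ≤-trans (s≤s (Unique-length-≤ {ys = as ++ bs} u sub′))
    (≤-reflexive (trans (cong suc (length-++ as)) (sym (trans (length-++ as) (+-suc _ _)))))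
  where
  sub′ : ∀ {y} → y ∈ˡ xs → y ∈ˡ as ++ bs
  sub′ y∈ with ∈-++⁻ as (sub (there y∈))
  ... | inj₁ y∈as         = ∈-++⁺ˡ y∈as
  ... | inj₂ (here refl)  = ⊥-elim (All.lookup x∉ y∈ refl)
  ... | inj₂ (there y∈bs) = ∈-++⁺ʳ as y∈bs

Unique-map-injective : ∀ {f : X → Y} {xs x y} → Unique (map f xs) → x ∈ˡ xs → y ∈ˡ xs → f x ≡ f y → x ≡ y
Unique-map-injective         (_ ∷ _)  (here refl) (here refl) _  = refl
Unique-map-injective {f = f} (x∉ ∷ _) (here refl) (there y∈)  eq = ⊥-elim (All.lookup x∉ (∈-map⁺ f y∈) eq)
Unique-map-injective {f = f} (x∉ ∷ _) (there x∈)  (here refl) eq = ⊥-elim (All.lookup x∉ (∈-map⁺ f x∈) (sym eq))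
Unique-map-injective         (_ ∷ u)  (there x∈)  (there y∈)  eq = Unique-map-injective u x∈ y∈ eq

Linked-++⁻ˡ : ∀ {R : X → X → Set} (xs : List X) {ys} → Linked R (xs ++ ys) → Linked R xs
Linked-++⁻ˡ []           _       = []
Linked-++⁻ˡ (x ∷ [])     _       = [-]
Linked-++⁻ˡ (x ∷ y ∷ xs) (r ∷ l) = r ∷ Linked-++⁻ˡ (y ∷ xs) l

Linked-++⁻ʳ : ∀ {R : X → X → Set} (xs : List X) {ys} → Linked R (xs ++ ys) → Linked R ys
Linked-++⁻ʳ []       l = l
Linked-++⁻ʳ (x ∷ xs) l = Linked-++⁻ʳ xs (Linked.tail l)

Linked-join : ∀ {R : X → X → Set} (xs : List X) {x y ys} →
  Linked R (xs ++ [ x ]) → R x y → Linked R (y ∷ ys) → Linked R ((xs ++ [ x ]) ++ y ∷ ys)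
Linked-join []           _        r l = r ∷ l
Linked-join (z ∷ [])     (q ∷ _)  r l = q ∷ r ∷ l
Linked-join (z ∷ y ∷ xs) (q ∷ l′) r l = q ∷ Linked-join (y ∷ xs) l′ r l

Linked-tail : ∀ {R : X → X → Set} {x : X} {xs} → Linked R (x ∷ xs) → Linked R xs
Linked-tail [-]     = []
Linked-tail (_ ∷ l) = l

∈-snoc : ∀ (xs : List X) {x y} → y ∈ˡ xs ++ [ x ] → y ∈ˡ xs ⊎ y ≡ x
∈-snoc xs y∈ with ∈-++⁻ xs y∈
... | inj₁ a = inj₁ a
... | inj₂ (here eq) = inj₂ eq

snoc-view : (x : X) (xs : List X) → ∃₂ λ ys y → x ∷ xs ≡ ys ++ [ y ]
snoc-view x []       = [] , x , refl
snoc-view x (z ∷ xs) with snoc-view z xs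
... | ys , y , eq = x ∷ ys , y , cong (x ∷_) eq

countᵇ : List X → (X → Bool) → ℕ
countᵇ []       p = 0
countᵇ (x ∷ xs) p with p x
... | true  = suc (countᵇ xs p)
... | false = countᵇ xs p

countᵇ-mono : (xs : List X) {p q : X → Bool} → (∀ x → p x ≡ true → q x ≡ true) → countᵇ xs p ≤ countᵇ xs q
countᵇ-mono [] imp = z≤n
countᵇ-mono (x ∷ xs) {p} {q} imp with p x in px | q x in qx
... | true  | true  = s≤s (countᵇ-mono xs imp)
... | true  | false = ⊥-elim (true≢false (trans (sym (imp x px)) qx))
... | false | true  = m≤n⇒m≤1+n (countᵇ-mono xs imp)
... | false | false = countᵇ-mono xs imp

countᵇ-strict : ∀ {xs : List X} {p q : X → Bool} {x} → (∀ x → p x ≡ true → q x ≡ true) →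
  x ∈ˡ xs → p x ≡ false → q x ≡ true → countᵇ xs p < countᵇ xs q
countᵇ-strict {xs = x ∷ xs} {p} {q} imp (here refl) px qx rewrite px | qx = s≤s (countᵇ-mono xs imp)
countᵇ-strict {xs = x ∷ xs} {p} {q} imp (there y∈) py qy with p x in px | q x in qx
... | true  | true  = s≤s (countᵇ-strict imp y∈ py qy)
... | true  | false = ⊥-elim (true≢false (trans (sym (imp x px)) qx))
... | false | true  = m≤n⇒m≤1+n (countᵇ-strict imp y∈ py qy)
... | false | false = countᵇ-strict imp y∈ py qy

iter-shift : (f : X → X) (k : ℕ) (x : X) → iter f k (f x) ≡ f (iter f k x)
iter-shift f zero    x = refl
iter-shift f (suc k) x = cong f (iter-shift f k x)

iter-+ : (f : X → X) (j k : ℕ) (x : X) → iter f (j + k) x ≡ iter f j (iter f k x)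
iter-+ f zero    k x = refl
iter-+ f (suc j) k x = cong f (iter-+ f j k x)

last-index : {P : ℕ → Set} → (∀ i → Dec (P i)) → ∀ K → P 0 → ¬ P K →
  ∃ λ i → i < K × P i × (∀ j → i < j → j ≤ K → ¬ P j)
last-index P? zero    p0 ¬pK = ⊥-elim (¬pK p0)
last-index {P} P? (suc K) p0 ¬pK with P? K
... | yes pK = K , n<1+n K , pK , λ j K<j j≤ pj → ¬pK (subst P (≤-antisym j≤ K<j) pj)
... | no  ¬pK′ with last-index P? K p0 ¬pK′
... | i , i<K , pi , later = i , m≤n⇒m≤1+n i<K , pi , λ j i<j j≤ pj →
  case <-cmp j (suc K) of λ { (tri< (s≤s j≤K) _ _) → later j i<j j≤K pj ; (tri≈ _ refl _) → ¬pK pj ; (tri> _ _ j>) → <-irrefl refl (≤-trans j> j≤) }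

-- Darts and the rotation around a vertex

rot4⁴ : ∀ i → rot4 (rot4 (rot4 (rot4 i))) ≡ i
rot4⁴ 0F = refl
rot4⁴ 1F = refl
rot4⁴ 2F = refl
rot4⁴ 3F = refl

rot4-cases : ∀ i j → j ≡ i ⊎ j ≡ rot4 i ⊎ j ≡ rot4 (rot4 i) ⊎ j ≡ rot4 (rot4 (rot4 i))
rot4-cases 0F 0F = inj₁ refl
rot4-cases 0F 1F = inj₂ (inj₁ refl)
rot4-cases 0F 2F = inj₂ (inj₂ (inj₁ refl))
rot4-cases 0F 3F = inj₂ (inj₂ (inj₂ refl))
rot4-cases 1F 1F = inj₁ refl
rot4-cases 1F 2F = inj₂ (inj₁ refl)
rot4-cases 1F 3F = inj₂ (inj₂ (inj₁ refl))
rot4-cases 1F 0F = inj₂ (inj₂ (inj₂ refl))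
rot4-cases 2F 2F = inj₁ refl
rot4-cases 2F 3F = inj₂ (inj₁ refl)
rot4-cases 2F 0F = inj₂ (inj₂ (inj₁ refl))
rot4-cases 2F 1F = inj₂ (inj₂ (inj₂ refl))
rot4-cases 3F 3F = inj₁ refl
rot4-cases 3F 0F = inj₂ (inj₁ refl)
rot4-cases 3F 1F = inj₂ (inj₂ (inj₁ refl))
rot4-cases 3F 2F = inj₂ (inj₂ (inj₂ refl))

module Darts {nv : ℕ} where

  tl : Dart nv → Fin nv
  tl = proj₁

  σ⁴ : (d : Dart nv) → σ (σ (σ (σ d))) ≡ d
  σ⁴ (v , i) = cong (v ,_) (rot4⁴ i)

  opp-opp : (d : Dart nv) → opp (opp d) ≡ d
  opp-opp = σ⁴

  σ≢ : (d : Dart nv) → σ d ≢ d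
  σ≢ (v , 0F) ()
  σ≢ (v , 1F) ()
  σ≢ (v , 2F) ()
  σ≢ (v , 3F) ()

  opp≢ : (d : Dart nv) → opp d ≢ d
  opp≢ (v , 0F) ()
  opp≢ (v , 1F) ()
  opp≢ (v , 2F) ()
  opp≢ (v , 3F) ()

  σ³≢ : (d : Dart nv) → σ (σ (σ d)) ≢ d
  σ³≢ d eq = σ≢ d (trans (cong σ (sym eq)) (σ⁴ d))

  σ-injective : ∀ {d e : Dart nv} → σ d ≡ σ e → d ≡ e
  σ-injective {d} {e} eq = trans (sym (σ⁴ d)) (trans (cong (σ ∘ σ ∘ σ) eq) (σ⁴ e))

  around : (d e : Dart nv) → tl e ≡ tl d → e ≡ d ⊎ e ≡ σ d ⊎ e ≡ σ (σ d) ⊎ e ≡ σ (σ (σ d))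
  around (v , i) (.v , j) refl with rot4-cases i j
  ... | inj₁ refl                = inj₁ refl
  ... | inj₂ (inj₁ refl)         = inj₂ (inj₁ refl)
  ... | inj₂ (inj₂ (inj₁ refl))  = inj₂ (inj₂ (inj₁ refl))
  ... | inj₂ (inj₂ (inj₂ refl))  = inj₂ (inj₂ (inj₂ refl))

  infix 4 _≟ᵈ_
  _≟ᵈ_ : (d e : Dart nv) → Dec (d ≡ e)
  _≟ᵈ_ = ≡-dec _≟ᶠ_ _≟ᶠ_

  _∈ᵈ?_ : (d : Dart nv) (w : List (Dart nv)) → Dec (d ∈ˡ w)
  d ∈ᵈ? w = DecMembership._∈?_ _≟ᵈ_ d w
    where import Data.List.Membership.DecPropositional as DecMembership

  _∈ᵛ?_ : (v : Fin nv) (w : List (Fin nv)) → Dec (v ∈ˡ w)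
  v ∈ᵛ? w = DecMembership._∈?_ _≟ᶠ_ v w
    where import Data.List.Membership.DecPropositional as DecMembership

  any-dart? : {P : Dart nv → Set} → (∀ d → Dec (P d)) → Dec (∃ P)
  any-dart? P? = map′ (λ { (v , i , p) → (v , i) , p }) (λ { ((v , i) , p) → v , i , p })
    (any? (λ v → any? (λ i → P? (v , i))))

  darts : List (Dart nv)
  darts = cartesianProduct (allFin nv) (allFin 4)

  ∈-darts : ∀ d → d ∈ˡ darts
  ∈-darts (v , i) = ∈-cartesianProduct⁺ (∈-allFin v) (∈-allFin i)

  darts-unique : Unique darts
  darts-unique = Uniqueₚ.cartesianProduct⁺ (Uniqueₚ.allFin⁺ nv) (Uniqueₚ.allFin⁺ 4)

  length-darts : length darts ≡ nv * 4
  length-darts = trans (length-product (allFin nv)) (cong (_* 4) (length-tabulate {n = nv} id))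
    where
    length-product : (vs : List (Fin nv)) → length (cartesianProduct vs (allFin 4)) ≡ length vs * 4
    length-product []       = refl
    length-product (v ∷ vs) = cong (4 +_) (length-product vs)

  around-sum : (Dart nv → Bool) → Fin nv → Bool
  around-sum g v = ⨁ (allFin 4) (λ i → g (v , i))

  ⨁-darts : (g : Dart nv → Bool) → ⨁ darts g ≡ ⨁ (allFin nv) (around-sum g)
  ⨁-darts g = go (allFin nv)
    where
    ⨁-++ : (as bs : List (Dart nv)) → ⨁ (as ++ bs) g ≡ ⨁ as g xor ⨁ bs g
    ⨁-++ []       bs = refl
    ⨁-++ (a ∷ as) bs = trans (cong (g a xor_) (⨁-++ as bs)) (sym (xor-assoc (g a) _ _))
    go : ∀ vs → ⨁ (cartesianProduct vs (allFin 4)) g ≡ ⨁ vs (around-sum g)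
    go []       = refl
    go (v ∷ vs) = trans (⨁-++ (map (v ,_) (allFin 4)) (cartesianProduct vs (allFin 4))) (cong (around-sum g v xor_) (go vs))

  ⨁-darts-at : (g : Dart nv → Bool) (v : Fin nv) →
    ⨁ darts (λ d → does (tl d ≟ᶠ v) ∧ g d) ≡ around-sum g v
  ⨁-darts-at g v = trans (⨁-darts _) (trans
    (⨁-single _ (Uniqueₚ.allFin⁺ nv) (∈-allFin v) off) on)
    where
    off : ∀ u → u ≢ v → around-sum (λ d → does (tl d ≟ᶠ v) ∧ g d) u ≡ false
    off u u≢v rewrite dec-false (u ≟ᶠ v) u≢v = refl
    on : around-sum (λ d → does (tl d ≟ᶠ v) ∧ g d) v ≡ around-sum g v
    on rewrite dec-true (v ≟ᶠ v) refl = refl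

  -- Each term is expanded against the indicator of `π d ≡ e`; after exchanging the sums, the inner
  -- one has the single term `ρ e`.
  ⨁-reindex : (π ρ : Dart nv → Dart nv) → (∀ d → ρ (π d) ≡ d) → (∀ d → π (ρ d) ≡ d) →
    (g : Dart nv → Bool) → ⨁ darts (g ∘ π) ≡ ⨁ darts g
  ⨁-reindex π ρ ρπ πρ g = begin
    ⨁ darts (g ∘ π)
      ≡⟨ ⨁-cong darts (λ d → sym (trans (⨁-single _ darts-unique (∈-darts (π d)) (off d)) (on d))) ⟩
    ⨁ darts (λ d → ⨁ darts (λ e → does (π d ≟ᵈ e) ∧ g e))
      ≡⟨ ⨁-swap darts darts _ ⟩
    ⨁ darts (λ e → ⨁ darts (λ d → does (π d ≟ᵈ e) ∧ g e))
      ≡⟨ ⨁-cong darts (λ e → trans (⨁-single _ darts-unique (∈-darts (ρ e)) (off′ e)) (on′ e)) ⟩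
    ⨁ darts g ∎
    where
    open ≡-Reasoning
    off : ∀ d e → e ≢ π d → (does (π d ≟ᵈ e) ∧ g e) ≡ false
    off d e e≢ rewrite dec-false (π d ≟ᵈ e) (e≢ ∘ sym) = refl
    on : ∀ d → (does (π d ≟ᵈ π d) ∧ g (π d)) ≡ g (π d)
    on d rewrite dec-true (π d ≟ᵈ π d) refl = refl
    off′ : ∀ e d → d ≢ ρ e → (does (π d ≟ᵈ e) ∧ g e) ≡ false
    off′ e d d≢ rewrite dec-false (π d ≟ᵈ e) (λ { refl → d≢ (sym (ρπ d)) }) = refl
    on′ : ∀ e → (does (π (ρ e) ≟ᵈ e) ∧ g e) ≡ g e
    on′ e rewrite dec-true (π (ρ e) ≟ᵈ e) (πρ e) = refl

-- Homology of the sphere modulo 2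

module Planar {n : ℕ} (A : Arrangement n) where
  open Arrangement A public
  open Darts {nv} public

  hd : Dart nv → Fin nv
  hd d = tl (α d)

  τ : Dart nv → Dart nv
  τ e = opp (α e)

  α-injective : ∀ {d e} → α d ≡ α e → d ≡ e
  α-injective {d} {e} eq = trans (sym (α-invol d)) (trans (cong α eq) (α-invol e))

  -- A dart d has face d on its left and face (α d) = face (σ d) on its right, so that face d is the corner
  -- between d and the preceding dart of the rotation.
  face-σα : ∀ d → face (σ (α d)) ≡ face d
  face-σα d = sym (Equivalence.from (face-orbit d (σ (α d))) (1 , refl))

  curve-τ : ∀ d → curve (τ d) ≡ curve d
  curve-τ d = trans (curve-opp (α d)) (curve-α d)

  curve-iter : ∀ k d → curve (iter τ k d) ≡ curve d
  curve-iter zero    d = refl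
  curve-iter (suc k) d = trans (curve-τ _) (curve-iter k d)

  meets-darts : ∀ {c c′ x} → Meets curve c c′ x → (∃ λ d → tl d ≡ x × curve d ≡ c) × (∃ λ d → tl d ≡ x × curve d ≡ c′)
  meets-darts {x = x} (inj₁ (p , q)) = ((x , 0F) , refl , p) , ((x , 1F) , refl , q)
  meets-darts {x = x} (inj₂ (p , q)) = ((x , 1F) , refl , q) , ((x , 0F) , refl , p)

  -- Connectedness, phrased for vertex sets: `U` is constant along each curve, and two different
  -- curves share a vertex.
  connected : (U : Fin nv → Bool) → (∀ d → U (tl d) ≡ U (hd d)) → ∀ u v → U u ≡ U v
  connected U same u v = go (curve (u , 0F) ≟ᶠ curve (v , 0F))
    where
    along : ∀ k d → U (tl (iter τ k d)) ≡ U (tl d)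
    along zero    d = refl
    along (suc k) d = trans (sym (same (iter τ k d))) (along k d)
    same-curve : ∀ d e → curve d ≡ curve e → U (tl d) ≡ U (tl e)
    same-curve d e eq with curve-closed d e eq
    ... | inj₁ (k , refl) = sym (along k d)
    ... | inj₂ (k , refl) = sym (along k (opp d))
    go : Dec (curve (u , 0F) ≡ curve (v , 0F)) → U u ≡ U v
    go (yes eq) = same-curve (u , 0F) (v , 0F) eq
    go (no neq) with crosses-twice _ _ neq
    ... | x , _ , _ , mx , _ with meets-darts mx
    ... | (d , refl , p) , (e , te , q) =
      trans (same-curve (u , 0F) d (sym p)) (trans (cong U (sym te)) (same-curve e (v , 0F) q))

  -- Serves two graphs on the same edges: with `node = tl` the arrangement graph, with `node = face`
  -- its dual, where a dart joins the faces on its two sides.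
  module Tree {N : ℕ} (node : Dart nv → Fin N) (r : Fin N) where

    visited : List (Dart nv) → List (Fin N)
    visited []       = [ r ]
    visited (t ∷ ts) = node (α t) ∷ visited ts

    data Grown : List (Dart nv) → Set where
      []   : Grown []
      grow : ∀ {t ts} → node t ∈ˡ visited ts → node (α t) ∉ˡ visited ts → Grown ts → Grown (t ∷ ts)

    _∈ⁿ?_ : (x : Fin N) (w : List (Fin N)) → Dec (x ∈ˡ w)
    x ∈ⁿ? w = DecMembership._∈?_ _≟ᶠ_ x w
      where import Data.List.Membership.DecPropositional as DecMembership

    visited-unique : ∀ {ts} → Grown ts → Unique (visited ts)
    visited-unique []           = [] ∷ []
    visited-unique (grow _ b g) = Unique-∷ b (visited-unique g)

    length-visited : ∀ ts → length (visited ts) ≡ suc (length ts)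
    length-visited []       = refl
    length-visited (t ∷ ts) = cong suc (length-visited ts)

    ends-visited : ∀ {ts d} → Grown ts → d ∈ˡ ts → node d ∈ˡ visited ts × node (α d) ∈ˡ visited ts
    ends-visited (grow a _ _) (here refl) = there a , here refl
    ends-visited (grow _ _ g) (there d∈) with ends-visited g d∈
    ... | p , q = there p , there q

    r-visited : ∀ ts → r ∈ˡ visited ts
    r-visited []       = here refl
    r-visited (t ∷ ts) = there (r-visited ts)

    tree-unique : ∀ {ts} → Grown ts → Unique ts
    tree-unique []           = []
    tree-unique (grow a b g) = Unique-∷ (λ t∈ → b (proj₂ (ends-visited g t∈))) (tree-unique g)

    tree-unreversed : ∀ {ts d e} → Grown ts → d ∈ˡ ts → e ∈ˡ ts → d ≢ α e
    tree-unreversed g (here refl) (here refl) eq = α-nofix _ (sym eq)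
    tree-unreversed (grow a b g) (here refl) (there e∈) refl =
      b (subst (λ z → node z ∈ˡ _) (sym (α-invol _)) (proj₁ (ends-visited g e∈)))
    tree-unreversed (grow a b g) (there d∈) (here refl) refl = b (proj₁ (ends-visited g d∈))
    tree-unreversed (grow a b g) (there d∈) (there e∈) eq = tree-unreversed g d∈ e∈ eq

    edges : List (Dart nv) → List (Dart nv)
    edges ts = ts ++ map α ts

    ∈-edges : ∀ {ts d} → d ∈ˡ edges ts → d ∈ˡ ts ⊎ α d ∈ˡ ts
    ∈-edges {ts} d∈ with ∈-++⁻ ts d∈
    ... | inj₁ p = inj₁ p
    ... | inj₂ q with ∈-map⁻ α q
    ... | e , e∈ , refl = inj₂ (subst (_∈ˡ ts) (sym (α-invol e)) e∈)

    edges-unique : ∀ {ts} → Grown ts → Unique (edges ts)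
    edges-unique g = Unique-++ (tree-unique g) (Uniqueₚ.map⁺ α-injective (tree-unique g)) disjoint
      where
      disjoint : ∀ {x} → x ∈ˡ _ → x ∈ˡ map α _ → ⊥
      disjoint x∈ y∈ with ∈-map⁻ α y∈
      ... | e , e∈ , eq = tree-unreversed g x∈ e∈ eq

    span : {P : Dart nv → Set} → (∀ d → Dec (P d)) →
      (∀ vs → r ∈ˡ vs → (∀ d → P d → node d ∈ˡ vs → node (α d) ∈ˡ vs) → ∀ x → x ∈ˡ vs) →
      ∃ λ ts → Grown ts × All P ts × (∀ x → x ∈ˡ visited ts)
    span {P} P? conn = extend N [] [] [] (≤-reflexive (sym (+-identityʳ N)))
      where
      extend : ∀ fuel ts → Grown ts → All P ts → N ≤ fuel + length ts →
        ∃ λ ts → Grown ts × All P ts × (∀ x → x ∈ˡ visited ts)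
      -- Without fuel left the tree has at least N edges, hence more than N distinct nodes.
      extend zero ts g ps N≤ = ⊥-elim (<-irrefl refl (≤-trans (s≤s N≤)
        (≤-trans (≤-reflexive (sym (length-visited ts)))
          (≤-trans (Unique-length-≤ (visited-unique g) (λ {x} _ → ∈-allFin x)) (≤-reflexive (length-tabulate {n = N} id))))))
      extend (suc fuel) ts g ps N≤
        with any-dart? (λ d → P? d ×-dec ((node d ∈ⁿ? visited ts) ×-dec ¬? (node (α d) ∈ⁿ? visited ts)))
      ... | yes (d , p , a , b) = extend fuel (d ∷ ts) (grow a b g) (p ∷ ps) (≤-trans N≤ (≤-reflexive (sym (+-suc fuel _))))
      ... | no none = ts , g , ps , conn (visited ts) (r-visited ts) closed
        where
        closed : ∀ d → P d → node d ∈ˡ visited ts → node (α d) ∈ˡ visited ts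
        closed d p a with node (α d) ∈ⁿ? visited ts
        ... | yes b = b
        ... | no ¬b = ⊥-elim (none (d , p , a , ¬b))

    spanning-length : ∀ {ts} → Grown ts → (∀ x → x ∈ˡ visited ts) → suc (length ts) ≡ N
    spanning-length {ts} g all = trans (sym (length-visited ts)) (trans (≤-antisym
      (Unique-length-≤ (visited-unique g) (λ {x} _ → ∈-allFin x))
      (Unique-length-≤ (Uniqueₚ.allFin⁺ N) (λ {x} _ → all x))) (length-tabulate {n = N} id))

    -- The node attached last is an end of no other tree edge, so evenness there kills the edge attaching it.
    peel : ∀ {ts} → Grown ts → (E : Dart nv → Bool) → (∀ d → E (α d) ≡ E d) →
      (∀ x → ⨁ darts (λ d → does (node d ≟ᶠ x) ∧ E d) ≡ false) →
      (∀ d → E d ≡ true → d ∈ˡ ts ⊎ α d ∈ˡ ts) → ∀ d → E d ≡ false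
    peel [] E symE even supp d with E d in eq
    ... | false = refl
    ... | true with supp d eq
    ... | inj₁ ()
    ... | inj₂ ()
    peel {t ∷ ts} (grow a b g) E symE even supp = peel g E symE even supp′
      where
      x : Fin N
      x = node (α t)
      off : ∀ d → d ≢ α t → (does (node d ≟ᶠ x) ∧ E d) ≡ false
      off d d≢ with node d ≟ᶠ x
      ... | no _ = refl
      ... | yes eq with E d in Ed
      ... | false = refl
      ... | true with supp d Ed
      ... | inj₁ (here refl) = ⊥-elim (b (subst (_∈ˡ visited ts) eq a))
      ... | inj₁ (there d∈)  = ⊥-elim (b (subst (_∈ˡ visited ts) eq (proj₁ (ends-visited g d∈))))
      ... | inj₂ (here αd≡t) = ⊥-elim (d≢ (trans (sym (α-invol d)) (cong α αd≡t)))
      ... | inj₂ (there αd∈) = ⊥-elim (b (subst (_∈ˡ visited ts) (trans (cong node (α-invol d)) eq) (proj₂ (ends-visited g αd∈))))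
      Eαt : E (α t) ≡ false
      Eαt = trans (trans (sym here≡) (sym (⨁-single _ darts-unique (∈-darts (α t)) off))) (even x)
        where
        here≡ : (does (node (α t) ≟ᶠ x) ∧ E (α t)) ≡ E (α t)
        here≡ rewrite dec-true (node (α t) ≟ᶠ x) refl = refl
      supp′ : ∀ d → E d ≡ true → d ∈ˡ ts ⊎ α d ∈ˡ ts
      supp′ d Ed with supp d Ed
      ... | inj₁ (here refl) = ⊥-elim (true≢false (trans (sym Ed) (trans (sym (symE d)) Eαt)))
      ... | inj₁ (there p)   = inj₁ p
      ... | inj₂ (here refl) = ⊥-elim (true≢false (trans (sym Ed) (trans (cong E (sym (α-invol d))) Eαt)))
      ... | inj₂ (there p)   = inj₂ p

    -- Differences can be prescribed freely along a tree, since each edge attaches a node that has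
    -- no value yet.
    potential : ∀ {ts} → Grown ts → (E : Dart nv → Bool) →
      ∃ λ (S : Fin N → Bool) → ∀ t → t ∈ˡ ts → S (node t) xor S (node (α t)) ≡ E t
    potential [] E = (λ _ → false) , λ _ ()
    potential {t ∷ ts} (grow a b g) E with potential g E
    ... | S , good = S′ , good′
      where
      S′ : Fin N → Bool
      S′ x with x ≟ᶠ node (α t)
      ... | yes _ = S (node t) xor E t
      ... | no  _ = S x
      old : ∀ {x} → x ∈ˡ visited ts → S′ x ≡ S x
      old {x} x∈ with x ≟ᶠ node (α t)
      ... | yes refl = ⊥-elim (b x∈)
      ... | no  _    = refl
      new : S′ (node (α t)) ≡ S (node t) xor E t
      new with node (α t) ≟ᶠ node (α t)
      ... | yes _ = refl
      ... | no ne = ⊥-elim (ne refl)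
      good′ : ∀ u → u ∈ˡ t ∷ ts → S′ (node u) xor S′ (node (α u)) ≡ E u
      good′ u (here refl) = trans (cong₂ _xor_ (old a) new)
        (trans (sym (xor-assoc (S (node t)) _ _)) (cong (_xor E t) (xor-same (S (node t)))))
      good′ u (there u∈) with ends-visited g u∈
      ... | p , q = trans (cong₂ _xor_ (old p) (old q)) (good u u∈)

  -- A spanning tree of the dual map and a spanning tree of the remaining edges: by Euler's formula there are
  -- no further edges.
  module Tree-cotree (v₀ : Fin nv) where
    module F = Tree face (face (v₀ , 0F))
    module V = Tree tl v₀

    cotree : ∃ λ ts → F.Grown ts × All (λ _ → Dart nv) ts × (∀ x → x ∈ˡ F.visited ts)
    cotree = F.span (λ d → yes d) conn
      where
      conn : ∀ vs → face (v₀ , 0F) ∈ˡ vs → (∀ d → Dart nv → face d ∈ˡ vs → face (α d) ∈ˡ vs) → ∀ x → x ∈ˡ vs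
      conn vs r∈ closed x with face-surj x
      ... | d , refl = does-true (face d F.∈ⁿ? vs) (trans (const d) (dec-true (face (v₀ , 0F) F.∈ⁿ? vs) r∈))
        where
        -- Membership of the face survives `α` by closure and then also `σ`; so it depends on the
        -- tail only, and `connected` makes it constant.
        G : Dart nv → Bool
        G d = does (face d F.∈ⁿ? vs)
        Gα : ∀ d → G (α d) ≡ G d
        Gα d with face d F.∈ⁿ? vs | face (α d) F.∈ⁿ? vs
        ... | yes _ | yes _ = refl
        ... | no  _ | no  _ = refl
        ... | yes p | no ¬q = ⊥-elim (¬q (closed d d p))
        ... | no ¬p | yes q = ⊥-elim (¬p (subst (λ z → face z ∈ˡ vs) (α-invol d) (closed (α d) d q)))
        Gσ : ∀ d → G (σ d) ≡ G d
        Gσ d = trans (cong (λ z → G (σ z)) (sym (α-invol d)))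
          (trans (cong (λ z → does (z F.∈ⁿ? vs)) (face-σα (α d))) (Gα d))
        base : ∀ d → G d ≡ G (tl d , 0F)
        base d with around (tl d , 0F) d refl
        ... | inj₁ eq               = cong G eq
        ... | inj₂ (inj₁ eq)        = trans (cong G eq) (Gσ _)
        ... | inj₂ (inj₂ (inj₁ eq)) = trans (cong G eq) (trans (Gσ _) (Gσ _))
        ... | inj₂ (inj₂ (inj₂ eq)) = trans (cong G eq) (trans (Gσ _) (trans (Gσ _) (Gσ _)))
        const : ∀ d → G d ≡ G (v₀ , 0F)
        const d = trans (base d) (connected (λ v → G (v , 0F))
          (λ e → trans (sym (base e)) (trans (sym (Gα e)) (base (α e)))) (tl d) v₀)

    T* : List (Dart nv)
    T* = proj₁ cotree
    grown* : F.Grown T*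
    grown* = proj₁ (proj₂ cotree)

    Allowed : Dart nv → Set
    Allowed d = d ∉ˡ T* × α d ∉ˡ T*

    -- A vertex cut crosses every face boundary evenly, so it cannot lie inside the cotree.
    tree : ∃ λ ts → V.Grown ts × All Allowed ts × (∀ x → x ∈ˡ V.visited ts)
    tree = V.span (λ d → ¬? (d ∈ᵈ? T*) ×-dec ¬? (α d ∈ᵈ? T*)) conn
      where
      conn : ∀ vs → v₀ ∈ˡ vs → (∀ d → Allowed d → tl d ∈ˡ vs → hd d ∈ˡ vs) → ∀ x → x ∈ˡ vs
      conn vs r∈ closed x = does-true (x V.∈ⁿ? vs) (trans (connected U same x v₀) (dec-true (v₀ V.∈ⁿ? vs) r∈))
        where
        U : Fin nv → Bool
        U v = does (v V.∈ⁿ? vs)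
        E : Dart nv → Bool
        E d = U (tl d) xor U (hd d)
        symE : ∀ d → E (α d) ≡ E d
        symE d = trans (cong (λ z → U (hd d) xor U (tl z)) (α-invol d)) (xor-comm (U (hd d)) (U (tl d)))
        even : ∀ y → ⨁ darts (λ d → does (face d ≟ᶠ y) ∧ E d) ≡ false
        even y = begin
          ⨁ darts (λ d → does (face d ≟ᶠ y) ∧ E d)
            ≡⟨ ⨁-cong darts split ⟩
          ⨁ darts (λ d → g d xor g (σ (α d)))
            ≡⟨ ⨁-xor darts g _ ⟩
          ⨁ darts g xor ⨁ darts (λ d → g (σ (α d)))
            ≡⟨ cong (⨁ darts g xor_) (⨁-reindex (λ d → σ (α d)) (λ d → α (σ (σ (σ d))))
                 (λ d → trans (cong α (σ⁴ (α d))) (α-invol d))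
                 (λ d → trans (cong σ (α-invol _)) (σ⁴ d)) g) ⟩
          ⨁ darts g xor ⨁ darts g
            ≡⟨ xor-same (⨁ darts g) ⟩
          false ∎
          where
          open ≡-Reasoning
          g : Dart nv → Bool
          g d = does (face d ≟ᶠ y) ∧ U (tl d)
          ∧-xor : ∀ a b c → a ∧ (b xor c) ≡ (a ∧ b) xor (a ∧ c)
          ∧-xor true  b c = refl
          ∧-xor false b c = refl
          split : ∀ d → (does (face d ≟ᶠ y) ∧ E d) ≡ g d xor g (σ (α d))
          split d = trans (∧-xor (does (face d ≟ᶠ y)) (U (tl d)) (U (hd d)))
            (cong (λ z → g d xor (does (z ≟ᶠ y) ∧ U (hd d))) (sym (face-σα d)))
        supp : ∀ d → E d ≡ true → d ∈ˡ T* ⊎ α d ∈ˡ T*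
        supp d Ed with d ∈ᵈ? T* | α d ∈ᵈ? T*
        ... | yes p | _     = inj₁ p
        ... | no _  | yes q = inj₂ q
        ... | no ¬p | no ¬q with tl d V.∈ⁿ? vs | hd d V.∈ⁿ? vs
        ... | yes a | yes b = ⊥-elim (true≢false (sym Ed))
        ... | no _  | no _  = ⊥-elim (true≢false (sym Ed))
        ... | yes a | no ¬b = ⊥-elim (¬b (closed d (¬p , ¬q) a))
        ... | no ¬a | yes b = ⊥-elim (¬a (subst (λ z → tl z ∈ˡ vs) (α-invol d)
                (closed (α d) (¬q , λ m → ¬p (subst (_∈ˡ T*) (α-invol d) m)) b)))
        same : ∀ d → U (tl d) ≡ U (hd d)
        same d = xor-≡ (F.peel grown* E symE even supp d)

    T₁ : List (Dart nv)
    T₁ = proj₁ tree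
    grown₁ : V.Grown T₁
    grown₁ = proj₁ (proj₂ tree)

    -- The cotree has nv + 1 edges by Euler's formula and the tree nv - 1. Being disjoint, together
    -- they have 2(nv + 1) + 2(nv - 1) = 4 nv darts, which is all of them.
    covered : nfaces ≡ nv + 2 → ∀ d → d ∈ˡ F.edges T* ⊎ d ∈ˡ V.edges T₁
    covered euler d with d ∈ᵈ? (F.edges T* ++ V.edges T₁)
    ... | yes d∈ = ∈-++⁻ (F.edges T*) d∈
    ... | no d∉ = ⊥-elim (<-irrefl refl (≤-trans (≤-reflexive (cong suc (sym total)))
        (≤-trans (Unique-length-≤ {ys = darts} (Unique-∷ d∉ unique) (λ {x} _ → ∈-darts x)) (≤-reflexive length-darts))))
      where
      allowed : ∀ {e} → e ∈ˡ V.edges T₁ → Allowed e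
      allowed {e} e∈ with V.∈-edges e∈
      ... | inj₁ p = All.lookup (proj₁ (proj₂ (proj₂ tree))) p
      ... | inj₂ q with All.lookup (proj₁ (proj₂ (proj₂ tree))) q
      ... | a , b = (λ m → b (subst (_∈ˡ T*) (sym (α-invol e)) m)) , a
      unique : Unique (F.edges T* ++ V.edges T₁)
      unique = Unique-++ (F.edges-unique grown*) (V.edges-unique grown₁) disjoint
        where
        disjoint : ∀ {x} → x ∈ˡ F.edges T* → x ∈ˡ V.edges T₁ → ⊥
        disjoint x∈ y∈ with F.∈-edges x∈ | allowed y∈
        ... | inj₁ p | a , b = a p
        ... | inj₂ q | a , b = b q
      length-edges : (ts : List (Dart nv)) → length (ts ++ map α ts) ≡ length ts + length ts
      length-edges ts = trans (length-++ ts) (cong (length ts +_) (length-map α ts))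
      len* : suc (length T*) ≡ suc (suc nv)
      len* = trans (F.spanning-length grown* (proj₂ (proj₂ (proj₂ cotree)))) (trans euler (+-comm nv 2))
      len₁ : suc (length T₁) ≡ nv
      len₁ = V.spanning-length grown₁ (proj₂ (proj₂ (proj₂ tree)))
      arith : ∀ l → (suc (suc l) + suc (suc l)) + (l + l) ≡ suc l * 4
      arith = solve 1 (λ l → ((con 2 :+ l) :+ (con 2 :+ l)) :+ (l :+ l) := (con 1 :+ l) :* con 4) refl
        where open +-*-Solver
      total : length (F.edges T* ++ V.edges T₁) ≡ nv * 4
      total = begin
        length (F.edges T* ++ V.edges T₁)
          ≡⟨ length-++ (F.edges T*) ⟩
        length (F.edges T*) + length (V.edges T₁)
          ≡⟨ cong₂ _+_ (length-edges T*) (length-edges T₁) ⟩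
        (length T* + length T*) + (length T₁ + length T₁)
          ≡⟨ cong (λ z → (z + z) + (length T₁ + length T₁)) (trans (suc-injective len*) (cong suc (sym len₁))) ⟩
        (suc (suc (length T₁)) + suc (suc (length T₁))) + (length T₁ + length T₁)
          ≡⟨ arith (length T₁) ⟩
        suc (length T₁) * 4
          ≡⟨ cong (_* 4) len₁ ⟩
        nv * 4 ∎
        where open ≡-Reasoning

  around-xor-σ : (g : Dart nv → Bool) → ∀ v → around-sum (λ d → g d xor g (σ d)) v ≡ false
  around-xor-σ g v = brute (g (v , 0F)) (g (v , 1F)) (g (v , 2F)) (g (v , 3F))
    where
    brute : ∀ a b c d → (a xor b) xor ((b xor c) xor ((c xor d) xor ((d xor a) xor false))) ≡ false
    brute a b c d = trans (cong (λ z → (a xor b) xor ((b xor c) xor z)) (trans (cong ((c xor d) xor_) (xor-identityʳ _)) (chain c d a)))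
      (trans (cong ((a xor b) xor_) (chain b c a)) (trans (chain a b a) (xor-same a)))
      where
      chain : ∀ x y z → (x xor y) xor (y xor z) ≡ x xor z
      chain x y z = trans (xor-assoc x y _) (cong (x xor_) (trans (sym (xor-assoc y y z)) (cong (_xor z) (xor-same y))))

  -- Every even set of edges bounds a set of faces: the vanishing of the first homology of the sphere.
  abstract
    bounds : (E : Dart nv → Bool) → (∀ d → E (α d) ≡ E d) → (∀ v → around-sum E v ≡ false) →
      ∃ λ (S : Dart nv → Bool) → (∀ d → S (σ (α d)) ≡ S d) × (∀ d → S d xor S (σ d) ≡ E d)
    bounds E symE even with any? (λ (v : Fin nv) → yes v)
    ... | no none = E , (λ d → ⊥-elim (none (tl d , tl d))) , (λ d → ⊥-elim (none (tl d , tl d)))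
    ... | yes (v₀ , _) with spherical
    ... | inj₁ nv≡0 = ⊥-elim (case subst Fin nv≡0 v₀ of λ ())
    ... | inj₂ euler = S , S-face , λ d → sym (xor-≡ (E″≡false d))
      where
      open Tree-cotree v₀
      pot : ∃ λ (P : Fin nfaces → Bool) → ∀ t → t ∈ˡ T* → P (face t) xor P (face (α t)) ≡ E t
      pot = F.potential grown* E
      S : Dart nv → Bool
      S d = proj₁ pot (face d)
      S-face : ∀ d → S (σ (α d)) ≡ S d
      S-face d = cong (proj₁ pot) (face-σα d)
      S-α : ∀ d → S (α d) ≡ S (σ d)
      S-α d = trans (sym (S-face (α d))) (cong (λ z → S (σ z)) (α-invol d))
      -- `S` was chosen so that its boundary agrees with `E` on the cotree. The difference is still
      -- even, is supported on the tree, and is therefore peeled away to nothing.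
      E″ : Dart nv → Bool
      E″ d = E d xor (S d xor S (σ d))
      S-sym : ∀ d → S (α d) xor S (σ (α d)) ≡ S d xor S (σ d)
      S-sym d = trans (cong₂ _xor_ (S-α d) (S-face d)) (xor-comm (S (σ d)) (S d))
      symE″ : ∀ d → E″ (α d) ≡ E″ d
      symE″ d = cong₂ _xor_ (symE d) (S-sym d)
      on-cotree : ∀ d → d ∈ˡ T* → E″ d ≡ false
      on-cotree d d∈ = trans (cong (E d xor_) (trans (cong (S d xor_) (sym (S-α d))) (proj₂ pot d d∈))) (xor-same (E d))
      supp : ∀ d → E″ d ≡ true → d ∈ˡ T₁ ⊎ α d ∈ˡ T₁
      supp d Ed with covered euler d
      ... | inj₂ d∈ = V.∈-edges d∈
      ... | inj₁ d∈ with F.∈-edges d∈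
      ... | inj₁ p = ⊥-elim (true≢false (trans (sym Ed) (on-cotree d p)))
      ... | inj₂ q = ⊥-elim (true≢false (trans (sym Ed) (trans (sym (symE″ d)) (on-cotree (α d) q))))
      even″ : ∀ v → ⨁ darts (λ d → does (tl d ≟ᶠ v) ∧ E″ d) ≡ false
      even″ v = trans (⨁-darts-at E″ v) (trans (⨁-xor (allFin 4) (λ i → E (v , i)) (λ i → S (v , i) xor S (σ (v , i))))
        (cong₂ _xor_ (even v) (around-xor-σ S v)))
      E″≡false : ∀ d → E″ d ≡ false
      E″≡false = V.peel grown₁ E″ symE″ even″ supp

-- Curves, paths and the two sides of a closed walk

module Walks {n : ℕ} (A : Arrangement n) where
  open Planar A public

  Through : Fin n → Fin nv → Set
  Through c v = ∃ λ d → tl d ≡ v × curve d ≡ c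

  -- By 4-regularity at most two half-edges at `v` lead into P, so a colour out of three stays free
  -- for `v`.
  Low : (Fin nv → Bool) → Fin nv → Set
  Low P v = ∃₂ λ d e → tl d ≡ v × tl e ≡ v × d ≢ e × P (hd d) ≡ false × P (hd e) ≡ false

  low? : ∀ P v → Dec (Low P v)
  low? P v = any-dart? (λ d → any-dart? (λ e →
    (tl d ≟ᶠ v) ×-dec ((tl e ≟ᶠ v) ×-dec (¬? (d ≟ᵈ e) ×-dec ((P (hd d) ≟ᵇ false) ×-dec (P (hd e) ≟ᵇ false))))))

  curve-σ≢ : ∀ d → curve (σ d) ≢ curve d
  curve-σ≢ (v , 0F) eq = two-curves v (sym eq)
  curve-σ≢ (v , 1F) eq = two-curves v (trans (sym (curve-opp (v , 0F))) eq)
  curve-σ≢ (v , 2F) eq = two-curves v (trans (sym (curve-opp (v , 0F))) (trans (sym eq) (curve-opp (v , 1F))))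
  curve-σ≢ (v , 3F) eq = two-curves v (trans eq (curve-opp (v , 1F)))

  curve-σ³≢ : ∀ d → curve (σ (σ (σ d))) ≢ curve d
  curve-σ³≢ d eq = curve-σ≢ d (trans (sym (curve-opp (σ d))) eq)

  same-strand : ∀ {d e} → tl e ≡ tl d → curve e ≡ curve d → e ≡ d ⊎ e ≡ opp d
  same-strand {d} {e} t c with around d e t
  ... | inj₁ eq                 = inj₁ eq
  ... | inj₂ (inj₁ refl)        = ⊥-elim (curve-σ≢ d c)
  ... | inj₂ (inj₂ (inj₁ eq))   = inj₂ eq
  ... | inj₂ (inj₂ (inj₂ refl)) = ⊥-elim (curve-σ³≢ d c)

  base-curve : ∀ d → curve d ≡ curve (tl d , 0F) ⊎ curve d ≡ curve (tl d , 1F)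
  base-curve (v , 0F) = inj₁ refl
  base-curve (v , 1F) = inj₂ refl
  base-curve (v , 2F) = inj₁ (curve-opp (v , 0F))
  base-curve (v , 3F) = inj₂ (curve-opp (v , 1F))

  through-meets : ∀ {c c′ v} → c ≢ c′ → Through c v → Through c′ v → Meets curve c c′ v
  through-meets ne (d , refl , refl) (e , te , refl) with base-curve d | base-curve e
  ... | inj₁ p | inj₁ q = ⊥-elim (ne (trans p (trans (cong (λ z → curve (z , 0F)) (sym te)) (sym q))))
  ... | inj₂ p | inj₂ q = ⊥-elim (ne (trans p (trans (cong (λ z → curve (z , 1F)) (sym te)) (sym q))))
  ... | inj₁ p | inj₂ q = inj₁ (sym p , trans (cong (λ z → curve (z , 1F)) (sym te)) (sym q))
  ... | inj₂ p | inj₁ q = inj₂ (trans (cong (λ z → curve (z , 0F)) (sym te)) (sym q) , sym p)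

  no-three : ∀ {c c′ x y z} → c ≢ c′ → x ≢ y → x ≢ z → y ≢ z →
    Through c x → Through c′ x → Through c y → Through c′ y → Through c z → Through c′ z → ⊥
  no-three {c} {c′} ne xy xz yz x x′ y y′ z z′ with crosses-twice c c′ ne
  ... | u , w , _ , _ , _ , only
    with only _ (through-meets ne x x′) | only _ (through-meets ne y y′) | only _ (through-meets ne z z′)
  ... | inj₁ a | inj₁ b | _      = xy (trans a (sym b))
  ... | inj₂ a | inj₂ b | _      = xy (trans a (sym b))
  ... | inj₁ a | inj₂ b | inj₁ c = xz (trans a (sym c))
  ... | inj₁ a | inj₂ b | inj₂ c = yz (trans b (sym c))
  ... | inj₂ a | inj₁ b | inj₁ c = yz (trans b (sym c))
  ... | inj₂ a | inj₁ b | inj₂ c = xz (trans a (sym c))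

  τ-injective : ∀ {d e} → τ d ≡ τ e → d ≡ e
  τ-injective eq = α-injective (σ-injective (σ-injective eq))

  -- A traversal of a curve never comes back in the opposite direction: τ and the reversal generate a
  -- dihedral action, and a reversed return would force a fixed point of opp or α in the middle.
  iter≢opp : ∀ k d → iter τ k d ≢ opp d
  iter≢opp zero d eq = opp≢ d (sym eq)
  iter≢opp (suc zero) d eq = α-nofix d (σ-injective (σ-injective eq))
  iter≢opp (suc (suc k)) d eq = iter≢opp k (τ d) (trans (trans (iter-shift τ k d) back) (sym (opp-opp (α d))))
    where
    back : iter τ (suc k) d ≡ α d
    back = trans (sym (α-invol _)) (cong α (σ-injective (σ-injective eq)))

  iter≢opp-iter : ∀ i j d → iter τ i d ≢ opp (iter τ j d)
  iter≢opp-iter i j d eq with ≤-total j i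
  ... | inj₁ j≤i = iter≢opp (i ∸ j) (iter τ j d)
          (trans (sym (iter-+ τ (i ∸ j) j d)) (trans (cong (λ m → iter τ m d) (m∸n+n≡m j≤i)) eq))
  ... | inj₂ i≤j = iter≢opp (j ∸ i) (iter τ i d)
          (trans (sym (iter-+ τ (j ∸ i) i d)) (trans (cong (λ m → iter τ m d) (m∸n+n≡m i≤j))
            (trans (sym (opp-opp _)) (cong opp (sym eq)))))

  reach : ∀ d e → curve d ≡ curve e → ∃ λ k → tl (iter τ k d) ≡ tl e
  reach d e eq with curve-closed d e eq | curve-closed d (opp e) (trans eq (sym (curve-opp e)))
  ... | inj₁ (k , p) | _            = k , cong tl p
  ... | inj₂ _       | inj₁ (k , q) = k , cong tl q
  ... | inj₂ (k , p) | inj₂ (l , q) = ⊥-elim (iter≢opp-iter l k (opp d) (trans q (cong opp (sym p))))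

  data Path : Fin nv → List (Dart nv) → Fin nv → Set where
    []  : ∀ {u} → Path u [] u
    _∷_ : ∀ {u v d w} → tl d ≡ u → Path (hd d) w v → Path u (d ∷ w) v

  path-++ : ∀ {u v x w w′} → Path u w v → Path v w′ x → Path u (w ++ w′) x
  path-++ []      q = q
  path-++ (t ∷ p) q = t ∷ path-++ p q

  path-split : ∀ {u v} w {w′} → Path u (w ++ w′) v → ∃ λ x → Path u w x × Path x w′ v
  path-split []      p       = _ , [] , p
  path-split (d ∷ w) (t ∷ p) with path-split w p
  ... | x , q , r = x , t ∷ q , r

  path-start : ∀ {u v d w} → Path u (d ∷ w) v → tl d ≡ u
  path-start (t ∷ _) = t

  path-last : ∀ {u v} w {d} → Path u (w ++ [ d ]) v → hd d ≡ v
  path-last []      (_ ∷ []) = refl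
  path-last (x ∷ w) (_ ∷ p)  = path-last w p

  tails : List (Dart nv) → List (Fin nv)
  tails = map tl

  ∈-tails : ∀ {v w} → v ∈ˡ tails w → ∃ λ d → d ∈ˡ w × v ≡ tl d
  ∈-tails = ∈-map⁻ tl

  tails⁺ : ∀ {d w} → d ∈ˡ w → tl d ∈ˡ tails w
  tails⁺ = ∈-map⁺ tl

  tails-split : ∀ {v} w → v ∈ˡ tails w → ∃ λ w₁ → ∃ λ d → ∃ λ w₂ → w ≡ w₁ ++ d ∷ w₂ × tl d ≡ v
  tails-split w v∈ with ∈-tails v∈
  ... | d , d∈ , eq with ∈-∃++ d∈
  ... | w₁ , w₂ , eq′ = w₁ , d , w₂ , eq′ , sym eq

  tails-++ : ∀ w {w′} → tails (w ++ w′) ≡ tails w ++ tails w′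
  tails-++ w = map-++ tl w _

  heads-shift : ∀ {u v d w} → Path u (d ∷ w) v → map hd (d ∷ w) ≡ tails w ++ [ v ]
  heads-shift (_ ∷ [])      = refl
  heads-shift (_ ∷ (t ∷ p)) = cong₂ _∷_ (sym t) (heads-shift (t ∷ p))

  heads-unique : ∀ {u w} → Path u w u → Unique (tails w) → Unique (map hd w)
  heads-unique []      u = []
  heads-unique {w = d ∷ w} (refl ∷ p) u =
    subst Unique (sym (heads-shift {d = d} (refl ∷ p))) (Unique-rotate [ tl d ] u)

  head-in-tails : ∀ {u w d} → Path u w u → d ∈ˡ w → hd d ∈ˡ tails w
  head-in-tails {w = d ∷ w} (refl ∷ p) d∈ with ∈-++⁻ (tails w) (subst (_ ∈ˡ_) (heads-shift {d = d} (refl ∷ p)) (∈-map⁺ hd d∈))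
  ... | inj₁ q           = there q
  ... | inj₂ (here refl) = here refl

  fwd : Dart nv → ℕ → List (Dart nv)
  fwd g zero    = []
  fwd g (suc k) = g ∷ fwd (τ g) k

  path-fwd : ∀ g k → Path (tl g) (fwd g k) (tl (iter τ k g))
  path-fwd g zero    = []
  path-fwd g (suc k) = refl ∷ subst (Path (hd g) (fwd (τ g) k)) (cong tl (iter-shift τ k g)) (path-fwd (τ g) k)

  ∈-fwd⁻ : ∀ {d} g k → d ∈ˡ fwd g k → ∃ λ i → i < k × d ≡ iter τ i g
  ∈-fwd⁻ g (suc k) (here refl) = 0 , s≤s z≤n , refl
  ∈-fwd⁻ g (suc k) (there d∈) with ∈-fwd⁻ (τ g) k d∈
  ... | i , i<k , eq = suc i , s≤s i<k , trans eq (iter-shift τ i g)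

  ∈-fwd⁺ : ∀ g {i} k → i < k → iter τ i g ∈ˡ fwd g k
  ∈-fwd⁺ g {zero}  (suc k) _         = here refl
  ∈-fwd⁺ g {suc i} (suc k) (s≤s i<k) = there (subst (_∈ˡ fwd (τ g) k) (iter-shift τ i g) (∈-fwd⁺ (τ g) k i<k))

  fwd-snoc : ∀ g k → fwd g (suc k) ≡ fwd g k ++ [ iter τ k g ]
  fwd-snoc g zero    = refl
  fwd-snoc g (suc k) = cong (g ∷_) (trans (fwd-snoc (τ g) k) (cong (λ z → fwd (τ g) k ++ [ z ]) (iter-shift τ k g)))

  tails-fwd-unique : ∀ g k → (∀ i j → i < j → j < k → tl (iter τ i g) ≢ tl (iter τ j g)) → Unique (tails (fwd g k))
  tails-fwd-unique g zero    ne = []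
  tails-fwd-unique g (suc k) ne = Unique-∷ fresh
    (tails-fwd-unique (τ g) k (λ i j i<j j<k eq → ne (suc i) (suc j) (s≤s i<j) (s≤s j<k)
      (trans (sym (cong tl (iter-shift τ i g))) (trans eq (cong tl (iter-shift τ j g))))))
    where
    fresh : tl g ∉ˡ tails (fwd (τ g) k)
    fresh t∈ with ∈-tails t∈
    ... | d , d∈ , eq with ∈-fwd⁻ (τ g) k d∈
    ... | j , j<k , refl = ne 0 (suc j) (s≤s z≤n) (s≤s j<k) (trans eq (cong tl (iter-shift τ j g)))

  -- Straight on, or a right turn, which leaves three quarters of the corner on the left.
  Turn : Dart nv → Dart nv → Set
  Turn d e = e ≡ τ d ⊎ e ≡ σ (σ (σ (α d)))

  Turn⇒≢α : ∀ {d e} → Turn d e → e ≢ α d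
  Turn⇒≢α (inj₁ refl) = opp≢ _
  Turn⇒≢α (inj₂ refl) = σ³≢ _

  fwd-turns : ∀ g k → Linked Turn (fwd g k)
  fwd-turns g zero          = []
  fwd-turns g (suc zero)    = [-]
  fwd-turns g (suc (suc k)) = inj₁ refl ∷ fwd-turns (τ g) (suc k)

  -- The reversal of `d` starts at `hd d`, as does the successor of `d`. Tails being distinct, it
  -- would be that successor, but no turn goes straight back.
  unreversed : ∀ {u v w} → Path u w v → Unique (tails w) → Linked Turn w → ∀ {d} → d ∈ˡ w → α d ∉ˡ w
  unreversed {w = d ∷ w} (t ∷ p) (t∉ ∷ u) l = go
    where
    next : ∀ {v w} → Path (hd d) w v → Unique (tails w) → Linked Turn (d ∷ w) → α d ∉ˡ w
    next (t′ ∷ p′) u (r ∷ _) αd∈ = Turn⇒≢α r (Unique-map-injective u (here refl) αd∈ t′)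
    not-next : α d ∉ˡ w
    not-next = next p u l
    go : ∀ {x} → x ∈ˡ d ∷ w → α x ∉ˡ d ∷ w
    go (here refl) (here eq)  = α-nofix d eq
    go (here refl) (there αd∈) = not-next αd∈
    go (there x∈)  (here refl) = not-next (subst (_∈ˡ w) (sym (α-invol _)) x∈)
    go (there x∈)  (there αx∈) = unreversed p u (Linked-tail l) x∈ αx∈

  record Separation (w : List (Dart nv)) : Set where
    field
      S     : Dart nv → Bool
      face′ : ∀ d → S (σ (α d)) ≡ S d
      left  : ∀ {d} → d ∈ˡ w → S d ≡ true
      right : ∀ {d} → d ∈ˡ w → S (σ d) ≡ false
      flat  : ∀ {d} → d ∉ˡ w → α d ∉ˡ w → S (σ d) ≡ S d

  module _ (w : List (Dart nv)) {u : Fin nv} (p : Path u w u) (uniq : Unique (tails w))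
    (unrev : ∀ {d} → d ∈ˡ w → α d ∉ˡ w) where
    private
      occ : Dart nv → Bool
      occ d = ⨁ w (λ x → does (d ≟ᵈ x))

      occ-∈ : ∀ {d} → d ∈ˡ w → occ d ≡ true
      occ-∈ {d} d∈ = trans (⨁-single _ (Uniqueₚ.map⁻ uniq) d∈ (λ y y≢ → dec-false (d ≟ᵈ y) (y≢ ∘ sym))) (dec-true (d ≟ᵈ d) refl)

      occ-∉ : ∀ {d} → d ∉ˡ w → occ d ≡ false
      occ-∉ {d} d∉ = ⨁-false w (λ x x∈ → dec-false (d ≟ᵈ x) (λ { refl → d∉ x∈ }))

      E : Dart nv → Bool
      E d = occ d xor occ (α d)

      symE : ∀ d → E (α d) ≡ E d
      symE d = trans (cong (λ z → occ (α d) xor occ z) (α-invol d)) (xor-comm (occ (α d)) (occ d))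

      ≟-flip : ∀ d x → does (α d ≟ᵈ x) ≡ does (d ≟ᵈ α x)
      ≟-flip d x with α d ≟ᵈ x
      ... | yes refl = sym (dec-true (d ≟ᵈ α (α d)) (sym (α-invol d)))
      ... | no ne    = sym (dec-false (d ≟ᵈ α x) (λ { refl → ne (α-invol x) }))

      at-vertex : ∀ v x → around-sum (λ d → does (d ≟ᵈ x)) v ≡ does (tl x ≟ᶠ v)
      at-vertex v (x , i) with x ≟ᶠ v
      ... | yes refl = trans (⨁-single (λ j → does ((x , j) ≟ᵈ (x , i))) (Uniqueₚ.allFin⁺ 4) (∈-allFin i)
                         (λ j j≢ → dec-false ((x , j) ≟ᵈ (x , i)) (λ { refl → j≢ refl }))) (dec-true ((x , i) ≟ᵈ (x , i)) refl)
      ... | no ne = ⨁-false (allFin 4) (λ j _ → dec-false ((v , j) ≟ᵈ (x , i)) (λ { refl → ne refl }))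

      telescope : ∀ {a b} w′ v → Path a w′ b →
        ⨁ w′ (λ x → does (tl x ≟ᶠ v) xor does (hd x ≟ᶠ v)) ≡ does (a ≟ᶠ v) xor does (b ≟ᶠ v)
      telescope {a} [] v [] = sym (xor-same (does (a ≟ᶠ v)))
      telescope {b = b} (x ∷ w′) v (refl ∷ q) = trans (cong ((does (tl x ≟ᶠ v) xor does (hd x ≟ᶠ v)) xor_) (telescope w′ v q))
        (trans (xor-assoc (does (tl x ≟ᶠ v)) _ _) (cong (does (tl x ≟ᶠ v) xor_)
          (trans (sym (xor-assoc (does (hd x ≟ᶠ v)) _ _)) (cong (_xor does (b ≟ᶠ v)) (xor-same (does (hd x ≟ᶠ v)))))))

      -- Each dart of the walk contributes to its two ends, so the sum telescopes along the closed
      -- walk.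
      even : ∀ v → around-sum E v ≡ false
      even v = begin
        around-sum E v
          ≡⟨ ⨁-xor (allFin 4) (λ i → occ (v , i)) (λ i → occ (α (v , i))) ⟩
        around-sum occ v xor around-sum (λ d → occ (α d)) v
          ≡⟨ cong₂ _xor_ (⨁-swap (allFin 4) w (λ i x → does ((v , i) ≟ᵈ x)))
               (trans (⨁-swap (allFin 4) w (λ i x → does (α (v , i) ≟ᵈ x)))
               (⨁-cong w (λ x → ⨁-cong (allFin 4) (λ i → ≟-flip (v , i) x)))) ⟩
        ⨁ w (λ x → around-sum (λ d → does (d ≟ᵈ x)) v) xor ⨁ w (λ x → around-sum (λ d → does (d ≟ᵈ α x)) v)
          ≡⟨ cong₂ _xor_ (⨁-cong w (at-vertex v)) (⨁-cong w (λ x → at-vertex v (α x))) ⟩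
        ⨁ w (λ x → does (tl x ≟ᶠ v)) xor ⨁ w (λ x → does (hd x ≟ᶠ v))
          ≡⟨ sym (⨁-xor w _ _) ⟩
        ⨁ w (λ x → does (tl x ≟ᶠ v) xor does (hd x ≟ᶠ v))
          ≡⟨ trans (telescope w v p) (xor-same (does (u ≟ᶠ v))) ⟩
        false ∎
        where open ≡-Reasoning

      abstract
        bd : ∃ λ (S : Dart nv → Bool) → (∀ d → S (σ (α d)) ≡ S d) × (∀ d → S d xor S (σ d) ≡ E d)
        bd = bounds E symE even
      S₀ : Dart nv → Bool
      S₀ = proj₁ bd

      jump₀ : ∀ {d} → d ∈ˡ w → S₀ (σ d) ≡ not (S₀ d)
      jump₀ {d} d∈ = xor-≢ (trans (proj₂ (proj₂ bd) d) (cong₂ _xor_ (occ-∈ d∈) (occ-∉ (unrev d∈))))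

      flat₀ : ∀ {d} → d ∉ˡ w → α d ∉ˡ w → S₀ (σ d) ≡ S₀ d
      flat₀ {d} d∉ αd∉ = sym (xor-≡ (trans (proj₂ (proj₂ bd) d) (cong₂ _xor_ (occ-∉ d∉) (occ-∉ αd∉))))

      -- Turning from the arrival `α d` to the departure `e` crosses no further dart of the walk in
      -- either direction, because heads as well as tails are distinct; so `S₀` does not jump in
      -- between.
      next-left : ∀ {d e} → d ∈ˡ w → e ∈ˡ w → tl e ≡ hd d → S₀ e ≡ S₀ d
      next-left {d} {e} d∈ e∈ t with around (α d) e t
      ... | inj₁ refl = ⊥-elim (unrev d∈ e∈)
      ... | inj₂ (inj₁ refl) = proj₁ (proj₂ bd) d
      ... | inj₂ (inj₂ (inj₁ refl)) = trans (flat₀ out in′) (proj₁ (proj₂ bd) d)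
        where
        out : σ (α d) ∉ˡ w
        out m = σ≢ _ (Unique-map-injective uniq e∈ m refl)
        in′ : α (σ (α d)) ∉ˡ w
        in′ m = σ≢ (α d) (trans (sym (α-invol _)) (cong α (Unique-map-injective (heads-unique p uniq) m d∈ (cong tl (α-invol _)))))
      ... | inj₂ (inj₂ (inj₂ refl)) = trans (flat₀ out₂ in₂) (trans (flat₀ out₁ in₁) (proj₁ (proj₂ bd) d))
        where
        out₁ : σ (α d) ∉ˡ w
        out₁ m = opp≢ _ (Unique-map-injective uniq e∈ m refl)
        in₁ : α (σ (α d)) ∉ˡ w
        in₁ m = σ≢ (α d) (trans (sym (α-invol _)) (cong α (Unique-map-injective (heads-unique p uniq) m d∈ (cong tl (α-invol _)))))
        out₂ : σ (σ (α d)) ∉ˡ w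
        out₂ m = σ≢ _ (Unique-map-injective uniq e∈ m refl)
        in₂ : α (σ (σ (α d))) ∉ˡ w
        in₂ m = opp≢ (α d) (trans (sym (α-invol _)) (cong α (Unique-map-injective (heads-unique p uniq) m d∈ (cong tl (α-invol _)))))

      constant : ∀ {a b d w′} → Path a (d ∷ w′) b → (∀ {x} → x ∈ˡ d ∷ w′ → x ∈ˡ w) → ∀ {x} → x ∈ˡ d ∷ w′ → S₀ x ≡ S₀ d
      constant q sub (here refl) = refl
      constant (_ ∷ (t ∷ q)) sub (there x∈) =
        trans (constant (t ∷ q) (sub ∘ there) x∈) (next-left (sub (here refl)) (sub (there (here refl))) t)

    separation : Separation w
    separation = pick w refl
      where
      pick : ∀ w′ → w′ ≡ w → Separation w
      pick [] refl = record { S = S₀ ; face′ = proj₁ (proj₂ bd) ; left = λ () ; right = λ () ; flat = flat₀ }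
      pick (d ∷ w′) refl with S₀ d in Sd
      ... | true = record { S = S₀ ; face′ = proj₁ (proj₂ bd) ; left = λ x∈ → trans (constant p id x∈) Sd
                          ; right = λ x∈ → trans (jump₀ x∈) (cong not (trans (constant p id x∈) Sd)) ; flat = flat₀ }
      -- A bounding set is only determined up to complement; the one on the left of the walk is
      -- taken.
      ... | false = record { S = not ∘ S₀ ; face′ = λ x → cong not (proj₁ (proj₂ bd) x)
                           ; left = λ x∈ → cong not (trans (constant p id x∈) Sd)
                           ; right = λ x∈ → cong not (trans (jump₀ x∈) (cong not (trans (constant p id x∈) Sd)))
                           ; flat = λ a b → cong not (flat₀ a b) }

-- Regions and their short-cuts

module Regions {n : ℕ} (A : Arrangement n) (C : Fin n) where
  open Walks A public

  -- A set of faces, as a Boolean function on darts, whose boundary is one simple closed walk with the set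
  -- on its left, and which contains no face at any vertex of C.
  record Region (w : List (Dart nv)) : Set where
    field
      base   : Fin nv
      path   : Path base w base
      unique : Unique (tails w)
      f      : Dart nv → Bool
      f-face : ∀ d → f (σ (α d)) ≡ f d
      left   : ∀ {d} → d ∈ˡ w → f d ≡ true
      right  : ∀ {d} → d ∈ˡ w → f (σ d) ≡ false
      only   : ∀ {d} → f d ≡ true → f (σ d) ≡ false → d ∈ˡ w
      off-C  : ∀ {d} → Through C (tl d) → f d ≡ false

    f-α : ∀ d → f (α d) ≡ f (σ d)
    f-α d = trans (sym (f-face (α d))) (cong (λ z → f (σ z)) (α-invol d))

    Interior : Dart nv → Set
    Interior d = f d ≡ true × f (σ d) ≡ true

    interior-α : ∀ {d} → Interior d → Interior (α d)
    interior-α (p , q) = trans (f-α _) q , trans (f-face _) p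

    boundary≢interior : ∀ {d} → d ∈ˡ w → ¬ Interior d
    boundary≢interior d∈ (_ , q) = true≢false (trans (sym q) (right d∈))

    α-boundary≢interior : ∀ {d} → α d ∈ˡ w → ¬ Interior d
    α-boundary≢interior αd∈ i = boundary≢interior αd∈ (interior-α i)

    α-boundary : ∀ {d} → d ∈ˡ w → α d ∉ˡ w
    α-boundary d∈ αd∈ = true≢false (trans (sym (left αd∈)) (trans (f-α _) (right d∈)))

    flat : ∀ {d} → d ∉ˡ w → α d ∉ˡ w → f (σ d) ≡ f d
    flat {d} d∉ αd∉ with false-or-true (f d) | false-or-true (f (σ d))
    ... | inj₁ p | inj₁ q = trans q (sym p)
    ... | inj₂ p | inj₂ q = trans q (sym p)
    ... | inj₂ p | inj₁ q = ⊥-elim (d∉ (only p q))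
    ... | inj₁ p | inj₂ q = ⊥-elim (αd∉ (only (trans (f-α d) q) (trans (f-face d) p)))

    flat-off : ∀ {d} → tl d ∉ˡ tails w → f (σ d) ≡ f d
    flat-off {d} t∉ = flat (λ d∈ → t∉ (tails⁺ d∈))
      (λ αd∈ → t∉ (subst (_∈ˡ tails w) (cong tl (α-invol d)) (head-in-tails path αd∈)))

    constant-off : ∀ {d e} → tl e ≡ tl d → tl d ∉ˡ tails w → f e ≡ f d
    constant-off {d} {e} t t∉ with around d e t
    ... | inj₁ refl = refl
    ... | inj₂ (inj₁ refl) = flat-off t∉
    ... | inj₂ (inj₂ (inj₁ refl)) = trans (flat-off {σ d} t∉) (flat-off t∉)
    ... | inj₂ (inj₂ (inj₂ refl)) = trans (flat-off {σ (σ d)} t∉) (trans (flat-off {σ d} t∉) (flat-off t∉))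

    -- At a right turn three quarters of the corner belong to the region, so both straight
    -- extensions start inside. Were the middle quarter missing, a second boundary dart would leave
    -- the same vertex.
    interior-corner : ∀ {d e} → d ∈ˡ w → e ∈ˡ w → e ≡ σ (σ (σ (α d))) → Interior (τ d) × Interior (opp e)
    interior-corner {d} d∈ e∈ refl = (mid , left e∈) , subst Interior (sym (cong σ (σ⁴ (α d)))) (fst , mid)
      where
      fst : f (σ (α d)) ≡ true
      fst = trans (f-face d) (left d∈)
      mid : f (σ (σ (α d))) ≡ true
      mid with false-or-true (f (σ (σ (α d))))
      ... | inj₂ q = q
      ... | inj₁ q = ⊥-elim (opp≢ _ (Unique-map-injective unique e∈ (only fst q) refl))

    Exit : Dart nv → ℕ → Set
    Exit g k = 0 < k × (∀ i → i < k → Interior (iter τ i g))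
      × (∀ i → 0 < i → i < k → tl (iter τ i g) ∉ˡ tails w) × tl (iter τ k g) ∈ˡ tails w

    exit-within : ∀ K g → Interior g → f (iter τ K g) ≡ false → ∃ (Exit g)
    exit-within zero g i out = ⊥-elim (true≢false (trans (sym (proj₁ i)) out))
    exit-within (suc K) g i out with tl (τ g) ∈ᵛ? tails w
    ... | yes t∈ = 1 , s≤s z≤n , (λ { zero _ → i ; (suc _) (s≤s ()) }) , (λ { zero () _ ; (suc _) _ (s≤s ()) }) , t∈
    ... | no t∉ with exit-within K (τ g) next (trans (cong f (iter-shift τ K g)) out)
      where
      next : Interior (τ g)
      next = trans (constant-off {σ (α g)} {τ g} refl t∉) (trans (f-face g) (proj₁ i))
           , trans (constant-off {σ (α g)} {σ (τ g)} refl t∉) (trans (f-face g) (proj₁ i))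
    ... | k , _ , ints , offs , end = suc k , s≤s z≤n
      , (λ { zero _ → i ; (suc j) (s≤s j<k) → subst Interior (iter-shift τ j g) (ints j j<k) })
      , (λ { zero () _ ; (suc zero) _ _ → t∉ ; (suc (suc j)) _ (s≤s j<k) →
             subst (λ z → tl z ∉ˡ tails w) (iter-shift τ (suc j) g) (offs (suc j) (s≤s z≤n) j<k) })
      , subst (λ z → tl z ∈ˡ tails w) (iter-shift τ k g) end

    -- Every curve has a vertex on C, hence leaves the region.
    exit : ∀ g → Interior g → ∃ (Exit g)
    exit g i with curve g ≟ᶠ C
    ... | yes eq = ⊥-elim (true≢false (trans (sym (proj₁ i)) (off-C (g , refl , eq))))
    ... | no ne with crosses-twice (curve g) C ne
    ... | x , _ , _ , mx , _ with meets-darts mx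
    ... | (d , td , cd) , (e , te , ce) with reach g d (sym cd)
    ... | K , p = exit-within K g i (off-C (e , trans te (sym (trans p td)) , ce))

    -- A repetition in the same direction can be shifted back to a return to `tl g` before the exit,
    -- yet `tl g` is a boundary vertex. A reversed repetition is impossible for a curve.
    exit-injective : ∀ {g k} → Exit g k → tl g ∈ˡ tails w → ∀ i j → i < j → j < k → tl (iter τ i g) ≢ tl (iter τ j g)
    exit-injective {g} {k} (_ , _ , offs , _) t∈ i j i<j j<k eq with same-strand (sym eq) (trans (curve-iter j g) (sym (curve-iter i g)))
    ... | inj₂ opp-eq = iter≢opp-iter j i g opp-eq
    ... | inj₁ same = offs (j ∸ i) (m<n⇒0<n∸m i<j) (≤-trans (s≤s (m∸n≤m j i)) j<k)
            (subst (_∈ˡ tails w) (cong tl (sym (cancel i j (<⇒≤ i<j) same))) t∈)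
      where
      cancel : ∀ i j → i ≤ j → iter τ j g ≡ iter τ i g → iter τ (j ∸ i) g ≡ g
      cancel zero    j       _         eq = eq
      cancel (suc i) (suc j) (s≤s i≤j) eq = cancel i j i≤j (τ-injective eq)

  open Region public

  size : ∀ {w} → Region w → ℕ
  size R = countᵇ darts (f R)

  swap-∈ : ∀ {S : Set} {x : S} xs {ys} → x ∈ˡ xs ++ ys → x ∈ˡ ys ++ xs
  swap-∈ xs {ys} x∈ with ∈-++⁻ xs x∈
  ... | inj₁ p = ∈-++⁺ʳ ys p
  ... | inj₂ q = ∈-++⁺ˡ q

  rotate : ∀ xs {ys} → Region (xs ++ ys) → Region (ys ++ xs)
  rotate xs {ys} R = record
    { base = proj₁ split ; path = path-++ (proj₂ (proj₂ split)) (proj₁ (proj₂ split))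
    ; unique = subst Unique (sym (tails-++ ys)) (Unique-rotate (tails xs) (subst Unique (tails-++ xs) (unique R)))
    ; f = f R ; f-face = f-face R
    ; left = λ d∈ → left R (swap-∈ ys d∈) ; right = λ d∈ → right R (swap-∈ ys d∈)
    ; only = λ a b → swap-∈ xs (only R a b) ; off-C = off-C R }
    where
    split : ∃ λ x → Path (base R) xs x × Path x ys (base R)
    split = path-split xs (path R)

  recast : ∀ {w w′} → w ≡ w′ → Region w → Region w′
  recast eq R = record
    { base = base R ; path = subst (λ z → Path (base R) z (base R)) eq (path R)
    ; unique = subst (Unique ∘ tails) eq (unique R) ; f = f R ; f-face = f-face R
    ; left = λ d∈ → left R (subst (_ ∈ˡ_) (sym eq) d∈) ; right = λ d∈ → right R (subst (_ ∈ˡ_) (sym eq) d∈)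
    ; only = λ a b → subst (_ ∈ˡ_) eq (only R a b) ; off-C = off-C R }

  base≡ : ∀ {d w} (R : Region (d ∷ w)) → base R ≡ tl d
  base≡ R = sym (path-start (path R))

  record Cut {w} (R : Region w) (w′ cs : List (Dart nv)) : Set where
    field
      region  : Region w′
      below   : ∀ {d} → f region d ≡ true → f R d ≡ true
      smaller : size region < size R
      dropped : ∀ {d} → d ∈ˡ cs → f region d ≡ false

  -- The boundary part `c ∷ cs` is exchanged for a route `e ∷ es` through the interior. The new
  -- region is the old one intersected with the left side of the new walk. The dropped part lies on
  -- its right: its first dart does, and afterwards it meets no vertex of the new walk.
  module _ (ks : List (Dart nv)) (l c : Dart nv) (cs : List (Dart nv)) (R : Region ((ks ++ [ l ]) ++ c ∷ cs))
    (e : Dart nv) (es : List (Dart nv)) (pe : Path (tl c) (e ∷ es) (base R)) (int : ∀ {d} → d ∈ˡ e ∷ es → Interior R d)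
    (ue : Unique (tails (e ∷ es))) (fresh : ∀ {d} → d ∈ˡ es → tl d ∉ˡ tails ((ks ++ [ l ]) ++ c ∷ cs))
    (turns : Linked Turn (e ∷ es)) where
    private
      K w w′ : List (Dart nv)
      K = ks ++ [ l ]
      w = K ++ c ∷ cs
      w′ = K ++ e ∷ es

      split-R : ∃ λ x → Path (base R) K x × Path x (c ∷ cs) (base R)
      split-R = path-split K (path R)

      x≡ : proj₁ split-R ≡ tl c
      x≡ = sym (path-start (proj₂ (proj₂ split-R)))

      pK : Path (base R) K (tl c)
      pK = subst (Path (base R) K) x≡ (proj₁ (proj₂ split-R))

      pc : Path (tl c) (c ∷ cs) (base R)
      pc = subst (λ z → Path z (c ∷ cs) (base R)) x≡ (proj₂ (proj₂ split-R))

      uw : Unique (tails K ++ tails (c ∷ cs))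
      uw = subst Unique (tails-++ K) (unique R)

      te : tl e ≡ tl c
      te = path-start pe

      hl : hd l ≡ tl c
      hl = path-last ks pK

      l∈K : l ∈ˡ K
      l∈K = ∈-++⁺ʳ ks (here refl)

      K⊆w : ∀ {d} → d ∈ˡ K → d ∈ˡ w
      K⊆w = ∈-++⁺ˡ

      c⊆w : ∀ {d} → d ∈ˡ c ∷ cs → d ∈ˡ w
      c⊆w = ∈-++⁺ʳ K

      e-off-K : ∀ {v} → v ∈ˡ tails K → v ∉ˡ tails (e ∷ es)
      e-off-K v∈K (here refl) = proj₂ (proj₂ (Unique-++⁻ (tails K) uw)) (subst (_∈ˡ tails K) te v∈K) (here refl)
      e-off-K v∈K (there v∈) with ∈-tails v∈
      ... | d , d∈ , refl = fresh d∈ (subst (tl d ∈ˡ_) (sym (tails-++ K)) (∈-++⁺ˡ v∈K))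

      u′ : Unique (tails w′)
      u′ = subst Unique (sym (tails-++ K)) (Unique-++ (proj₁ (Unique-++⁻ (tails K) uw)) ue e-off-K)

      p′ : Path (base R) w′ (base R)
      p′ = path-++ pK pe

      unrev′ : ∀ {d} → d ∈ˡ w′ → α d ∉ˡ w′
      unrev′ d∈ αd∈ with ∈-++⁻ K d∈ | ∈-++⁻ K αd∈
      ... | inj₁ a | inj₁ b = α-boundary R (K⊆w a) (K⊆w b)
      ... | inj₁ a | inj₂ b = boundary≢interior R (K⊆w a) (subst (Interior R) (α-invol _) (interior-α R (int b)))
      ... | inj₂ a | inj₁ b = α-boundary≢interior R (K⊆w b) (int a)
      ... | inj₂ a | inj₂ b = unreversed pe ue turns a b

      sep : Separation w′
      sep = separation w′ p′ u′ unrev′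
      open Separation sep using (S) renaming (left to S-left; right to S-right; flat to S-flat; face′ to S-face)

      l∈ : l ∈ˡ w′
      l∈ = ∈-++⁺ˡ l∈K
      e∈ : e ∈ˡ w′
      e∈ = ∈-++⁺ʳ K (here refl)

      -- Only the arrival l and the departure e of the new walk lie at tl c, and e lies strictly
      -- between the arrival l and the departure c of the old one.
      S-c : S c ≡ false
      S-c with around (α l) e (trans te (sym hl)) | around (α l) c (sym hl)
      ... | inj₁ refl | _ = ⊥-elim (true≢false (trans (sym (proj₁ (int (here refl)))) (trans (f-α R l) (right R (K⊆w l∈K)))))
      ... | _ | inj₁ refl = ⊥-elim (α-boundary R (K⊆w l∈K) (c⊆w (here refl)))
      ... | inj₂ (inj₂ (inj₂ refl)) | _ = ⊥-elim (true≢false (trans (sym (proj₂ (int (here refl))))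
              (trans (cong (f R) (σ⁴ (α l))) (trans (f-α R l) (right R (K⊆w l∈K))))))
      ... | inj₂ (inj₁ refl) | inj₂ (inj₁ refl) = ⊥-elim (boundary≢interior R (c⊆w (here refl)) (int (here refl)))
      ... | inj₂ (inj₁ refl) | inj₂ (inj₂ (inj₁ refl)) = S-right e∈
      ... | inj₂ (inj₁ refl) | inj₂ (inj₂ (inj₂ refl)) = trans (S-flat out in′) (S-right e∈)
        where
        out : σ (σ (α l)) ∉ˡ w′
        out m = σ≢ _ (Unique-map-injective u′ m e∈ refl)
        in′ : α (σ (σ (α l))) ∉ˡ w′
        in′ m = opp≢ (α l) (trans (sym (α-invol _)) (cong α (Unique-map-injective (heads-unique p′ u′) m l∈ (cong tl (α-invol _)))))
      ... | inj₂ (inj₂ (inj₁ refl)) | inj₂ (inj₁ refl) = ⊥-elim (true≢false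
              (trans (sym (proj₁ (int (here refl)))) (right R (c⊆w (here refl)))))
      ... | inj₂ (inj₂ (inj₁ refl)) | inj₂ (inj₂ (inj₁ refl)) = ⊥-elim (boundary≢interior R (c⊆w (here refl)) (int (here refl)))
      ... | inj₂ (inj₂ (inj₁ refl)) | inj₂ (inj₂ (inj₂ refl)) = S-right e∈

      off-new : ∀ {d} → d ∈ˡ cs → tl d ∉ˡ tails w′
      off-new {d} d∈ t∈ with ∈-++⁻ (tails K) (subst (tl d ∈ˡ_) (tails-++ K) t∈)
      ... | inj₁ a = proj₂ (proj₂ (Unique-++⁻ (tails K) uw)) a (there (tails⁺ d∈))
      ... | inj₂ (here eq) = Unique-head (proj₁ (proj₂ (Unique-++⁻ (tails K) uw))) (subst (_∈ˡ tails cs) (trans eq te) (tails⁺ d∈))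
      ... | inj₂ (there b) with ∈-tails b
      ... | g , g∈ , eq = fresh g∈ (subst (_∈ˡ tails w) eq (tails⁺ (c⊆w (there d∈))))

      S-flat-off : ∀ {d} → tl d ∉ˡ tails w′ → S (σ d) ≡ S d
      S-flat-off {d} t∉ = S-flat (λ m → t∉ (tails⁺ m))
        (λ m → t∉ (subst (_∈ˡ tails w′) (cong tl (α-invol d)) (head-in-tails p′ m)))

      S-next : ∀ d d′ → tl d′ ≡ hd d → tl d′ ∉ˡ tails w′ → S d ≡ false → S d′ ≡ false
      S-next d d′ t t∉ Sd with around (σ (α d)) d′ t
      ... | inj₁ refl = trans (S-face d) Sd
      ... | inj₂ (inj₁ refl) = trans (S-flat-off {σ (α d)} t∉) (trans (S-face d) Sd)
      ... | inj₂ (inj₂ (inj₁ refl)) = trans (S-flat-off {σ (σ (α d))} t∉) (trans (S-flat-off {σ (α d)} t∉) (trans (S-face d) Sd))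
      ... | inj₂ (inj₂ (inj₂ refl)) = trans (S-flat-off {σ (σ (σ (α d)))} t∉) (trans (S-flat-off {σ (σ (α d))} t∉)
              (trans (S-flat-off {σ (α d)} t∉) (trans (S-face d) Sd)))

      S-dropped : ∀ {a b d xs} → Path a (d ∷ xs) b → S d ≡ false → (∀ {x} → x ∈ˡ xs → tl x ∉ˡ tails w′) →
        ∀ {x} → x ∈ˡ d ∷ xs → S x ≡ false
      S-dropped q Sd off (here refl) = Sd
      S-dropped {d = d} (_ ∷ (t ∷ q)) Sd off (there x∈) =
        S-dropped (t ∷ q) (S-next d _ t (off (here refl)) Sd) (off ∘ there) x∈

      S-cs : ∀ {d} → d ∈ˡ c ∷ cs → S d ≡ false
      S-cs = S-dropped pc S-c off-new

      g : Dart nv → Bool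
      g d = f R d ∧ S d

      both : ∀ {a b} → a ≡ true → b ≡ true → a ∧ b ≡ true
      both refl refl = refl
      fst : ∀ {a b} → a ∧ b ≡ true → a ≡ true
      fst {true} _ = refl
      snd : ∀ {a b} → a ∧ b ≡ true → b ≡ true
      snd {true} eq = eq
      no₂ : ∀ {a b} → b ≡ false → a ∧ b ≡ false
      no₂ {true}  eq = eq
      no₂ {false} eq = refl
      neither : ∀ {a b} → a ∧ b ≡ false → b ≡ true → a ≡ false
      neither {false} _ _ = refl
      neither {true} refl ()

      g-left : ∀ {d} → d ∈ˡ w′ → g d ≡ true
      g-left d∈ with ∈-++⁻ K d∈
      ... | inj₁ a = both (left R (K⊆w a)) (S-left d∈)
      ... | inj₂ b = both (proj₁ (int b)) (S-left d∈)

      g-only : ∀ {d} → g d ≡ true → g (σ d) ≡ false → d ∈ˡ w′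
      g-only {d} p q with false-or-true (S (σ d))
      ... | inj₂ Sσ with ∈-++⁻ K (only R (fst p) (neither q Sσ))
      ... | inj₁ a = ∈-++⁺ˡ a
      ... | inj₂ b = ⊥-elim (true≢false (trans (sym (snd p)) (S-cs b)))
      g-only {d} p q | inj₁ Sσ with d ∈ᵈ? w′ | α d ∈ᵈ? w′
      ... | yes m | _ = m
      ... | no m | yes m′ = ⊥-elim (true≢false (trans (sym (S-left m′))
              (trans (sym (S-face (α d))) (trans (cong (λ z → S (σ z)) (α-invol d)) Sσ))))
      ... | no m | no m′ = ⊥-elim (true≢false (trans (sym (snd p)) (trans (sym (S-flat m m′)) Sσ)))

    abstract
      cut : Cut R ((ks ++ [ l ]) ++ e ∷ es) (c ∷ cs)
      cut = record
        { region = record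
          { base = base R ; path = p′ ; unique = u′ ; f = g
          ; f-face = λ d → cong₂ _∧_ (f-face R d) (S-face d)
          ; left = g-left ; right = λ d∈ → no₂ {f R (σ _)} (S-right d∈) ; only = g-only
          ; off-C = λ {d} t → cong (_∧ S d) (off-C R t) }
        ; below = fst
        -- The face on the right of `e`, represented by `σ e`, is lost: `e` was interior and is now
        -- boundary.
        ; smaller = countᵇ-strict (λ _ → fst) (∈-darts (σ e)) (no₂ {f R (σ e)} (S-right e∈)) (proj₂ (int (here refl)))
        ; dropped = λ {d} d∈ → no₂ {f R d} (S-cs d∈) }

  record Passage {w} (R : Region w) (u v : Fin nv) (es : List (Dart nv)) : Set where
    field
      route : Path u es v
      inner : ∀ {d} → d ∈ˡ es → Interior R d
      apart : Unique (tails es)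
      fresh : ∀ {d} → d ∈ˡ es → tl d ≢ u → tl d ∉ˡ tails w
      turns : Linked Turn es

  abstract
    -- `cut` requires the route to end at the base of the list. Rotating first allows a route
    -- between any two boundary vertices.
    replace : ∀ {w} (R : Region w) xs ys → w ≡ xs ++ ys → ∀ ks l c cs → ys ++ xs ≡ (ks ++ [ l ]) ++ c ∷ cs →
      ∀ {v k₀ ks₀} → ks ++ [ l ] ≡ k₀ ∷ ks₀ → tl k₀ ≡ v → ∀ e es → Passage R (tl c) v (e ∷ es) →
      Cut R ((ks ++ [ l ]) ++ e ∷ es) (c ∷ cs)
    replace {w} R xs ys eq ks l c cs eq′ {v} {k₀} eq″ tk e es P =
      record { region = Cut.region new ; below = Cut.below new ; smaller = Cut.smaller new ; dropped = Cut.dropped new }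
      where
      open Passage P
      R′ : Region ((ks ++ [ l ]) ++ c ∷ cs)
      R′ = recast eq′ (rotate xs (recast eq R))
      base-v : v ≡ base R′
      base-v = trans (sym tk) (sym (base≡ (recast (cong (_++ c ∷ cs) eq″) R′)))
      back : ∀ {d} → d ∈ˡ (ks ++ [ l ]) ++ c ∷ cs → d ∈ˡ w
      back d∈ = subst (_ ∈ˡ_) (sym eq) (swap-∈ ys (subst (_ ∈ˡ_) (sym eq′) d∈))
      te : tl e ≡ tl c
      te = path-start route
      fresh′ : ∀ {d} → d ∈ˡ es → tl d ∉ˡ tails ((ks ++ [ l ]) ++ c ∷ cs)
      fresh′ {d} d∈ t∈ with ∈-tails t∈
      ... | x , x∈ , tx = fresh (there d∈) (λ td → Unique-head apart (subst (_∈ˡ tails es) (trans td (sym te)) (tails⁺ d∈)))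
                            (subst (_∈ˡ tails w) (sym tx) (tails⁺ (back x∈)))
      new : Cut R′ ((ks ++ [ l ]) ++ e ∷ es) (c ∷ cs)
      new = cut ks l c cs R′ e es (subst (Path (tl c) (e ∷ es)) base-v route) inner apart fresh′ turns

-- Minimal loops and their corners

module Loops {n : ℕ} (A : Arrangement n) (C : Fin n) where
  open Regions A C public

  rev-iter : ∀ i j g → iter τ i (α (iter τ (i + j) g)) ≡ α (iter τ j g)
  rev-iter zero    j g = refl
  rev-iter (suc i) j g = trans (cong τ (trans (cong (λ z → iter τ i (α (iter τ z g))) (sym (+-suc i j))) (rev-iter i (suc j) g)))
    (trans (cong opp (α-invol _)) (opp-opp _))

  rev-iter-∸ : ∀ {i m} → i ≤ m → ∀ g → iter τ i (α (iter τ m g)) ≡ α (iter τ (m ∸ i) g)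
  rev-iter-∸ {i} {m} i≤m g = trans (cong (λ z → iter τ i (α (iter τ z g))) (sym (m+[n∸m]≡n i≤m))) (rev-iter i (m ∸ i) g)

  rev-end : ∀ m g → τ (iter τ m (α (iter τ m g))) ≡ opp g
  rev-end m g = cong opp (trans (cong α (trans (cong (λ z → iter τ m (α (iter τ z g))) (sym (+-identityʳ m))) (rev-iter m 0 g))) (α-invol g))

  ∈-rev⁻ : ∀ {d} m g → d ∈ˡ fwd (α (iter τ m g)) (suc m) → ∃ λ j → j ≤ m × d ≡ α (iter τ j g)
  ∈-rev⁻ m g d∈ with ∈-fwd⁻ _ (suc m) d∈
  ... | i , s≤s i≤m , eq = m ∸ i , m∸n≤m m i , trans eq (rev-iter-∸ i≤m g)

  ∈-rev⁺ : ∀ {j} m g → j ≤ m → α (iter τ j g) ∈ˡ fwd (α (iter τ m g)) (suc m)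
  ∈-rev⁺ {j} m g j≤m = subst (_∈ˡ fwd _ (suc m))
    (trans (rev-iter-∸ (m∸n≤m m j) g) (cong (λ z → α (iter τ z g)) (m∸[m∸n]≡n j≤m))) (∈-fwd⁺ _ (suc m) (s≤s (m∸n≤m m j)))

  module _ {w} (R : Region w) (g : Dart nv) (m : ℕ) (ints : ∀ i → i ≤ m → Interior R (iter τ i g))
    (offs : ∀ i → 0 < i → i ≤ m → tl (iter τ i g) ∉ˡ tails w)
    (inj : ∀ i j → i < j → j ≤ m → tl (iter τ i g) ≢ tl (iter τ j g)) where

    passage : Passage R (tl g) (tl (iter τ (suc m) g)) (fwd g (suc m))
    passage = record
      { route = path-fwd g (suc m)
      ; inner = λ d∈ → case ∈-fwd⁻ g (suc m) d∈ of λ { (i , s≤s i≤m , refl) → ints i i≤m }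
      ; apart = tails-fwd-unique g (suc m) (λ { i j i<j (s≤s j≤m) → inj i j i<j j≤m })
      ; fresh = λ d∈ t≢ → case ∈-fwd⁻ g (suc m) d∈ of λ
          { (zero , _ , refl) → ⊥-elim (t≢ refl) ; (suc i , s≤s i≤m , refl) → offs (suc i) (s≤s z≤n) i≤m }
      ; turns = fwd-turns g (suc m) }

    -- Read backwards, the stretch starts at its far end. That vertex takes over the exemption in
    -- `fresh`, and the hypothesis keeps it apart from the inner vertices.
    passage-back : (∀ i → 0 < i → i ≤ m → tl (iter τ i g) ≢ tl (iter τ (suc m) g)) →
      Passage R (tl (iter τ (suc m) g)) (tl g) (fwd (α (iter τ m g)) (suc m))
    passage-back ends = record
      { route = subst (Path _ _) (cong tl (rev-end m g)) (path-fwd (α (iter τ m g)) (suc m))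
      ; inner = λ d∈ → case ∈-rev⁻ m g d∈ of λ { (j , j≤m , refl) → interior-α R (ints j j≤m) }
      ; apart = tails-fwd-unique _ (suc m) (λ { i j i<j (s≤s j≤m) eq →
          distinct (m ∸ j) (m ∸ i) (∸-monoʳ-< i<j j≤m) (m∸n≤m m i)
            (trans (sym (cong tl (rev-iter-∸ j≤m g))) (trans (sym eq) (cong tl (rev-iter-∸ (≤-trans (<⇒≤ i<j) j≤m) g)))) })
      ; fresh = λ d∈ t≢ → case ∈-rev⁻ m g d∈ of λ { (j , j≤m , refl) →
          case m≤n⇒m<n∨m≡n j≤m of λ { (inj₁ j<m) → offs (suc j) (s≤s z≤n) j<m ; (inj₂ refl) → ⊥-elim (t≢ refl) } }
      ; turns = fwd-turns _ (suc m) }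
      where
      distinct : ∀ i j → i < j → j ≤ m → hd (iter τ i g) ≢ hd (iter τ j g)
      distinct i j i<j j≤m eq with m≤n⇒m<n∨m≡n j≤m
      ... | inj₁ j<m  = inj (suc i) (suc j) (s≤s i<j) j<m eq
      ... | inj₂ refl = ends (suc i) (s≤s z≤n) i<j eq

  module _ {w} (R : Region w) {g : Dart nv} {m : ℕ} (E : Exit R g (suc m)) (t∈ : tl g ∈ˡ tails w) where

    exit-passage : Passage R (tl g) (tl (iter τ (suc m) g)) (fwd g (suc m))
    exit-passage = passage R g m (λ i i≤m → proj₁ (proj₂ E) i (s≤s i≤m)) (λ i 0<i i≤m → proj₁ (proj₂ (proj₂ E)) i 0<i (s≤s i≤m))
      (λ i j i<j j≤m → exit-injective R E t∈ i j i<j (s≤s j≤m))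

    exit-passage-back : Passage R (tl (iter τ (suc m) g)) (tl g) (fwd (α (iter τ m g)) (suc m))
    exit-passage-back = passage-back R g m (λ i i≤m → proj₁ (proj₂ E) i (s≤s i≤m)) (λ i 0<i i≤m → proj₁ (proj₂ (proj₂ E)) i 0<i (s≤s i≤m))
      (λ i j i<j j≤m → exit-injective R E t∈ i j i<j (s≤s j≤m))
      (λ i 0<i i≤m eq → proj₁ (proj₂ (proj₂ E)) i 0<i (s≤s i≤m) (subst (_∈ˡ tails w) (sym eq) (proj₂ (proj₂ (proj₂ E)))))

  -- `Linked` constrains consecutive darts only: from the last dart back to the first any turn is
  -- allowed. This is the free corner of a loop.
  Minimal : ℕ → Set
  Minimal s = ∀ {d w} (R : Region (d ∷ w)) → Linked Turn (d ∷ w) → size R < s → ⊥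

  rightward : Dart nv → Dart nv
  rightward d = σ (σ (σ (α d)))

  ∈-tails-++ : ∀ {v} xs {ys} → v ∈ˡ tails (xs ++ ys) → v ∈ˡ tails xs ⊎ v ∈ˡ tails ys
  ∈-tails-++ xs v∈ = ∈-++⁻ (tails xs) (subst (_ ∈ˡ_) (tails-++ xs) v∈)

  ∈-tails-++ˡ : ∀ {v} xs {ys} → v ∈ˡ tails xs → v ∈ˡ tails (xs ++ ys)
  ∈-tails-++ˡ xs v∈ = subst (_ ∈ˡ_) (sym (tails-++ xs)) (∈-++⁺ˡ v∈)

  ∈-tails-++ʳ : ∀ {v} xs {ys} → v ∈ˡ tails ys → v ∈ˡ tails (xs ++ ys)
  ∈-tails-++ʳ xs v∈ = subst (_ ∈ˡ_) (sym (tails-++ xs)) (∈-++⁺ʳ (tails xs) v∈)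

  tails-disjoint : ∀ {w} (R : Region w) xs {ys} → w ≡ xs ++ ys → ∀ {v} → v ∈ˡ tails xs → v ∈ˡ tails ys → ⊥
  tails-disjoint R xs refl = proj₂ (proj₂ (Unique-++⁻ (tails xs) (subst Unique (tails-++ xs) (unique R))))

  -- In a minimal loop the extension of an incoming segment beyond a right turn leaves the region at a later
  -- boundary vertex: otherwise the extension and the boundary from its exit to the turn form a smaller loop.
  -- Symmetrically, the outgoing segment extended backwards leaves it at an earlier vertex.
  module Corner (xs : List (Dart nv)) (d : Dart nv) (ys : List (Dart nv))
    (R : Region ((xs ++ [ d ]) ++ rightward d ∷ ys)) (L : Linked Turn ((xs ++ [ d ]) ++ rightward d ∷ ys))
    (least : Minimal (size R)) where
    as : List (Dart nv)
    as = xs ++ [ d ]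
    d′ : Dart nv
    d′ = rightward d

    d∈ : d ∈ˡ as ++ d′ ∷ ys
    d∈ = ∈-++⁺ˡ (∈-++⁺ʳ xs (here refl))
    d′∈ : d′ ∈ˡ as ++ d′ ∷ ys
    d′∈ = ∈-++⁺ʳ as (here refl)

    forward : ∀ {k} → Exit R (τ d) k → tl (iter τ k (τ d)) ∈ˡ tails ys
    forward {suc m} E@(_ , ints , _ , t∈) with ∈-tails-++ as t∈
    ... | inj₂ (there t∈ys) = t∈ys
    ... | inj₂ (here eq) with same-strand {τ d} {iter τ (suc m) (τ d)} eq (curve-iter (suc m) (τ d))
    ... | inj₂ o = ⊥-elim (iter≢opp (suc m) (τ d) o)
    -- The extension can return to its own corner only by arriving along `d`, which is a boundary
    -- dart and not interior.
    ... | inj₁ s = ⊥-elim (boundary≢interior R d∈ (subst (Interior R) (τ-injective s) (ints m ≤-refl)))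
    forward {suc m} E@(_ , ints , _ , t∈) | inj₁ t∈as with tails-split as t∈as
    ... | as₁ , a , as₂ , eq , ta with snoc-view a as₂
    ... | ks , l , eq′ with ∷ʳ-injectiveʳ (as₁ ++ ks) xs (trans (++-assoc as₁ ks [ l ]) (trans (cong (as₁ ++_) (sym eq′)) (sym eq)))
    ... | refl = ⊥-elim (small (Cut.region new) turned (Cut.smaller new))
      where
      w≡ : as ++ d′ ∷ ys ≡ as₁ ++ ((ks ++ [ d ]) ++ d′ ∷ ys)
      w≡ = trans (cong (_++ d′ ∷ ys) (trans eq (cong (as₁ ++_) eq′))) (++-assoc as₁ (ks ++ [ d ]) (d′ ∷ ys))
      -- The boundary from the exit to the turn, closed up by the extension: the turn becomes
      -- straight and the free corner is at the exit.
      new : Cut R ((ks ++ [ d ]) ++ fwd (τ d) (suc m)) (d′ ∷ (ys ++ as₁))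
      new = replace R as₁ ((ks ++ [ d ]) ++ d′ ∷ ys) w≡ ks d d′ (ys ++ as₁)
            (++-assoc (ks ++ [ d ]) (d′ ∷ ys) as₁) (sym eq′) ta (τ d) (fwd (τ (τ d)) m) (exit-passage R E (tails⁺ d′∈))
      turned : Linked Turn ((ks ++ [ d ]) ++ fwd (τ d) (suc m))
      turned = Linked-join ks (Linked-++⁻ˡ (ks ++ [ d ]) (Linked-++⁻ʳ as₁ (subst (Linked Turn) w≡ L))) (inj₁ refl) (fwd-turns (τ d) (suc m))
      small : ∀ (R′ : Region ((ks ++ [ d ]) ++ fwd (τ d) (suc m))) → Linked Turn ((ks ++ [ d ]) ++ fwd (τ d) (suc m)) → size R′ < size R → ⊥
      small rewrite sym eq′ = least

    backward : ∀ {k} → Exit R (opp d′) k → tl (iter τ k (opp d′)) ∈ˡ tails as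
    backward {suc m} E@(_ , ints , _ , t∈) with ∈-tails-++ as t∈
    ... | inj₁ t∈as = t∈as
    ... | inj₂ (here eq) with same-strand {opp d′} {iter τ (suc m) (opp d′)} eq (curve-iter (suc m) (opp d′))
    ... | inj₂ o = ⊥-elim (iter≢opp (suc m) (opp d′) o)
    ... | inj₁ s = ⊥-elim (α-boundary≢interior R (subst (_∈ˡ as ++ d′ ∷ ys) (sym (σ-injective (σ-injective s))) d′∈) (ints m ≤-refl))
    backward {suc m} E@(_ , ints , _ , t∈) | inj₂ (there t∈ys) with tails-split ys t∈ys
    ... | ys₁ , b , ys₂ , refl , tb with snoc-view d′ ys₁
    -- Starting the list with the reversed extension, which runs straight into `d′`, puts the free
    -- corner at the exit.
    ... | ks , l , eq′ = ⊥-elim (least (rotate (d′ ∷ ys₁) (recast (cong (_++ fwd h (suc m)) (sym eq′)) (Cut.region new))) turned (Cut.smaller new))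
      where
      g h : Dart nv
      g = opp d′
      h = α (iter τ m g)
      new : Cut R ((ks ++ [ l ]) ++ fwd h (suc m)) (b ∷ (ys₂ ++ as))
      new = replace R as (d′ ∷ ys₁ ++ b ∷ ys₂) refl ks l b (ys₂ ++ as)
            (trans (++-assoc (d′ ∷ ys₁) (b ∷ ys₂) as) (cong (_++ b ∷ (ys₂ ++ as)) eq′)) (sym eq′) refl h (fwd (τ h) m)
            (subst (λ z → Passage R z (tl d′) (fwd h (suc m))) (sym tb) (exit-passage-back R E (tails⁺ d′∈)))
      turned : Linked Turn (fwd h (suc m) ++ d′ ∷ ys₁)
      turned = subst (λ z → Linked Turn (z ++ d′ ∷ ys₁)) (sym (fwd-snoc h m))
        (Linked-join (fwd h m) (subst (Linked Turn) (fwd-snoc h m) (fwd-turns h (suc m)))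
          (inj₁ (sym (trans (rev-end m g) (opp-opp d′)))) (Linked-++⁻ˡ (d′ ∷ ys₁) (Linked-++⁻ʳ as L)))

-- Crossing extensions and the absence of loops

module NoLoops {n : ℕ} (A : Arrangement n) (C : Fin n) where
  open Loops A C public

  -- Suppose an incoming segment F, extended beyond its turn, leaves the region after a later turn, whose
  -- outgoing segment B, extended backwards, leaves the region before the first turn.  Then F and B cross,
  -- and going along F up to the crossing and back along B short-cuts the loop.
  module Crossing (xs : List (Dart nv)) (l a : Dart nv) (cs : List (Dart nv)) (l′ : Dart nv)
    (ys : List (Dart nv)) (mid : List (Dart nv)) (a≡ : a ≡ rightward l) (mid≡ : a ∷ cs ≡ mid ++ [ l′ ])
    (R : Region ((xs ++ [ l ]) ++ (mid ++ [ l′ ]) ++ rightward l′ ∷ ys))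
    (L : Linked Turn ((xs ++ [ l ]) ++ (mid ++ [ l′ ]) ++ rightward l′ ∷ ys))
    (least : Minimal (size R)) {mF kB : ℕ}
    (EF : Exit R (τ l) (suc mF)) (F-end : tl (iter τ (suc mF) (τ l)) ∈ˡ tails ys)
    (EB : Exit R (opp (rightward l′)) kB) (B-end : tl (iter τ kB (opp (rightward l′))) ∈ˡ tails (xs ++ [ l ])) where
    private
      as w : List (Dart nv)
      as = xs ++ [ l ]
      M : List (Dart nv)
      M = mid ++ [ l′ ]
      a″ gF gB : Dart nv
      a″ = rightward l′
      gF = τ l
      gB = opp a″
      w = as ++ M ++ a″ ∷ ys

      ta : tl a ≡ tl gF
      ta = cong tl a≡

      M⊆ : ∀ {d} → d ∈ˡ M → d ∈ˡ w
      M⊆ m = ∈-++⁺ʳ as (∈-++⁺ˡ m)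
      ys⊆ : ∀ {d} → d ∈ˡ a″ ∷ ys → d ∈ˡ w
      ys⊆ m = ∈-++⁺ʳ as (∈-++⁺ʳ M m)
      a∈M : a ∈ˡ M
      a∈M = subst (a ∈ˡ_) mid≡ (here refl)
      l′∈M : l′ ∈ˡ M
      l′∈M = ∈-++⁺ʳ mid (here refl)

      tgF∈ : tl gF ∈ˡ tails w
      tgF∈ = subst (_∈ˡ tails w) ta (tails⁺ (M⊆ a∈M))

      splitF : ∃ λ r₁ → ∃ λ b → ∃ λ r₂ → ys ≡ r₁ ++ b ∷ r₂ × tl b ≡ tl (iter τ (suc mF) gF)
      splitF = tails-split ys F-end
      r₁ r₂ : List (Dart nv)
      r₁ = proj₁ splitF
      b : Dart nv
      b = proj₁ (proj₂ splitF)
      r₂ = proj₁ (proj₂ (proj₂ splitF))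
      ys≡ : ys ≡ r₁ ++ b ∷ r₂
      ys≡ = proj₁ (proj₂ (proj₂ (proj₂ splitF)))
      tb : tl b ≡ tl (iter τ (suc mF) gF)
      tb = proj₂ (proj₂ (proj₂ (proj₂ splitF)))

      hF : Dart nv
      hF = α (iter τ mF gF)

      lastU : ∃₂ λ ks k → a ∷ cs ++ a″ ∷ r₁ ≡ ks ++ [ k ]
      lastU = snoc-view a (cs ++ a″ ∷ r₁)
      ksU : List (Dart nv)
      ksU = proj₁ lastU
      kU : Dart nv
      kU = proj₁ (proj₂ lastU)
      KU≡ : ksU ++ [ kU ] ≡ M ++ a″ ∷ r₁
      KU≡ = trans (sym (proj₂ (proj₂ lastU))) (cong (_++ a″ ∷ r₁) mid≡)

      abstract
        -- U is bounded by the old boundary from the first turn to the exit of F, and by F run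
        -- backwards. It still has the later turn as a corner, so B starts inside it.
        cut-U : Cut R ((ksU ++ [ kU ]) ++ fwd hF (suc mF)) (b ∷ (r₂ ++ as))
        cut-U = replace R as (M ++ a″ ∷ ys) refl ksU kU b (r₂ ++ as)
          (trans (cong (λ z → (M ++ a″ ∷ z) ++ as) ys≡) (trans (cong (_++ as) (sym (++-assoc M (a″ ∷ r₁) (b ∷ r₂))))
            (trans (++-assoc (M ++ a″ ∷ r₁) (b ∷ r₂) as) (cong (_++ b ∷ (r₂ ++ as)) (sym KU≡)))))
          (sym (proj₂ (proj₂ lastU))) refl hF (fwd (τ hF) mF)
          (subst₂ (λ y z → Passage R y z (fwd hF (suc mF))) (sym tb) (sym ta) (exit-passage-back R EF tgF∈))

      wU : List (Dart nv)
      wU = (ksU ++ [ kU ]) ++ fwd hF (suc mF)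
      U : Region wU
      U = Cut.region cut-U

      KU⊆ : ∀ {d} → d ∈ˡ ksU ++ [ kU ] → d ∈ˡ M ++ a″ ∷ ys
      KU⊆ {d} m with ∈-++⁻ M (subst (d ∈ˡ_) KU≡ m)
      ... | inj₁ p         = ∈-++⁺ˡ p
      ... | inj₂ (here eq) = ∈-++⁺ʳ M (here eq)
      ... | inj₂ (there q) = ∈-++⁺ʳ M (there (subst (d ∈ˡ_) (sym ys≡) (∈-++⁺ˡ q)))

      inU : ∀ {d} → d ∈ˡ M ++ a″ ∷ r₁ → d ∈ˡ wU
      inU {d} m = ∈-++⁺ˡ (subst (d ∈ˡ_) (sym KU≡) m)

      U-start : Interior U gB
      U-start = proj₂ (interior-corner U (inU (∈-++⁺ˡ l′∈M)) (inU (∈-++⁺ʳ M (here refl))) refl)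

      abstract
        exitU : ∃ (Exit U gB)
        exitU = exit U gB U-start

      k′ : ℕ
      k′ = proj₁ exitU
      EU : Exit U gB k′
      EU = proj₂ exitU

      as-off-U : ∀ {v} → v ∈ˡ tails as → v ∉ˡ tails wU
      as-off-U {v} v∈ v∈U with ∈-tails-++ (ksU ++ [ kU ]) v∈U
      ... | inj₁ p with ∈-tails p
      ... | d , d∈ , refl = tails-disjoint R as refl v∈ (tails⁺ (KU⊆ d∈))
      as-off-U {v} v∈ v∈U | inj₂ q with ∈-tails q
      ... | d , d∈ , refl with ∈-rev⁻ mF gF d∈
      ... | j , j≤m , refl with m≤n⇒m<n∨m≡n j≤m
      ... | inj₁ j<m = proj₁ (proj₂ (proj₂ EF)) (suc j) (s≤s z≤n) (s≤s j<m) (∈-tails-++ˡ as v∈)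
      ... | inj₂ refl = tails-disjoint R as refl v∈ (∈-tails-++ʳ M (there F-end))

      -- B ends on the part of the boundary before the first turn, which lies outside U; so it
      -- leaves U earlier. Until then it avoids the old boundary and can only leave through F.
      k′<kB : k′ < kB
      k′<kB with <-cmp k′ kB
      ... | tri< lt _ _ = lt
      ... | tri≈ _ eq _ = ⊥-elim (as-off-U B-end (subst (λ z → tl (iter τ z gB) ∈ˡ tails wU) eq (proj₂ (proj₂ (proj₂ EU)))))
      ... | tri> _ _ gt with ∈-tails B-end
      ... | c , c∈ , eq = ⊥-elim (true≢false (trans (sym (proj₁ (proj₁ (proj₂ EU) kB gt)))
              (trans (constant-off U {c} {iter τ kB gB} eq (as-off-U (tails⁺ c∈)))
                (Cut.dropped cut-U (there (∈-++⁺ʳ r₂ c∈))))))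

      module Short (mB : ℕ) (k′≡ : k′ ≡ suc mB) where
        hB x₀ : Dart nv
        hB = α (iter τ mB gB)
        x₀ = iter τ (suc mB) gB

        EU′ : Exit U gB (suc mB)
        EU′ = subst (Exit U gB) k′≡ EU
        sB<kB : suc mB < kB
        sB<kB = subst (_< kB) k′≡ k′<kB
        x-off : tl x₀ ∉ˡ tails w
        x-off = proj₁ (proj₂ (proj₂ EB)) (suc mB) (s≤s z≤n) sB<kB

        meet : ∃ λ j → j < mF × tl x₀ ≡ tl (α (iter τ j gF))
        meet with ∈-tails-++ (ksU ++ [ kU ]) (proj₂ (proj₂ (proj₂ EU′)))
        ... | inj₁ p with ∈-tails p
        ... | d , d∈ , eq = ⊥-elim (x-off (subst (_∈ˡ tails w) (sym eq) (tails⁺ (∈-++⁺ʳ as (KU⊆ d∈)))))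
        meet | inj₂ q with ∈-tails q
        ... | d , d∈ , eq with ∈-rev⁻ mF gF d∈
        ... | j , j≤m , refl with m≤n⇒m<n∨m≡n j≤m
        ... | inj₁ j<m = j , j<m , eq
        ... | inj₂ refl = ⊥-elim (x-off (subst (_∈ˡ tails w) (sym eq) (∈-tails-++ʳ as (∈-tails-++ʳ M (there F-end)))))

        j : ℕ
        j = proj₁ meet
        j<m : j < mF
        j<m = proj₁ (proj₂ meet)
        fj q : Dart nv
        fj = iter τ j gF
        q = α fj
        tx : tl x₀ ≡ tl q
        tx = proj₂ (proj₂ meet)

        rev∈U : ∀ {i} → i ≤ mF → α (iter τ i gF) ∈ˡ wU
        rev∈U i≤ = ∈-++⁺ʳ (ksU ++ [ kU ]) (∈-rev⁺ mF gF i≤)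

        -- B reaches F from inside U. Of the four darts at the crossing, `q` is on the boundary of U
        -- and the next two have a face outside U on their left, so only the right turn from F
        -- remains.
        hB≡ : hB ≡ rightward fj
        hB≡ with around q hB tx
        ... | inj₂ (inj₂ (inj₂ eq)) = eq
        ... | inj₁ eq = ⊥-elim (boundary≢interior U (rev∈U (<⇒≤ j<m)) (subst (Interior U) eq (interior-α U (proj₁ (proj₂ EU′) mB ≤-refl))))
        ... | inj₂ (inj₁ eq) = ⊥-elim (true≢false (trans (sym (proj₁ (subst (Interior U) eq (interior-α U (proj₁ (proj₂ EU′) mB ≤-refl)))))
                (right U (rev∈U (<⇒≤ j<m)))))
        ... | inj₂ (inj₂ (inj₁ eq)) = ⊥-elim (true≢false (trans (sym (proj₁ (subst (Interior U) eq (interior-α U (proj₁ (proj₂ EU′) mB ≤-refl)))))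
                (trans (sym (f-face U (iter τ (suc j) gF))) (right U (rev∈U j<m)))))

        offB : ∀ i → 0 < i → i ≤ mB → tl (iter τ i gB) ∉ˡ tails wU
        offB i 0<i i≤ = proj₁ (proj₂ (proj₂ EU′)) i 0<i (s≤s i≤)

        F-pass : Passage R (tl gF) (tl (iter τ (suc j) gF)) (fwd gF (suc j))
        F-pass = passage R gF j (λ i i≤ → proj₁ (proj₂ EF) i (s≤s (≤-trans i≤ (<⇒≤ j<m))))
          (λ i 0<i i≤ → proj₁ (proj₂ (proj₂ EF)) i 0<i (s≤s (≤-trans i≤ (<⇒≤ j<m))))
          (λ i i′ i<i′ i′≤ → exit-injective R EF tgF∈ i i′ i<i′ (s≤s (≤-trans i′≤ (<⇒≤ j<m))))

        B-pass : Passage R (tl x₀) (tl gB) (fwd hB (suc mB))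
        B-pass = passage-back R gB mB (λ i i≤ → proj₁ (proj₂ EB) i (≤-trans (s≤s i≤) (<⇒≤ sB<kB)))
          (λ i 0<i i≤ → proj₁ (proj₂ (proj₂ EB)) i 0<i (≤-trans (s≤s i≤) (<⇒≤ sB<kB)))
          (λ i i′ i<i′ i′≤ → exit-injective R EB (tails⁺ (ys⊆ (here refl))) i i′ i<i′ (≤-trans (s≤s i′≤) (<⇒≤ sB<kB)))
          (λ i 0<i i≤ → exit-injective R EB (tails⁺ (ys⊆ (here refl))) i (suc mB) (s≤s i≤) sB<kB)

        F-on-U : ∀ i → i ≤ j → tl (iter τ i gF) ∈ˡ tails wU
        F-on-U zero    _  = subst (_∈ˡ tails wU) ta (tails⁺ (inU (∈-++⁺ˡ a∈M)))
        F-on-U (suc i) i≤ = tails⁺ (rev∈U (≤-trans (n≤1+n i) (≤-trans i≤ (<⇒≤ j<m))))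

        apart-FB : ∀ {v} → v ∈ˡ tails (fwd gF (suc j)) → v ∈ˡ tails (fwd hB (suc mB)) → ⊥
        apart-FB v∈ v∈′ with ∈-tails v∈ | ∈-tails v∈′
        ... | d , d∈ , refl | e , e∈ , eq with ∈-fwd⁻ gF (suc j) d∈ | ∈-rev⁻ mB gB e∈
        ... | i , s≤s i≤j , refl | i′ , i′≤ , refl with m≤n⇒m<n∨m≡n i′≤
        ... | inj₁ lt = offB (suc i′) (s≤s z≤n) lt (subst (_∈ˡ tails wU) eq (F-on-U i i≤j))
        ... | inj₂ refl = exit-injective R EF tgF∈ i (suc j) (s≤s i≤j) (s≤s j<m) (trans eq tx)

        route : List (Dart nv)
        route = fwd gF (suc j) ++ fwd hB (suc mB)

        short-turns : Linked Turn route
        short-turns = subst (λ z → Linked Turn (z ++ fwd hB (suc mB))) (sym (fwd-snoc gF j))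
          (Linked-join (fwd gF j) (subst (Linked Turn) (fwd-snoc gF j) (fwd-turns gF (suc j))) (inj₂ hB≡) (fwd-turns hB (suc mB)))

        short : Passage R (tl a) (tl a″) route
        short = record
          { route = subst (λ z → Path z route (tl a″)) (sym ta)
              (path-++ (Passage.route F-pass) (subst (λ z → Path z (fwd hB (suc mB)) (tl gB)) tx (Passage.route B-pass)))
          ; inner = λ d∈ → case ∈-++⁻ (fwd gF (suc j)) d∈ of λ { (inj₁ p) → Passage.inner F-pass p ; (inj₂ p) → Passage.inner B-pass p }
          ; apart = subst Unique (sym (tails-++ (fwd gF (suc j)))) (Unique-++ (Passage.apart F-pass) (Passage.apart B-pass) apart-FB)
          ; fresh = λ {d} d∈ t≢ → case ∈-++⁻ (fwd gF (suc j)) d∈ of λ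
              { (inj₁ p) → Passage.fresh F-pass p (λ e → t≢ (trans e (sym ta)))
              ; (inj₂ p) → case tl d ≟ᶠ tl x₀ of λ { (yes e) → subst (_∉ˡ tails w) (sym e) x-off ; (no e) → Passage.fresh B-pass p e } }
          ; turns = short-turns }

        back : (a″ ∷ ys) ++ as ≡ (a″ ∷ ys ++ xs) ++ [ l ]
        back = sym (++-assoc (a″ ∷ ys) xs [ l ])

        abstract
          cut-W : Cut R ((a″ ∷ ys ++ xs) ++ [ l ] ++ route) (a ∷ cs)
          cut-W = subst (λ z → Cut R z (a ∷ cs)) (++-assoc (a″ ∷ ys ++ xs) [ l ] route)
            (replace R (as ++ M) (a″ ∷ ys) (sym (++-assoc as M (a″ ∷ ys))) (a″ ∷ ys ++ xs) l a cs
              (trans (sym (++-assoc (a″ ∷ ys) as M)) (cong₂ _++_ back (sym mid≡))) refl refl gF _ short)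

        turned : Linked Turn ((as ++ route) ++ a″ ∷ ys)
        turned = subst (Linked Turn) (sym (trans (++-assoc as route _) (cong (as ++_) (++-assoc (fwd gF (suc j)) _ _))))
          (Linked-join xs (Linked-++⁻ˡ as L) (inj₁ refl)
            (subst (λ z → Linked Turn (z ++ fwd hB (suc mB) ++ a″ ∷ ys)) (sym (fwd-snoc gF j))
              (Linked-join (fwd gF j) (subst (Linked Turn) (fwd-snoc gF j) (fwd-turns gF (suc j))) (inj₂ hB≡)
                (subst (λ z → Linked Turn (z ++ a″ ∷ ys)) (sym (fwd-snoc hB mB))
                  (Linked-join (fwd hB mB) (subst (Linked Turn) (fwd-snoc hB mB) (fwd-turns hB (suc mB)))
                    (inj₁ (sym (trans (rev-end mB gB) (opp-opp a″)))) (Linked-++⁻ʳ M (Linked-++⁻ʳ as L)))))))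

        -- Rotated back to the start of the original list, so that the free corner stays where it
        -- was and every other turn is admissible.
        W : Region ((as ++ route) ++ a″ ∷ ys)
        W = rotate (a″ ∷ ys) (recast (trans (++-assoc (a″ ∷ ys) xs _) (cong ((a″ ∷ ys) ++_) (sym (++-assoc xs [ l ] route)))) (Cut.region cut-W))

        contradictory : ⊥
        contradictory = go xs refl
          where
          -- The case distinction only exposes a first dart, as `Minimal` speaks of nonempty lists.
          go : ∀ zs → zs ≡ xs → ⊥
          go []       refl = least W turned (Cut.smaller cut-W)
          go (z ∷ zs) refl = least W turned (Cut.smaller cut-W)

    absurd : ⊥
    absurd = go k′ refl
      where
      go : ∀ m → k′ ≡ m → ⊥
      go zero    eq = case subst (0 <_) eq (proj₁ EU) of λ ()
      go (suc m) eq = Short.contradictory m eq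

  -- The list after a dart `l`, decomposed into straight segments, each of which opens with a right
  -- turn.
  data Runs (l : Dart nv) : List (Dart nv) → Set where
    done   : Runs l []
    corner : ∀ m w → Runs (iter τ m (rightward l)) w → Runs l (fwd (rightward l) (suc m) ++ w)

  runs : ∀ a w → Linked Turn (a ∷ w) → ∃₂ λ m w′ → a ∷ w ≡ fwd a (suc m) ++ w′ × Runs (iter τ m a) w′
  runs a []      _ = 0 , [] , refl , done
  runs a (b ∷ w) (t ∷ L) with runs b w L
  runs a (b ∷ w) (inj₁ refl ∷ L) | m , w′ , eq , r = suc m , w′ , cong (a ∷_) eq , subst (λ z → Runs z w′) (iter-shift τ m a) r
  runs a (b ∷ w) (inj₂ refl ∷ L) | m , w′ , eq , r = 0 , b ∷ w , refl , subst (Runs a) (sym eq) (corner m w′ r)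

  ∈-fwd-curve : ∀ {v} g k → v ∈ˡ tails (fwd g k) → Through (curve g) v
  ∈-fwd-curve g k v∈ with ∈-tails v∈
  ... | d , d∈ , refl with ∈-fwd⁻ g k d∈
  ... | i , _ , refl = iter τ i g , refl , curve-iter i g

  exit-recast : ∀ {w w′} (eq : w ≡ w′) (R : Region w) {g k} → Exit R g k → Exit (recast eq R) g k
  exit-recast refl R E = E

  -- The curves of two consecutive segments meet at the turn between them and, by induction, at the exit y of
  -- the backward extension of the second one; so the forward extension of the first passes over the second.
  module Segment (xs : List (Dart nv)) (a : Dart nv) (m m′ : ℕ) (w : List (Dart nv))
    (R : Region ((xs ++ fwd a (suc m)) ++ fwd (rightward (iter τ m a)) (suc m′) ++ w))
    (L : Linked Turn ((xs ++ fwd a (suc m)) ++ fwd (rightward (iter τ m a)) (suc m′) ++ w)) (least : Minimal (size R))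
    {y : Fin nv} (y∈ : y ∈ˡ tails (fwd a (suc m))) (y-on : Through (curve (rightward (iter τ m a))) y) where
    l a′ : Dart nv
    l = iter τ m a
    a′ = rightward l
    as : List (Dart nv)
    as = (xs ++ fwd a m) ++ [ l ]
    s≡ : xs ++ fwd a (suc m) ≡ as
    s≡ = trans (cong (xs ++_) (fwd-snoc a m)) (sym (++-assoc xs (fwd a m) [ l ]))
    w≡ : (xs ++ fwd a (suc m)) ++ fwd a′ (suc m′) ++ w ≡ as ++ a′ ∷ (fwd (τ a′) m′ ++ w)
    w≡ = cong (_++ fwd a′ (suc m′) ++ w) s≡
    R₁ : Region (as ++ a′ ∷ (fwd (τ a′) m′ ++ w))
    R₁ = recast w≡ R
    L₁ : Linked Turn (as ++ a′ ∷ (fwd (τ a′) m′ ++ w))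
    L₁ = subst (Linked Turn) w≡ L
    open Corner (xs ++ fwd a m) l (fwd (τ a′) m′ ++ w) R₁ L₁ least using (d∈; d′∈; forward)
    abstract
      exitF : ∃ λ k → Exit R₁ (τ l) (suc k)
      exitF with exit R₁ (τ l) (proj₁ (interior-corner R₁ d∈ d′∈ refl))
      ... | suc k , E = k , E
    kF : ℕ
    kF = suc (proj₁ exitF)
    EF : Exit R₁ (τ l) kF
    EF = proj₂ exitF
    z : Fin nv
    z = tl (iter τ kF (τ l))
    z∈ : z ∈ˡ tails (fwd (τ a′) m′) ⊎ z ∈ˡ tails w
    z∈ = ∈-tails-++ (fwd (τ a′) m′) (forward EF)
    c≢c′ : curve a ≢ curve a′
    c≢c′ eq = curve-σ³≢ (α l) (trans (sym eq) (sym (trans (curve-α l) (curve-iter m a))))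
    p-on : Through (curve a) (tl a′)
    p-on = τ l , refl , trans (curve-τ l) (curve-iter m a)
    z-on : Through (curve a) z
    z-on = iter τ kF (τ l) , refl , trans (curve-iter kF (τ l)) (trans (curve-τ l) (curve-iter m a))
    y∈as : y ∈ˡ tails as
    y∈as = subst (λ z → y ∈ˡ tails z) s≡ (∈-tails-++ʳ xs y∈)
    p≢ : ∀ {v} → v ∈ˡ tails (fwd (τ a′) m′ ++ w) → tl a′ ≢ v
    p≢ v∈ p≡v = Unique-head (proj₁ (proj₂ (Unique-++⁻ (tails as) (subst Unique (tails-++ as) (unique R₁)))))
      (subst (_∈ˡ tails (fwd (τ a′) m′ ++ w)) (sym p≡v) v∈)
    third : z ∈ˡ tails (fwd (τ a′) m′ ++ w) → Through (curve a′) z → ⊥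
    third z∈ z-on′ = no-three c≢c′ (λ p≡y → tails-disjoint R₁ as refl y∈as (here (sym p≡y))) (p≢ z∈)
      (λ y≡z → tails-disjoint R₁ as refl y∈as (there (subst (_∈ˡ tails (fwd (τ a′) m′ ++ w)) (sym y≡z) z∈)))
      p-on (a′ , refl , refl) (∈-fwd-curve a (suc m) y∈) y-on z-on z-on′
    over : z ∈ˡ tails w
    over with z∈
    ... | inj₂ p = p
    ... | inj₁ p = ⊥-elim (third (∈-tails-++ˡ (fwd (τ a′) m′) p)
                     (subst (λ c → Through c z) (curve-τ a′) (∈-fwd-curve (τ a′) m′ p)))

  -- The invariant is `y`: a vertex of the current segment, before its final turn, on the curve of
  -- the next segment. If the next backward extension exits on the next segment, the invariant
  -- passes on; if it exits earlier, it crosses the forward extension and `Crossing` applies.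
  walk-runs : ∀ xs a m m′ w (R : Region ((xs ++ fwd a (suc m)) ++ fwd (rightward (iter τ m a)) (suc m′) ++ w)) →
    Linked Turn ((xs ++ fwd a (suc m)) ++ fwd (rightward (iter τ m a)) (suc m′) ++ w) →
    Runs (iter τ m′ (rightward (iter τ m a))) w → Minimal (size R) →
    ∀ {y} → y ∈ˡ tails (fwd a (suc m)) → Through (curve (rightward (iter τ m a))) y → ⊥
  walk-runs xs a m m′ .[] R L done least y∈ y-on = case Segment.over xs a m m′ [] R L least y∈ y-on of λ ()
  walk-runs xs a m m′ _ R L (corner m″ w rs) least {y} y∈ y-on = beyond over
    where
    open Segment xs a m m′ _ R L least y∈ y-on
    l′ a″ : Dart nv
    l′ = iter τ m′ a′
    a″ = rightward l′
    ys : List (Dart nv)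
    ys = fwd (τ a″) m″ ++ w
    as′ : List (Dart nv)
    as′ = (as ++ fwd a′ m′) ++ [ l′ ]
    to-crossing : as ++ fwd a′ (suc m′) ++ a″ ∷ ys ≡ as ++ (fwd a′ m′ ++ [ l′ ]) ++ a″ ∷ ys
    to-crossing = cong (λ z → as ++ z ++ a″ ∷ ys) (fwd-snoc a′ m′)
    to-corner : as ++ (fwd a′ m′ ++ [ l′ ]) ++ a″ ∷ ys ≡ as′ ++ a″ ∷ ys
    to-corner = trans (sym (++-assoc as (fwd a′ m′ ++ [ l′ ]) (a″ ∷ ys))) (cong (_++ a″ ∷ ys) (sym (++-assoc as (fwd a′ m′) [ l′ ])))
    R₂ : Region (as ++ (fwd a′ m′ ++ [ l′ ]) ++ a″ ∷ ys)
    R₂ = recast to-crossing R₁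
    L₂ : Linked Turn (as ++ (fwd a′ m′ ++ [ l′ ]) ++ a″ ∷ ys)
    L₂ = subst (Linked Turn) to-crossing L₁
    R₃ : Region (as′ ++ a″ ∷ ys)
    R₃ = recast to-corner R₂
    L₃ : Linked Turn (as′ ++ a″ ∷ ys)
    L₃ = subst (Linked Turn) to-corner L₂
    module Next = Corner (as ++ fwd a′ m′) l′ ys R₃ L₃ least
    abstract
      exitB : ∃ (Exit R₃ (opp a″))
      exitB = exit R₃ (opp a″) (proj₂ (interior-corner R₃ Next.d∈ Next.d′∈ refl))
    kB : ℕ
    kB = proj₁ exitB
    v : Fin nv
    v = tl (iter τ kB (opp a″))
    v-on : Through (curve a″) v
    v-on = iter τ kB (opp a″) , refl , trans (curve-iter kB (opp a″)) (curve-opp a″)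
    v∈ : v ∈ˡ tails as ⊎ v ∈ˡ tails (fwd a′ (suc m′))
    v∈ = ∈-tails-++ as (subst (λ z → v ∈ˡ tails z) (trans (++-assoc as (fwd a′ m′) [ l′ ]) (cong (as ++_) (sym (fwd-snoc a′ m′))))
           (Next.backward (proj₂ exitB)))
    next≡ : (xs ++ fwd a (suc m)) ++ fwd a′ (suc m′) ++ fwd a″ (suc m″) ++ w ≡ ((xs ++ fwd a (suc m)) ++ fwd a′ (suc m′)) ++ fwd a″ (suc m″) ++ w
    next≡ = sym (++-assoc (xs ++ fwd a (suc m)) (fwd a′ (suc m′)) (fwd a″ (suc m″) ++ w))
    beyond : z ∈ˡ tails (fwd a″ (suc m″) ++ w) → ⊥
    -- The corner `tl a″` still lies on the curve of `a′`, which arrives there along `l′`; an exit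
    -- there would be a third common vertex.
    beyond (here eq) = third (∈-tails-++ʳ (fwd (τ a′) m′) (here eq)) (τ l′ , sym eq , trans (curve-τ l′) (curve-iter m′ a′))
    beyond (there z∈ys) with v∈
    ... | inj₁ v∈as = Crossing.absurd (xs ++ fwd a m) l a′ (fwd (τ a′) m′) l′ ys (fwd a′ m′) refl (fwd-snoc a′ m′) R₂ L₂ least
                        (exit-recast to-crossing R₁ EF) z∈ys (exit-recast (sym to-corner) R₃ (proj₂ exitB)) v∈as
    ... | inj₂ v∈s = walk-runs (xs ++ fwd a (suc m)) a′ m′ m″ w (recast next≡ R) (subst (Linked Turn) next≡ L) rs least v∈s v-on

  -- A single segment that closes up is an entire curve. That curve has a vertex on C, where no face
  -- belongs to the region.
  not-straight : ∀ a m → Region (fwd a (suc m) ++ []) → ⊥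
  not-straight a m R = leaves (curve a ≟ᶠ C)
    where
    w≡ : fwd a (suc m) ++ [] ≡ fwd a (suc m)
    w≡ = ++-identityʳ _
    R′ : Region (fwd a (suc m))
    R′ = recast w≡ R
    closed : tl (iter τ (suc m) a) ≡ tl a
    closed = trans (path-last (fwd a m) (subst (λ z → Path (base R′) z (base R′)) (fwd-snoc a m) (path R′))) (base≡ R′)
    period : iter τ (suc m) a ≡ a
    period with same-strand closed (curve-iter (suc m) a)
    ... | inj₁ eq = eq
    ... | inj₂ eq = ⊥-elim (iter≢opp (suc m) a eq)
    next∈ : ∀ {d} → d ∈ˡ fwd a (suc m) → τ d ∈ˡ fwd a (suc m)
    next∈ d∈ with ∈-fwd⁻ a (suc m) d∈
    ... | i , s≤s i≤m , refl with m≤n⇒m<n∨m≡n i≤m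
    ... | inj₁ i<m  = ∈-fwd⁺ a (suc m) (s≤s i<m)
    ... | inj₂ refl = here period
    all∈ : ∀ k → iter τ k a ∈ˡ fwd a (suc m)
    all∈ zero    = here refl
    all∈ (suc k) = next∈ (all∈ k)
    leaves : Dec (curve a ≡ C) → ⊥
    leaves (yes eq) = true≢false (trans (sym (left R′ (here refl))) (off-C R′ (a , refl , eq)))
    leaves (no ne) with crosses-twice (curve a) C ne
    ... | x , _ , _ , mx , _ with meets-darts mx
    ... | (d , td , cd) , (e , te , ce) with reach a d (sym cd)
    ... | K , p = true≢false (trans (sym (left R′ (all∈ K))) (off-C R′ (e , trans te (sym (trans p td)) , ce)))

  no-loop : ∀ N {d w} (R : Region (d ∷ w)) → Linked Turn (d ∷ w) → size R < N → ⊥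
  no-loop (suc N) {d} {w} R L (s≤s size≤) = start (runs d w L)
    where
    least : Minimal (size R)
    least R′ L′ lt = no-loop N R′ L′ (≤-trans lt size≤)
    start : (∃₂ λ m w′ → d ∷ w ≡ fwd d (suc m) ++ w′ × Runs (iter τ m d) w′) → ⊥
    start (m , .[] , eq , done) = not-straight d m (recast eq R)
    -- Nothing precedes the first segment, so the backward extension at its end leaves on that very
    -- segment: this is the initial `y`.
    start (m , _ , eq , corner m′ w′ rs) =
      walk-runs [] d m m′ w′ (recast eq R) (subst (Linked Turn) eq L) rs least
        (subst (λ z → v ∈ˡ tails z) (sym (fwd-snoc d m)) (backward (proj₂ exitB)))
        (iter τ (proj₁ exitB) (opp a′) , refl , trans (curve-iter (proj₁ exitB) (opp a′)) (curve-opp a′))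
      where
      a′ : Dart nv
      a′ = rightward (iter τ m d)
      eq′ : d ∷ w ≡ (fwd d m ++ [ iter τ m d ]) ++ a′ ∷ (fwd (τ a′) m′ ++ w′)
      eq′ = trans eq (cong (_++ fwd a′ (suc m′) ++ w′) (fwd-snoc d m))
      R₁ : Region ((fwd d m ++ [ iter τ m d ]) ++ a′ ∷ (fwd (τ a′) m′ ++ w′))
      R₁ = recast eq′ R
      open Corner (fwd d m) (iter τ m d) (fwd (τ a′) m′ ++ w′) R₁ (subst (Linked Turn) eq′ L) least using (d∈; d′∈; backward)
      exitB : ∃ (Exit R₁ (opp a′))
      exitB = exit R₁ (opp a′) (proj₂ (interior-corner R₁ d∈ d′∈ refl))
      v : Fin nv
      v = tl (iter τ (proj₁ exitB) (opp a′))

-- 2-degeneracy off C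

module Degeneracy {n : ℕ} (A : Arrangement n) (C : Fin n) where
  open NoLoops A C public

  -- If every vertex of H has at most one edge leaving H, walk along H keeping as far right as possible,
  -- starting where some curve leaves H for the last time before reaching C.  The face of H on the right
  -- contains C, and the first closed part of the walk bounds a region on the left.
  module Core (H : Fin nv → Bool) (H-off : ∀ {v} → H v ≡ true → ¬ Through C v)
    (dense : ∀ {d e} → H (tl d) ≡ true → tl e ≡ tl d → H (hd d) ≡ false → H (hd e) ≡ false → e ≡ d)
    (v₀ : Fin nv) (v₀∈ : H v₀ ≡ true) where
    private
      s : Dart nv
      s = v₀ , 0F

      s-curve : curve s ≢ C
      s-curve eq = H-off v₀∈ (s , refl , eq)

      to-C : ∃₂ λ K x → tl (iter τ K s) ≡ x × Through C x
      to-C with crosses-twice (curve s) C s-curve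
      ... | x , _ , _ , mx , _ with meets-darts mx
      ... | (d , td , cd) , on-C with reach s d (sym cd)
      ... | K , p = K , x , trans p td , on-C

      K : ℕ
      K = proj₁ to-C

      H-false : ∀ {v} → Through C v → H v ≡ false
      H-false {v} t with false-or-true (H v)
      ... | inj₁ p = p
      ... | inj₂ p = ⊥-elim (H-off p t)

      K-on-C : Through C (tl (iter τ K s))
      K-on-C = subst (Through C) (sym (proj₁ (proj₂ (proj₂ to-C)))) (proj₂ (proj₂ (proj₂ to-C)))

      leaving : ∃ λ i → i < K × H (tl (iter τ i s)) ≡ true × (∀ j → i < j → j ≤ K → H (tl (iter τ j s)) ≢ true)
      leaving = last-index (λ i → H (tl (iter τ i s)) ≟ᵇ true) K v₀∈ (λ p → H-off p K-on-C)

      i₀ : ℕ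
      i₀ = proj₁ leaving
      -- Since `σ d₀` is `out`, the face on the right of `d₀` is the one on the left of `out`; from
      -- there `S-after` follows the curve to C.
      out d₀ : Dart nv
      out = iter τ i₀ s
      d₀ = σ (σ (σ out))

      after : ∀ j → i₀ < j → j ≤ K → H (tl (iter τ j s)) ≡ false
      after j i<j j≤K = ¬-not (proj₂ (proj₂ (proj₂ leaving)) j i<j j≤K)

      head-in : ∀ {d e} → H (tl d) ≡ true → H (hd d) ≡ false → tl e ≡ tl d → e ≢ d → H (hd e) ≡ true
      head-in {d} {e} Ht Hh t ne with false-or-true (H (hd e))
      ... | inj₂ p = p
      ... | inj₁ p = ⊥-elim (ne (dense Ht t Hh p))

      W : Dart nv → Dart nv
      W d with H (hd (rightward d))
      ... | true  = rightward d
      ... | false = τ d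

      W-tl : ∀ d → tl (W d) ≡ hd d
      W-tl d with H (hd (rightward d))
      ... | true  = refl
      ... | false = refl

      W-turn : ∀ d → Turn d (W d)
      W-turn d with H (hd (rightward d))
      ... | true  = inj₂ refl
      ... | false = inj₁ refl

      Inside : Dart nv → Set
      Inside d = H (tl d) ≡ true × H (hd d) ≡ true

      W-inside : ∀ {d} → Inside d → Inside (W d)
      W-inside {d} (_ , Hh) with H (hd (rightward d)) in eq
      ... | true  = Hh , eq
      ... | false = Hh , head-in {rightward d} Hh eq refl (λ e → σ≢ _ (sym e))

      data Reached : Dart nv → Set where
        start : Reached d₀
        next  : ∀ {d} → Reached d → Reached (W d)

      reached-inside : ∀ {d} → Reached d → Inside d
      reached-inside start = proj₁ (proj₂ (proj₂ leaving))
        , head-in {out} (proj₁ (proj₂ (proj₂ leaving))) (after (suc i₀) ≤-refl (proj₁ (proj₂ leaving))) refl (σ³≢ out)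
      reached-inside (next r) = W-inside (reached-inside r)

      module _ (e : Dart nv) (w : List (Dart nv)) (p : Path (tl e) (e ∷ w) (tl e)) (u : Unique (tails (e ∷ w)))
        (L : Linked Turn (e ∷ w)) (rs : ∀ {d} → d ∈ˡ e ∷ w → Reached d) where
        abstract
          sep : Separation (e ∷ w)
          sep = separation (e ∷ w) p u (unreversed p u L)
        open Separation sep renaming (left to S-left; right to S-right; flat to S-flat)

        S-outside : ∀ {d} → ¬ Inside d → S (σ d) ≡ S d
        S-outside {d} no-in = S-flat (λ m → no-in (reached-inside (rs m)))
          (λ m → no-in (subst (λ z → H (tl z) ≡ true) (α-invol d) (proj₂ (reached-inside (rs m))) , proj₁ (reached-inside (rs m))))

        S-off : ∀ {d} → H (tl d) ≡ false → S (σ d) ≡ S d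
        S-off no-H = S-outside (λ i → true≢false (trans (sym (proj₁ i)) no-H))

        -- A right turn keeps the face on the right. Going straight passes over one dart that leaves
        -- H, and such an edge is not on the walk.
        S-right-constant : ∀ {d} → Reached d → S (σ d) ≡ S (σ d₀)
        S-right-constant start = refl
        S-right-constant (next {d} r) = trans step (S-right-constant r)
          where
          S-α : S (α d) ≡ S (σ d)
          S-α = trans (sym (face′ (α d))) (cong (λ z → S (σ z)) (α-invol d))
          step : S (σ (W d)) ≡ S (σ d)
          step with H (hd (rightward d)) in eq
          ... | true  = trans (cong S (σ⁴ (α d))) S-α
          ... | false = trans (sym (S-outside {rightward d} (λ i → true≢false (trans (sym (proj₂ i)) eq))))
                          (trans (cong S (σ⁴ (α d))) S-α)

        S-out : S out ≡ false
        S-out = trans (cong S (sym (σ⁴ out))) (trans (sym (S-right-constant (rs (here refl)))) (S-right (here refl)))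

        S-τ : ∀ {d} → H (hd d) ≡ false → S (τ d) ≡ S d
        S-τ {d} no-H = trans (S-off {σ (α d)} no-H) (face′ d)

        S-after : ∀ j → i₀ + j ≤ K → S (iter τ (j + i₀) s) ≡ false
        S-after zero    _  = S-out
        S-after (suc j) le = trans (S-τ {iter τ (j + i₀) s} (after (suc j + i₀) (s≤s (m≤n+m i₀ j)) le′)) (S-after j (≤-trans (n≤1+n _) (subst (_≤ K) (+-suc i₀ j) le)))
          where
          le′ : suc j + i₀ ≤ K
          le′ = subst (_≤ K) (+-comm i₀ (suc j)) le

        S-at : ∀ {d g} → H (tl d) ≡ false → tl g ≡ tl d → S g ≡ S d
        S-at {d} {g} no-H t with around d g t
        ... | inj₁ refl = refl
        ... | inj₂ (inj₁ refl) = S-off no-H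
        ... | inj₂ (inj₂ (inj₁ refl)) = trans (S-off {σ d} no-H) (S-off no-H)
        ... | inj₂ (inj₂ (inj₂ refl)) = trans (S-off {σ (σ d)} no-H) (trans (S-off {σ d} no-H) (S-off no-H))

        S-K : S (iter τ K s) ≡ false
        S-K = subst (λ z → S (iter τ z s) ≡ false) (m∸n+n≡m i≤K) (S-after (K ∸ i₀) (≤-reflexive (m+[n∸m]≡n i≤K)))
          where
          i≤K : i₀ ≤ K
          i≤K = <⇒≤ (proj₁ (proj₂ leaving))

        S-along-C : ∀ {d} → curve d ≡ C → ∀ k → S (iter τ k d) ≡ S d
        S-along-C c zero    = refl
        S-along-C {d} c (suc k) = trans (S-τ {iter τ k d} (H-false (iter τ (suc k) d , refl , trans (curve-iter (suc k) d) c))) (S-along-C c k)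

        S-C : ∀ {d} → Through C (tl d) → S d ≡ false
        S-C {d} (g , tg , cg) with K-on-C
        ... | h , th , ch with reach h g (trans ch (sym cg))
        ... | k , q = trans (S-at {iter τ k h} {d} (H-false (g , sym q , cg)) (sym (trans q tg)))
                (trans (S-along-C ch k) (trans (S-at {iter τ K s} {h} (H-false K-on-C) th) S-K))

        loop-region : Region (e ∷ w)
        loop-region = record
          { base = tl e ; path = p ; unique = u ; f = S ; f-face = face′ ; left = S-left ; right = S-right
          ; only = S-only ; off-C = S-C }
          where
          S-only : ∀ {d} → S d ≡ true → S (σ d) ≡ false → d ∈ˡ e ∷ w
          S-only {d} a b with d ∈ᵈ? (e ∷ w) | α d ∈ᵈ? (e ∷ w)
          ... | yes m | _ = m
          ... | no m | yes m′ = ⊥-elim (true≢false (trans (sym (S-left m′))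
                  (trans (sym (face′ (α d))) (trans (cong (λ z → S (σ z)) (α-invol d)) b))))
          ... | no m | no m′ = ⊥-elim (true≢false (trans (sym a) (trans (sym (S-flat m m′)) b)))

        no-closed-walk : ⊥
        no-closed-walk = no-loop (suc (size loop-region)) loop-region L ≤-refl

      -- The tails so far are distinct, so a repetition occurs within nv + 1 steps. The closed part
      -- starts at the repeated vertex, where its free corner lies.
      find : ∀ fuel {a} ps d → Path a ps (tl d) → Unique (tails ps) → Linked Turn (ps ++ [ d ]) →
        (∀ {x} → x ∈ˡ ps ++ [ d ] → Reached x) → nv < fuel + length ps → ⊥
      find zero ps d p u L rs lt = <-irrefl refl (≤-trans lt (≤-trans (≤-reflexive (sym (length-map tl ps)))
        (≤-trans (Unique-length-≤ u (λ {x} _ → ∈-allFin x)) (≤-reflexive (length-tabulate {n = nv} id)))))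
      find (suc fuel) ps d p u L rs lt with tl d ∈ᵛ? tails ps
      ... | no t∉ = find fuel (ps ++ [ d ]) (W d)
              (path-++ p (refl ∷ subst (Path (hd d) []) (sym (W-tl d)) []))
              (subst Unique (sym (tails-++ ps)) (Unique-++ u ([] ∷ []) (λ { x∈ (here refl) → t∉ x∈ })))
              (Linked-join ps L (W-turn d) [-])
              (λ x∈ → case ∈-snoc (ps ++ [ d ]) x∈ of λ { (inj₁ y) → rs y ; (inj₂ refl) → next (rs (∈-++⁺ʳ ps (here refl))) })
              (≤-trans lt (≤-reflexive (trans (sym (+-suc fuel (length ps))) (cong (fuel +_) (trans (sym (+-comm (length ps) 1)) (sym (length-++ ps)))))))
      ... | yes t∈ with tails-split ps t∈
      ... | p₁ , e , p₂ , refl , te with path-split p₁ p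
      ... | x , _ , q = no-closed-walk e p₂ (subst₂ (λ y z → Path y (e ∷ p₂) z) (sym (path-start q)) (sym te) q)
              (proj₁ (proj₂ (Unique-++⁻ (tails p₁) (subst Unique (tails-++ p₁) u))))
              (Linked-++⁻ʳ p₁ (Linked-++⁻ˡ (p₁ ++ e ∷ p₂) L)) (λ x∈ → rs (∈-++⁺ˡ (∈-++⁺ʳ p₁ x∈)))

    absurd : ⊥
    absurd = find (suc nv) {tl d₀} [] d₀ [] [] [-] (λ { (here refl) → start }) (m≤m+n (suc nv) 0)

  degenerate : (H : Fin nv → Bool) → (∀ {v} → H v ≡ true → ¬ Through C v) → ∀ v₀ → H v₀ ≡ true →
    ∃ λ v → H v ≡ true × Low H v
  degenerate H off v₀ v₀∈ with any? (λ v → (H v ≟ᵇ true) ×-dec low? H v)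
  ... | yes found = found
  ... | no none = ⊥-elim (Core.absurd H off dense v₀ v₀∈)
    where
    dense : ∀ {d e} → H (tl d) ≡ true → tl e ≡ tl d → H (hd d) ≡ false → H (hd e) ≡ false → e ≡ d
    dense {d} {e} Hd t p q with e ≟ᵈ d
    ... | yes eq = eq
    ... | no ne = ⊥-elim (none (tl d , Hd , e , d , t , refl , ne , q , p))

-- Greedy colouring, sides and chords of a curve

avoid-two : ∀ {m} (a b : Fin (suc (suc (suc m)))) → ∃ λ c → c ≢ a × c ≢ b
avoid-two a b with 0F ≟ᶠ a | 0F ≟ᶠ b | 1F ≟ᶠ a | 1F ≟ᶠ b
... | no p     | no q     | _        | _        = 0F , p , q
... | yes refl | _        | _        | no q     = 1F , (λ ()) , q
... | yes refl | _        | _        | yes refl = 2F , (λ ()) , (λ ())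
... | no _     | yes refl | no p     | _        = 1F , p , (λ ())
... | no _     | yes refl | yes refl | _        = 2F , (λ ()) , (λ ())

module Colouring {n : ℕ} (A : Arrangement n) (other : ∀ (c : Fin n) → ∃ λ c′ → c′ ≢ c) where
  open Walks A

  -- A loop edge returning as `opp d` would be its entire curve, with one vertex only, whereas
  -- another curve crosses it at two.
  loopless : ∀ d → hd d ≢ tl d
  loopless d eq with around d (α d) eq
  ... | inj₁ p = α-nofix d p
  ... | inj₂ (inj₁ p) = curve-σ≢ d (trans (cong curve (sym p)) (curve-α d))
  ... | inj₂ (inj₂ (inj₂ p)) = curve-σ³≢ d (trans (cong curve (sym p)) (curve-α d))
  ... | inj₂ (inj₂ (inj₁ p)) with other (curve d)
  ... | c′ , c′≢ with crosses-twice (curve d) c′ (c′≢ ∘ sym)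
  ... | u , w , u≢w , mu , mw , _ = u≢w (trans (only mu) (sym (only mw)))
    where
    fixed : ∀ k → iter τ k d ≡ d
    fixed zero    = refl
    fixed (suc k) = trans (cong τ (fixed k)) (trans (cong opp p) (opp-opp d))
    only : ∀ {x} → Meets curve (curve d) c′ x → x ≡ tl d
    only m with proj₁ (meets-darts m)
    ... | e , te , ce with reach d e (sym ce)
    ... | k , q = trans (sym te) (trans (sym q) (cong tl (fixed k)))

  Proper : (Fin nv → Bool) → (Fin nv → Fin 3) → Set
  Proper P κ = ∀ d → P (tl d) ≡ true → P (hd d) ≡ true → κ (tl d) ≢ κ (hd d)

  infix 5 _[_≔_]
  _[_≔_] : ∀ {X : Set} → (Fin nv → X) → Fin nv → X → Fin nv → X
  (κ [ x ≔ c ]) v with v ≟ᶠ x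
  ... | yes _ = c
  ... | no  _ = κ v

  ≔-here : ∀ {X : Set} (κ : Fin nv → X) x c → (κ [ x ≔ c ]) x ≡ c
  ≔-here κ x c with x ≟ᶠ x
  ... | yes _ = refl
  ... | no ne = ⊥-elim (ne refl)

  ≔-there : ∀ {X : Set} (κ : Fin nv → X) {x v} c → v ≢ x → (κ [ x ≔ c ]) v ≡ κ v
  ≔-there κ {x} {v} c ne with v ≟ᶠ x
  ... | yes eq = ⊥-elim (ne eq)
  ... | no _   = refl

  update-proper : ∀ {P κ x c} → Proper P κ → (∀ d → tl d ≡ x → P (hd d) ≡ true → c ≢ κ (hd d)) →
    Proper (P [ x ≔ true ]) (κ [ x ≔ c ])
  update-proper {P} {κ} {x} {c} proper ok d pt ph eq with tl d ≟ᶠ x | hd d ≟ᶠ x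
  ... | yes t | yes h = loopless d (trans h (sym t))
  ... | yes t | no _  = ok d t ph eq
  ... | no _  | yes h = ok (α d) h (trans (cong (λ z → P (tl z)) (α-invol d)) pt) (trans (sym eq) (cong (λ z → κ (tl z)) (sym (α-invol d))))
  ... | no _  | no _  = proper d pt ph eq

  other-two : ∀ {v} {d e : Dart nv} → tl d ≡ v → tl e ≡ v → d ≢ e →
    ∃₂ λ g h → ∀ x → tl x ≡ v → x ≡ d ⊎ x ≡ e ⊎ x ≡ g ⊎ x ≡ h
  other-two {v} {d} {e} td te ne with around d e (trans te (sym td))
  ... | inj₁ eq = ⊥-elim (ne (sym eq))
  ... | inj₂ (inj₁ refl) = σ (σ d) , σ (σ (σ d)) , λ x tx → around d x (trans tx (sym td))
  ... | inj₂ (inj₂ (inj₁ refl)) = σ d , σ (σ (σ d)) , λ x tx → case around d x (trans tx (sym td)) of λ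
      { (inj₁ p) → inj₁ p ; (inj₂ (inj₁ p)) → inj₂ (inj₂ (inj₁ p)) ; (inj₂ (inj₂ (inj₁ p))) → inj₂ (inj₁ p)
      ; (inj₂ (inj₂ (inj₂ p))) → inj₂ (inj₂ (inj₂ p)) }
  ... | inj₂ (inj₂ (inj₂ refl)) = σ d , σ (σ d) , λ x tx → case around d x (trans tx (sym td)) of λ
      { (inj₁ p) → inj₁ p ; (inj₂ (inj₁ p)) → inj₂ (inj₂ (inj₁ p)) ; (inj₂ (inj₂ (inj₁ p))) → inj₂ (inj₂ (inj₂ p))
      ; (inj₂ (inj₂ (inj₂ p))) → inj₂ (inj₁ p) }

  colour-low : ∀ P (κ : Fin nv → Fin 3) {v} → Low P v → ∃ λ c → ∀ d → tl d ≡ v → P (hd d) ≡ true → c ≢ κ (hd d)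
  colour-low P κ (d , e , td , te , ne , pd , pe) with other-two td te ne
  ... | g , h , cover with avoid-two (κ (hd g)) (κ (hd h))
  ... | c , c≢g , c≢h = c , λ x tx px → case cover x tx of λ
      { (inj₁ refl) → ⊥-elim (true≢false (trans (sym px) pd))
      ; (inj₂ (inj₁ refl)) → ⊥-elim (true≢false (trans (sym px) pe))
      ; (inj₂ (inj₂ (inj₁ refl))) → c≢g ; (inj₂ (inj₂ (inj₂ refl))) → c≢h }

  infixr 6 _∪_
  _∪_ : (P Q : Fin nv → Bool) → Fin nv → Bool
  (P ∪ Q) v = P v ∨ Q v

  ∪-true : ∀ {a b} → a ∨ b ≡ true → a ≡ true ⊎ b ≡ true
  ∪-true {true}  _ = inj₁ refl
  ∪-true {false} p = inj₂ p

  ∪-falseˡ : ∀ {a b} → a ≡ false → b ≡ false → a ∨ b ≡ false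
  ∪-falseˡ refl refl = refl

  abstract
    -- Greedy colouring: a low vertex of Q is set aside, the rest is coloured, and a third colour is
    -- left for it. Asking for low vertices in all nonempty `H` inside Q makes the hypothesis
    -- hereditary. It is applied with P empty off C and again along C.
    extend : ∀ N (P Q : Fin nv → Bool) κ → Proper P κ → (∀ v → Q v ≡ true → P v ≡ false) → countᵇ (allFin nv) Q < N →
      (∀ H → (∀ v → H v ≡ true → Q v ≡ true) → ∀ v₀ → H v₀ ≡ true → ∃ λ v → H v ≡ true × Low (P ∪ H) v) →
      ∃ λ κ′ → Proper (P ∪ Q) κ′ × (∀ v → P v ≡ true → κ′ v ≡ κ v)
    extend (suc N) P Q κ proper disjoint (s≤s lt) elim with any? (λ v → Q v ≟ᵇ true)
    ... | no none = κ , (λ d pt ph → proper d (only pt) (only ph)) , λ _ _ → refl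
      where
      only : ∀ {v} → (P ∪ Q) v ≡ true → P v ≡ true
      only {v} p with ∪-true {P v} p
      ... | inj₁ a = a
      ... | inj₂ b = ⊥-elim (none (v , b))
    ... | yes (v₀ , v₀∈) with elim Q (λ _ → id) v₀ v₀∈
    ... | v , v∈ , d , e , td , te , ne , pd , pe
      with extend N P (Q [ v ≔ false ]) κ proper (λ u u∈ → disjoint u (sub u u∈))
             (≤-trans (countᵇ-strict sub (∈-allFin v) (≔-here Q v false) v∈) lt)
             (λ H H⊆ → elim H (λ u u∈ → sub u (H⊆ u u∈)))
      where
      sub : ∀ u → (Q [ v ≔ false ]) u ≡ true → Q u ≡ true
      sub u p with u ≟ᶠ v
      ... | no _ = p
    ... | κ₁ , proper₁ , agree with colour-low (P ∪ (Q [ v ≔ false ])) κ₁ (d , e , td , te , ne , shrink pd , shrink pe)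
      where
      shrink : ∀ {u} → (P ∪ Q) u ≡ false → (P ∪ (Q [ v ≔ false ])) u ≡ false
      shrink {u} p with P u | u ≟ᶠ v
      ... | false | yes _ = refl
      ... | false | no _  = p
    ... | c , ok = κ₁ [ v ≔ c ] , (λ x pt ph → update-proper {P ∪ (Q [ v ≔ false ])} {κ₁} {v} {c} proper₁ ok x (grow pt) (grow ph))
        , λ u pu → trans (≔-there κ₁ c (λ { refl → true≢false (trans (sym pu) (disjoint v v∈)) })) (agree u pu)
      where
      grow : ∀ {u} → (P ∪ Q) u ≡ true → ((P ∪ (Q [ v ≔ false ])) [ v ≔ true ]) u ≡ true
      grow {u} p with u ≟ᶠ v in eq
      ... | yes _ = refl
      ... | no  _ rewrite eq = p

  through? : ∀ c v → Dec (Through c v)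
  through? c v = map′ (λ { (i , p) → (v , i) , refl , p }) (λ { ((.v , i) , refl , p) → i , p }) (any? (λ i → curve (v , i) ≟ᶠ c))

  on : Fin n → Fin nv → Bool
  on c v = does (through? c v)

  -- The faces with f = true form the inside of C; there are two choices.
  record Side (C : Fin n) : Set where
    field
      f      : Dart nv → Bool
      f-face : ∀ d → f (σ (α d)) ≡ f d
      jump   : ∀ {d} → curve d ≡ C → f (σ d) ≡ not (f d)
      flat   : ∀ {d} → curve d ≢ C → f (σ d) ≡ f d

    f-α : ∀ d → f (α d) ≡ f (σ d)
    f-α d = trans (sym (f-face (α d))) (cong (λ z → f (σ z)) (α-invol d))

    off-flat : ∀ {d} → ¬ Through C (tl d) → f (σ d) ≡ f d
    off-flat {d} off = flat (λ eq → off (d , refl , eq))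

    off-constant : ∀ {d e} → ¬ Through C (tl d) → tl e ≡ tl d → f e ≡ f d
    off-constant {d} {e} off t with around d e t
    ... | inj₁ refl = refl
    ... | inj₂ (inj₁ refl) = off-flat off
    ... | inj₂ (inj₂ (inj₁ refl)) = trans (off-flat {σ d} off) (off-flat off)
    ... | inj₂ (inj₂ (inj₂ refl)) = trans (off-flat {σ (σ d)} off) (trans (off-flat {σ d} off) (off-flat off))

  abstract
    side : ∀ C → Side C
    side C with bounds (λ d → does (curve d ≟ᶠ C)) (λ d → cong (λ c → does (c ≟ᶠ C)) (curve-α d)) even
      where
      even : ∀ v → around-sum (λ d → does (curve d ≟ᶠ C)) v ≡ false
      even v rewrite curve-opp (v , 0F) | curve-opp (v , 1F) = brute (does (curve (v , 0F) ≟ᶠ C)) (does (curve (v , 1F) ≟ᶠ C))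
        where
        brute : ∀ a b → a xor (b xor (a xor (b xor false))) ≡ false
        brute false false = refl
        brute false true  = refl
        brute true  false = refl
        brute true  true  = refl
    ... | S , S-face , S-jump = record
      { f = S ; f-face = S-face
      ; jump = λ {d} eq → xor-≢ (trans (S-jump d) (dec-true (curve d ≟ᶠ C) eq))
      ; flat = λ {d} ne → sym (xor-≡ (trans (S-jump d) (dec-false (curve d ≟ᶠ C) ne))) }

    -- All degrees are 4, so the set of all edges is even and bounds one class of a chequerboard
    -- colouring of the faces.
    chequer : ∃ λ (χ : Dart nv → Bool) → (∀ d → χ (σ (α d)) ≡ χ d) × (∀ d → χ (σ d) ≡ not (χ d))
    chequer with bounds (λ _ → true) (λ _ → refl) (λ _ → refl)
    ... | S , S-face , S-jump = S , S-face , λ d → xor-≢ (S-jump d)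

  opposite : ∀ {C} → Side C → Side C
  opposite s = record { f = not ∘ f ; f-face = λ d → cong not (f-face d)
                      ; jump = λ eq → cong not (jump eq) ; flat = λ ne → cong not (flat ne) }
    where open Side s

  Chord : ∀ {C} → Side C → Dart nv → Set
  Chord {C} s d = Through C (tl d) × curve d ≢ C × Side.f s d ≡ true × Through C (hd d)

  crossing-curve : ∀ {C e} → Through C (tl e) → curve e ≢ C → curve (σ e) ≡ C
  crossing-curve {C} {e} (g , tg , cg) ne with around e g tg
  ... | inj₁ refl = ⊥-elim (ne cg)
  ... | inj₂ (inj₁ refl) = cg
  ... | inj₂ (inj₂ (inj₁ refl)) = ⊥-elim (ne (trans (sym (curve-opp e)) cg))
  ... | inj₂ (inj₂ (inj₂ refl)) = trans (sym (curve-opp (σ e))) cg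

  no-third-curve : ∀ {a b c v} → a ≢ b → a ≢ c → b ≢ c → Through a v → Through b v → Through c v → ⊥
  no-third-curve {v = v} ab ac bc (d , td , refl) (e , te , refl) (g , tg , refl)
    with pick d td | pick e te | pick g tg
    where
    pick : ∀ d → tl d ≡ v → curve d ≡ curve (v , 0F) ⊎ curve d ≡ curve (v , 1F)
    pick d refl = base-curve d
  ... | inj₁ p | inj₁ q | _ = ab (trans p (sym q))
  ... | inj₂ p | inj₂ q | _ = ab (trans p (sym q))
  ... | inj₁ p | inj₂ q | inj₁ r = ac (trans p (sym r))
  ... | inj₁ p | inj₂ q | inj₂ r = bc (trans q (sym r))
  ... | inj₂ p | inj₁ q | inj₁ r = bc (trans q (sym r))
  ... | inj₂ p | inj₁ q | inj₂ r = ac (trans p (sym r))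

  -- The chord uses up both crossings of its curve with C, so the rest of that curve stays outside.
  chord-empty : ∀ {C} (s : Side C) {d} → Chord s d → ∀ e → curve e ≡ curve d → ¬ Through C (tl e) → Side.f s e ≡ false
  chord-empty {C} s {d} (x-on , c≢C , fd , y-on) e ce off with reach d e (sym ce)
  ... | k , q with visits k
    where
    open Side s
    turns-out : ∀ g → Through C (tl g) → curve g ≡ curve d → f g ≡ true → f (opp g) ≡ false
    turns-out g on-C cg fg = trans (jump {σ g} (crossing-curve {C} {g} on-C (λ eq → c≢C (trans (sym cg) eq))))
      (cong not (trans (flat {g} (λ eq → c≢C (trans (sym cg) eq))) fg))
    fαd : f (α d) ≡ true
    fαd = trans (f-α d) (trans (flat c≢C) fd)
    visits : ∀ k → f (iter τ k d) ≡ false ⊎ iter τ k d ≡ d ⊎ iter τ k d ≡ α d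
    visits zero = inj₂ (inj₁ refl)
    visits (suc k) with visits k
    ... | inj₂ (inj₁ eq) = inj₁ (trans (cong (f ∘ τ) eq) (turns-out (α d) y-on (curve-α d) fαd))
    ... | inj₂ (inj₂ eq) = inj₁ (trans (cong (f ∘ τ) eq) (trans (cong (f ∘ opp) (α-invol d)) (turns-out d x-on refl fd)))
    ... | inj₁ fe = go (through? C (hd g))
      where
      g : Dart nv
      g = iter τ k d
      cg : curve g ≡ curve d
      cg = curve-iter k d
      g≢C : curve g ≢ C
      g≢C eq = c≢C (trans (sym cg) eq)
      fαg : f (α g) ≡ false
      fαg = trans (f-α g) (trans (flat g≢C) fe)
      at : ∀ h → f h ≡ true → curve h ≡ curve d → hd g ≡ tl h → τ g ≡ h
      at h fh ch t with same-strand {h} {α g} t (trans (curve-α g) (trans cg (sym ch)))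
      ... | inj₁ eq = ⊥-elim (true≢false (trans (sym fh) (trans (cong f (sym eq)) fαg)))
      ... | inj₂ eq = trans (cong opp eq) (opp-opp h)
      go : Dec (Through C (hd g)) → f (τ g) ≡ false ⊎ τ g ≡ d ⊎ τ g ≡ α d
      go (no off′) = inj₁ (trans (off-flat {σ (α g)} off′) (trans (f-face g) fe))
      go (yes on-C) with hd g ≟ᶠ tl d | hd g ≟ᶠ hd d
      ... | yes t | _     = inj₂ (inj₁ (at d fd refl t))
      ... | no _  | yes t = inj₂ (inj₂ (at (α d) fαd (curve-α d) t))
      ... | no a  | no b  = ⊥-elim (no-three c≢C (loopless d ∘ sym) (a ∘ sym) (b ∘ sym)
              (d , refl , refl) x-on (α d , refl , curve-α d) y-on (α g , refl , trans (curve-α g) cg) on-C)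
  ... | inj₁ fk = trans (Side.off-constant s {iter τ k d} {e} (λ t → off (subst (Through C) q t)) (sym q)) fk
  ... | inj₂ (inj₁ eq) = ⊥-elim (off (subst (Through C) (trans (cong tl (sym eq)) q) x-on))
  ... | inj₂ (inj₂ eq) = ⊥-elim (off (subst (Through C) (trans (cong tl (sym eq)) q) y-on))

-- Shifts modulo 3 and the extension of a colouring to C

add₃ : Fin 3 → Fin 3 → Fin 3
add₃ 0F a  = a
add₃ 1F 0F = 1F
add₃ 1F 1F = 2F
add₃ 1F 2F = 0F
add₃ 2F 0F = 2F
add₃ 2F 1F = 0F
add₃ 2F 2F = 1F

-- Modulo 3 the double of `s` is its negative.
add₃-inverse : ∀ s a → add₃ (add₃ s s) (add₃ s a) ≡ a
add₃-inverse 0F a  = refl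
add₃-inverse 1F 0F = refl
add₃-inverse 1F 1F = refl
add₃-inverse 1F 2F = refl
add₃-inverse 2F 0F = refl
add₃-inverse 2F 1F = refl
add₃-inverse 2F 2F = refl

add₃-injective : ∀ s {a b} → add₃ s a ≡ add₃ s b → a ≡ b
add₃-injective s {a} {b} eq = trans (sym (add₃-inverse s a)) (trans (cong (add₃ (add₃ s s)) eq) (add₃-inverse s b))

two-shifts : ∀ a t → ∃₂ λ r s → r ≢ s × add₃ r a ≢ t × add₃ s a ≢ t
two-shifts 0F 0F = 1F , 2F , (λ ()) , (λ ()) , (λ ())
two-shifts 0F 1F = 0F , 2F , (λ ()) , (λ ()) , (λ ())
two-shifts 0F 2F = 0F , 1F , (λ ()) , (λ ()) , (λ ())
two-shifts 1F 0F = 0F , 1F , (λ ()) , (λ ()) , (λ ())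
two-shifts 1F 1F = 1F , 2F , (λ ()) , (λ ()) , (λ ())
two-shifts 1F 2F = 0F , 2F , (λ ()) , (λ ()) , (λ ())
two-shifts 2F 0F = 0F , 2F , (λ ()) , (λ ()) , (λ ())
two-shifts 2F 1F = 0F , 1F , (λ ()) , (λ ()) , (λ ())
two-shifts 2F 2F = 1F , 2F , (λ ()) , (λ ()) , (λ ())

module PerCurve {n : ℕ} (A : Arrangement n) (other : ∀ (c : Fin n) → ∃ λ c′ → c′ ≢ c) (C : Fin n) where
  open Walks A
  open Colouring A other

  off : Fin nv → Bool
  off v = not (on C v)

  not-true : ∀ {a} → not a ≡ true → a ≡ false
  not-true {false} _ = refl

  off⁻ : ∀ {v} → off v ≡ true → ¬ Through C v
  off⁻ {v} p = does-false (through? C v) (not-true p)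

  off⁺ : ∀ {v} → ¬ Through C v → off v ≡ true
  off⁺ {v} ¬t = cong not (dec-false (through? C v) ¬t)

  on⁺ : ∀ {v} → Through C v → on C v ≡ true
  on⁺ {v} = dec-true (through? C v)

  on⁻ : ∀ {v} → on C v ≡ true → Through C v
  on⁻ {v} = does-true (through? C v)

  abstract
    colour-off : ∃ λ g → Proper off g
    colour-off with extend (suc (countᵇ (allFin nv) off)) (λ _ → false) off (λ _ → 0F) (λ _ ()) (λ _ _ → refl) ≤-refl
                      (λ H H⊆ v₀ v₀∈ → Degeneracy.degenerate A C H (λ h → off⁻ (H⊆ _ h)) v₀ v₀∈)
    ... | g , proper , _ = g , proper

  module Outside (s : Side C) (chordless : ∀ d → ¬ Chord s d) (g : Fin nv → Fin 3) (g-proper : Proper off g) where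
    open Side s

    B : Fin nv → Bool
    B v = off v ∧ not (f (v , 0F))

    B⁻ : ∀ {v} → B v ≡ true → ¬ Through C v × f (v , 0F) ≡ false
    B⁻ {v} p with off v in eq | f (v , 0F)
    ... | true | false = off⁻ eq , refl

    B⁺ : ∀ {d} → ¬ Through C (tl d) → f d ≡ false → B (tl d) ≡ true
    B⁺ {d} ¬t fd = trans (cong (_∧ not (f (tl d , 0F))) (off⁺ ¬t)) (cong not (trans (off-constant {d} {tl d , 0F} ¬t refl) fd))

    B-on : ∀ {v} → Through C v → B v ≡ false
    B-on {v} t = cong (_∧ not (f (v , 0F))) (cong not (on⁺ t))

    B-in : ∀ {d} → ¬ Through C (tl d) → f d ≡ true → B (tl d) ≡ false
    B-in {d} ¬t fd = trans (cong (_∧ not (f (tl d , 0F))) (off⁺ ¬t)) (cong not (trans (off-constant {d} {tl d , 0F} ¬t refl) fd))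

    -- Orients C with its inside on the left. Around the tail of such a `d`, the dart `σ d` points
    -- outside, `opp d` back along C, and `σ (σ (σ d))` inside.
    Directed : Dart nv → Set
    Directed d = curve d ≡ C × f d ≡ true

    σ-curve : ∀ {d} → curve d ≡ C → curve (σ d) ≢ C
    σ-curve {d} c eq = curve-σ≢ d (trans eq (sym c))

    f-out : ∀ {d} → Directed d → f (σ d) ≡ false
    f-out (c , t) = trans (jump c) (cong not t)

    f-out′ : ∀ {d} → Directed d → f (σ (σ d)) ≡ false
    f-out′ {d} D = trans (flat (σ-curve (proj₁ D))) (f-out D)

    f-in : ∀ {d} → Directed d → f (σ (σ (σ d))) ≡ true
    f-in {d} D = trans (jump (trans (curve-opp d) (proj₁ D))) (cong not (f-out′ D))

    in-curve : ∀ {d} → Directed d → curve (σ (σ (σ d))) ≢ C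
    in-curve {d} (c , _) eq = curve-σ³≢ d (trans eq (sym c))

    directed : ∀ {v} → Through C v → ∃ λ d → tl d ≡ v × Directed d
    directed (d , td , cd) with false-or-true (f d)
    ... | inj₂ p = d , td , cd , p
    ... | inj₁ p = opp d , td , trans (curve-opp d) cd , trans (flat (σ-curve cd)) (trans (jump cd) (cong not p))

    directed-unique : ∀ {d e} → Directed d → Directed e → tl e ≡ tl d → e ≡ d
    directed-unique D (c , t) te with same-strand te (trans c (sym (proj₁ D)))
    ... | inj₁ eq = eq
    ... | inj₂ eq = ⊥-elim (true≢false (trans (sym t) (trans (cong f eq) (f-out′ D))))

    directed-τ : ∀ {d} → Directed d → Directed (τ d)
    directed-τ {d} (c , t) = trans (curve-τ d) c , trans (flat (σ-curve (trans (curve-α d) c))) (trans (f-face d) t)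

    directed-iter : ∀ k {d} → Directed d → Directed (iter τ k d)
    directed-iter zero    D = D
    directed-iter (suc k) D = directed-τ (directed-iter k D)

    directed-reach : ∀ {d e} → Directed d → Directed e → ∃ λ k → iter τ k d ≡ e
    directed-reach {d} {e} D D′ with reach d e (trans (proj₁ D) (sym (proj₁ D′)))
    ... | k , q = k , directed-unique D′ (directed-iter k D) q

    along-on : ∀ {d} → Directed d → Through C (hd d)
    along-on {d} (c , _) = α d , refl , trans (curve-α d) c

    against-on : ∀ {d} → Directed d → Through C (hd (opp d))
    against-on {d} (c , _) = α (opp d) , refl , trans (curve-α (opp d)) (trans (curve-opp d) c)

    in-off : ∀ {d} → Directed d → ¬ Through C (hd (σ (σ (σ d))))
    in-off {d} D t = chordless (σ (σ (σ d))) ((d , refl , proj₁ D) , in-curve D , f-in D , t)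

    f-in-head : ∀ {d} → Directed d → f (α (σ (σ (σ d)))) ≡ true
    f-in-head {d} D = trans (f-α _) (trans (flat (in-curve D)) (f-in D))

    in-not-B : ∀ {d} → Directed d → B (hd (σ (σ (σ d)))) ≡ false
    in-not-B {d} D = B-in {α (σ (σ (σ d)))} (in-off D) (f-in-head D)

    out-B : ∀ {d} → Directed d → ¬ Through C (hd (σ d)) → B (hd (σ d)) ≡ true
    out-B {d} D ¬t = B⁺ {α (σ d)} ¬t (trans (f-α (σ d)) (f-out′ D))

    g-proper-B : Proper B g
    g-proper-B d p q = g-proper d (off⁺ (proj₁ (B⁻ p))) (off⁺ (proj₁ (B⁻ q)))

    OuterColouring : Set
    OuterColouring = ∃ λ h → Proper (B ∪ on C) h × (∀ v → B v ≡ true → h v ≡ g v)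

    -- y is followed on C by x, the outer neighbour b of y is coloured z, and x may be coloured z too: then
    -- colour x first and go on along C as far as y, which sees z twice.
    module Break (d : Dart nv) (D : Directed d) (out : ¬ Through C (hd (σ d)))
      (differ : Through C (hd (σ (τ d))) ⊎ g (hd (σ (τ d))) ≢ g (hd (σ d))) where
      y x : Fin nv
      y = tl d
      x = hd d
      z : Fin 3
      z = g (hd (σ d))
      P₁ Q : Fin nv → Bool
      P₁ = B [ x ≔ true ]
      Q = (on C [ x ≔ false ]) [ y ≔ false ]
      κ₁ : Fin nv → Fin 3
      κ₁ = g [ x ≔ z ]

      Q⁻ : ∀ v → Q v ≡ true → Through C v × v ≢ x × v ≢ y
      Q⁻ v p with v ≟ᶠ y
      ... | no v≢y with v ≟ᶠ x
      ... | no v≢x = on⁻ p , v≢x , v≢y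

      P₁-false : ∀ v → B v ≡ false → v ≢ x → P₁ v ≡ false
      P₁-false v b ne = trans (≔-there B true ne) b

      ok₁ : ∀ e → tl e ≡ x → B (hd e) ≡ true → z ≢ g (hd e)
      ok₁ e te b with around (τ d) e te
      ... | inj₁ refl = ⊥-elim (proj₁ (B⁻ b) (along-on (directed-τ D)))
      ... | inj₂ (inj₂ (inj₁ refl)) = ⊥-elim (proj₁ (B⁻ b) (against-on (directed-τ D)))
      ... | inj₂ (inj₂ (inj₂ refl)) = ⊥-elim (true≢false (trans (sym b) (in-not-B (directed-τ D))))
      ... | inj₂ (inj₁ refl) = case differ of λ { (inj₁ t) → ⊥-elim (proj₁ (B⁻ b) t) ; (inj₂ ne) → ne ∘ sym }

      -- On the way along C to `y`, take the last vertex in H. Its successor is not in H, and it is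
      -- not `x`, which only `y` precedes; its inner neighbour is outside P₁ and H as well.
      elim : ∀ H → (∀ v → H v ≡ true → Q v ≡ true) → ∀ v₀ → H v₀ ≡ true → ∃ λ v → H v ≡ true × Low (P₁ ∪ H) v
      elim H H⊆ v₀ v₀∈ with directed (proj₁ (Q⁻ v₀ (H⊆ v₀ v₀∈)))
      ... | d₀ , t₀ , D₀ with directed-reach D₀ D
      ... | K , eK with last-index (λ i → H (tl (iter τ i d₀)) ≟ᵇ true) K (trans (cong H t₀) v₀∈)
                         (λ p → proj₂ (proj₂ (Q⁻ (tl (iter τ K d₀)) (H⊆ _ p))) (cong tl eK))
      ... | i , i<K , pi , later = tl e , pi , e , σ (σ (σ e)) , refl , refl , (λ eq → σ³≢ e (sym eq))
            , ∪-falseˡ (P₁-false (hd e) (B-on (along-on De)) succ≢x) (¬-not (later (suc i) ≤-refl i<K))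
            , ∪-falseˡ (P₁-false (hd (σ (σ (σ e)))) (in-not-B De) (λ eq → in-off De (subst (Through C) (sym eq) (along-on D))))
                (¬-not (λ p → in-off De (proj₁ (Q⁻ (hd (σ (σ (σ e)))) (H⊆ _ p)))))
        where
        e : Dart nv
        e = iter τ i d₀
        De : Directed e
        De = directed-iter i D₀
        succ≢x : hd e ≢ x
        succ≢x eq = proj₂ (proj₂ (Q⁻ (tl e) (H⊆ _ pi)))
          (cong tl (τ-injective (directed-unique (directed-τ D) (directed-τ De) eq)))

      abstract
        extended : ∃ λ κ → Proper (P₁ ∪ Q) κ × (∀ v → P₁ v ≡ true → κ v ≡ κ₁ v)
        extended = extend (suc (countᵇ (allFin nv) Q)) P₁ Q κ₁ (update-proper {B} {g} g-proper-B ok₁)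
          (λ v q → P₁-false v (B-on (proj₁ (Q⁻ v q))) (proj₁ (proj₂ (Q⁻ v q)))) ≤-refl elim

      outer : OuterColouring
      outer with extended
      ... | κ₂ , proper₂ , agree with avoid-two z (κ₂ (hd (opp d)))
      -- Successor and outer neighbour of `y` both have colour `z`, and the inner neighbour is not
      -- coloured here; so only `z` and the colour of the predecessor are forbidden.
      ... | c , c≢z , c≢w = κ₂ [ y ≔ c ]
          , (λ e p q → update-proper {P₁ ∪ Q} {κ₂} {y} {c} proper₂ ok₂ e (grow p) (grow q))
          , λ v b → trans (≔-there κ₂ c (λ { refl → proj₁ (B⁻ b) (d , refl , proj₁ D) }))
                      (trans (agree v (in₁ b)) (≔-there g z (λ { refl → proj₁ (B⁻ b) (along-on D) })))
        where
        in₁ : ∀ {v} → B v ≡ true → P₁ v ≡ true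
        in₁ {v} b with v ≟ᶠ x
        ... | yes _ = refl
        ... | no _  = b
        ok₂ : ∀ e → tl e ≡ y → (P₁ ∪ Q) (hd e) ≡ true → c ≢ κ₂ (hd e)
        ok₂ e te p with around d e te
        ... | inj₁ refl = λ eq → c≢z (trans eq (trans (agree x (≔-here B x true)) (≔-here g x z)))
        ... | inj₂ (inj₁ refl) = λ eq → c≢z (trans eq (trans (agree _ (in₁ (out-B D out)))
                (≔-there g z (λ h → out (subst (Through C) (sym h) (along-on D))))))
        ... | inj₂ (inj₂ (inj₁ refl)) = c≢w
        ... | inj₂ (inj₂ (inj₂ refl)) = ⊥-elim (true≢false (trans (sym p) (∪-falseˡ
                (P₁-false (hd (σ (σ (σ d)))) (in-not-B D) (λ eq → in-off D (subst (Through C) (sym eq) (along-on D))))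
                (¬-not (λ q → in-off D (proj₁ (Q⁻ (hd (σ (σ (σ d)))) q)))))))
        grow : ∀ {v} → (B ∪ on C) v ≡ true → ((P₁ ∪ Q) [ y ≔ true ]) v ≡ true
        grow {v} p = by (v ≟ᶠ y) (v ≟ᶠ x)
          where
          by : Dec (v ≡ y) → Dec (v ≡ x) → ((P₁ ∪ Q) [ y ≔ true ]) v ≡ true
          by (yes refl) _          = ≔-here (P₁ ∪ Q) y true
          by (no ne)    (yes refl) = trans (≔-there (P₁ ∪ Q) true ne) (cong (_∨ Q x) (≔-here B x true))
          by (no ne)    (no ne′)   = trans (≔-there (P₁ ∪ Q) true ne)
            (trans (cong₂ _∨_ (≔-there B true ne′) (trans (≔-there (on C [ x ≔ false ]) false ne) (≔-there (on C) false ne′))) p)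

    -- Otherwise all outer neighbours off C have one colour z, and C, which is even, is coloured alternately.
    module Alternate (z : Fin 3) (uniform : ∀ {d} → Directed d → ¬ Through C (hd (σ d)) → g (hd (σ d)) ≡ z) where
      χ : Dart nv → Bool
      χ = proj₁ chequer
      χ-face : ∀ d → χ (σ (α d)) ≡ χ d
      χ-face = proj₁ (proj₂ chequer)
      χ-σ : ∀ d → χ (σ d) ≡ not (χ d)
      χ-σ = proj₂ (proj₂ chequer)
      χ-α : ∀ d → χ (α d) ≡ not (χ d)
      χ-α d = trans (sym (χ-face (α d))) (trans (cong (λ e → χ (σ e)) (α-invol d)) (χ-σ d))
      χ-σσ : ∀ d → χ (σ (σ d)) ≡ χ d
      χ-σσ d = trans (χ-σ _) (trans (cong not (χ-σ d)) (not-involutive _))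

      p q : Fin 3
      p = proj₁ (avoid-two z z)
      q = proj₁ (avoid-two z p)
      p≢z : p ≢ z
      p≢z = proj₁ (proj₂ (avoid-two z z))
      q≢z : q ≢ z
      q≢z = proj₁ (proj₂ (avoid-two z p))
      q≢p : q ≢ p
      q≢p = proj₂ (proj₂ (avoid-two z p))

      pick : Bool → Fin 3
      pick true  = p
      pick false = q

      pick≢z : ∀ b → pick b ≢ z
      pick≢z true  = p≢z
      pick≢z false = q≢z

      pick-not : ∀ b → pick b ≢ pick (not b)
      pick-not true  eq = q≢p (sym eq)
      pick-not false eq = q≢p eq

      h : Fin nv → Fin 3
      h v with through? C v
      ... | yes t = pick (χ (proj₁ (directed t)))
      ... | no _  = g v

      h-on : ∀ {d} → Directed d → h (tl d) ≡ pick (χ d)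
      h-on {d} D with through? C (tl d)
      ... | no ¬t = ⊥-elim (¬t (d , refl , proj₁ D))
      ... | yes t with directed t
      ... | e , te , De = cong (pick ∘ χ) (directed-unique D De te)

      h-off : ∀ {v} → ¬ Through C v → h v ≡ g v
      h-off {v} ¬t with through? C v
      ... | yes t = ⊥-elim (¬t t)
      ... | no _  = refl

      -- For a directed dart, `χ` is the chequerboard colour of the inner face along it. It changes
      -- from each vertex of C to the next, and equally from one end of an outer chord to the other.
      both-on : ∀ {d e} → Directed d → tl e ≡ tl d → Through C (hd e) → h (tl e) ≢ h (hd e)
      both-on {d} {e} D te t eq = pick-not (χ d) (trans (sym (h-on D)) (trans (cong h (sym te)) (trans eq h-hd)))
        where
        via : ∀ {d′} → Directed d′ → tl d′ ≡ hd e → χ d′ ≡ not (χ d) → h (hd e) ≡ pick (not (χ d))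
        via D′ t′ c = trans (cong h (sym t′)) (trans (h-on D′) (cong pick c))
        h-hd : h (hd e) ≡ pick (not (χ d))
        h-hd with around d e te
        ... | inj₁ refl = via (directed-τ D) refl (trans (χ-σ _) (cong not (χ-face d)))
        ... | inj₂ (inj₂ (inj₁ refl)) = via {α (opp d)} (trans (curve-α (opp d)) (trans (curve-opp d) (proj₁ D)) , trans (f-α (opp d)) (f-in D)) refl
                (trans (χ-α (opp d)) (cong not (χ-σσ d)))
        ... | inj₂ (inj₂ (inj₂ refl)) = ⊥-elim (in-off D t)
        ... | inj₂ (inj₁ refl) with directed t
        ... | d′ , td′ , D′ with around d′ (α (σ d)) (sym td′)
        ... | inj₁ a = ⊥-elim (σ-curve (proj₁ D) (trans (sym (curve-α (σ d))) (trans (cong curve a) (proj₁ D′))))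
        ... | inj₂ (inj₂ (inj₁ a)) = ⊥-elim (σ-curve (proj₁ D) (trans (sym (curve-α (σ d))) (trans (cong curve a) (trans (curve-opp d′) (proj₁ D′)))))
        ... | inj₂ (inj₂ (inj₂ a)) = ⊥-elim (true≢false (trans (sym (f-in D′)) (trans (cong f (sym a)) (trans (f-α (σ d)) (f-out′ D)))))
        ... | inj₂ (inj₁ a) = via D′ td′ (trans (sym (not-involutive (χ d′)))
                (cong not (trans (sym (χ-σ d′)) (trans (cong χ (sym a)) (trans (χ-α (σ d)) (trans (cong not (χ-σ d)) (not-involutive _)))))))

      on-B : ∀ {d e} → Directed d → tl e ≡ tl d → B (hd e) ≡ true → h (tl e) ≢ h (hd e)
      on-B {d} {e} D te b eq with around d e te
      ... | inj₁ refl = proj₁ (B⁻ b) (along-on D)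
      ... | inj₂ (inj₂ (inj₁ refl)) = proj₁ (B⁻ b) (against-on D)
      ... | inj₂ (inj₂ (inj₂ refl)) = true≢false (trans (sym b) (in-not-B D))
      ... | inj₂ (inj₁ refl) = pick≢z (χ d) (trans (sym (h-on D)) (trans eq (trans (h-off (proj₁ (B⁻ b))) (uniform D (proj₁ (B⁻ b))))))

      h-proper : Proper (B ∪ on C) h
      h-proper e pt ph eq with ∪-true {B (tl e)} pt | ∪-true {B (hd e)} ph
      ... | inj₁ a | inj₁ b = g-proper-B e a b (trans (sym (h-off (proj₁ (B⁻ a)))) (trans eq (h-off (proj₁ (B⁻ b)))))
      ... | inj₂ a | inj₂ b with directed (on⁻ a)
      ... | d , td , D = both-on D (sym td) (on⁻ b) eq
      h-proper e pt ph eq | inj₂ a | inj₁ b with directed (on⁻ a)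
      ... | d , td , D = on-B D (sym td) b eq
      h-proper e pt ph eq | inj₁ a | inj₂ b with directed (on⁻ b)
      ... | d , td , D = on-B {d} {α e} D (sym td) (trans (cong (B ∘ tl) (α-invol e)) a) (trans (sym eq) (cong (h ∘ tl) (sym (α-invol e))))

      outer : OuterColouring
      outer = h , h-proper , λ v b → h-off (proj₁ (B⁻ b))

    abstract
      colour-outer : OuterColouring
      colour-outer with any-dart? (λ d → ((curve d ≟ᶠ C) ×-dec (f d ≟ᵇ true)) ×-dec (¬? (through? C (hd (σ d)))
                          ×-dec (through? C (hd (σ (τ d))) ⊎-dec ¬? (g (hd (σ (τ d))) ≟ᶠ g (hd (σ d))))))
      ... | yes (d , D , out , differ) = Break.outer d D out differ
      ... | no none with any-dart? (λ d → ((curve d ≟ᶠ C) ×-dec (f d ≟ᵇ true)) ×-dec ¬? (through? C (hd (σ d))))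
      -- Every outer edge at C is a chord here, so the choice of `z` is arbitrary.
      ... | no none′ = Alternate.outer 0F (λ {d} D out → ⊥-elim (none′ (d , D , out)))
      ... | yes (d₀ , D₀ , out₀) = Alternate.outer (g (hd (σ d₀))) uniform
        where
        -- In the absence of a break, having an outer neighbour off C is passed on along C together
        -- with the colour of that neighbour.
        chain : ∀ k → ¬ Through C (hd (σ (iter τ k d₀))) × g (hd (σ (iter τ k d₀))) ≡ g (hd (σ d₀))
        chain zero = out₀ , refl
        chain (suc k) with chain k
        ... | o , e = (λ t → none (iter τ k d₀ , directed-iter k D₀ , o , inj₁ t))
          , trans next e
          where
          next : g (hd (σ (iter τ (suc k) d₀))) ≡ g (hd (σ (iter τ k d₀)))
          next with g (hd (σ (iter τ (suc k) d₀))) ≟ᶠ g (hd (σ (iter τ k d₀)))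
          ... | yes eq = eq
          ... | no ne  = ⊥-elim (none (iter τ k d₀ , directed-iter k D₀ , o , inj₂ ne))
        uniform : ∀ {d} → Directed d → ¬ Through C (hd (σ d)) → g (hd (σ d)) ≡ g (hd (σ d₀))
        uniform D _ with directed-reach D₀ D
        ... | k , refl = proj₂ (chain k)

-- Three partial 3-colourings for each curve

record PartialColourings {n : ℕ} (A : Arrangement n) (C : Fin n) : Set where
  open Walks A using (nv; hd; tl; Through)
  field
    κ         : Fin 3 → Fin nv → Maybe (Fin 3)
    proper    : ∀ s d k → κ s (tl d) ≡ just k → κ s (hd d) ≢ just k
    total-off : ∀ s {v} → ¬ Through C v → ∃ λ k → κ s v ≡ just k
    twice-on  : ∀ {v} → Through C v → ∃₂ λ r s → r ≢ s × (∃ λ k → κ r v ≡ just k) × (∃ λ k → κ s v ≡ just k)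

module Family {n : ℕ} (A : Arrangement n) (third : ∀ (a b : Fin n) → ∃ λ c → c ≢ a × c ≢ b) where
  open Walks A

  other : ∀ (c : Fin n) → ∃ λ c′ → c′ ≢ c
  other c = proj₁ (third c c) , proj₁ (proj₂ (third c c))

  open Colouring A other

  -- The vertices off C of the two curves lie on opposite sides of C, yet the curves must meet off C.
  one-sided : ∀ {C} (s : Side C) {d e} → Chord s d → Chord (opposite s) e → ⊥
  one-sided {C} s {d} {e} dc@(_ , d≢C , _) ec@(_ , e≢C , _) with curve d ≟ᶠ curve e
  ... | no ne with crosses-twice (curve d) (curve e) ne
  ... | u , _ , _ , mu , _ with meets-darts mu
  ... | (x , tx , cx) , (y , ty , cy) = true≢false (trans (sym (not-injective (chord-empty (opposite s) ec y cy off-y)))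
          (trans (Side.off-constant s {x} {y} off-x (trans ty (sym tx))) (chord-empty s dc x cx off-x)))
    where
    off-u : ¬ Through C u
    off-u = no-third-curve ne d≢C e≢C (x , tx , cx) (y , ty , cy)
    off-x : ¬ Through C (tl x)
    off-x = subst (λ z → ¬ Through C z) (sym tx) off-u
    off-y : ¬ Through C (tl y)
    off-y = subst (λ z → ¬ Through C z) (sym ty) off-u
    not-injective : ∀ {a} → not a ≡ false → a ≡ true
    not-injective {true} _ = refl
  -- With both chords on one curve, that curve would have no vertex off C at all; its crossing with
  -- a third curve is one.
  one-sided {C} s {d} {e} dc@(_ , d≢C , _) ec@(_ , e≢C , _) | yes eq with third (curve d) C
  ... | c , c≢d , c≢C with crosses-twice (curve d) c (c≢d ∘ sym)
  ... | u , _ , _ , mu , _ with meets-darts mu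
  ... | (x , tx , cx) , on-c = true≢false (trans (sym (cong not (chord-empty s dc x cx off-x))) (chord-empty (opposite s) ec x (trans cx eq) off-x))
    where
    off-x : ¬ Through C (tl x)
    off-x = subst (λ z → ¬ Through C z) (sym tx) (no-third-curve (c≢d ∘ sym) d≢C c≢C (x , tx , cx) on-c)

  -- The outside and C are coloured consistently, the inside is coloured separately and its colours are
  -- shifted cyclically; a vertex of C is dropped when it agrees with its only neighbour inside, which
  -- happens for just one shift.
  module Shifts {C : Fin n} (s₀ : Side C) (chordless : ∀ d → ¬ Chord s₀ d) where
    open PerCurve A other C
    g : Fin nv → Fin 3
    g = proj₁ colour-off
    g-proper : Proper off g
    g-proper = proj₂ colour-off
    open Outside s₀ chordless g g-proper
    open Side s₀
    h : Fin nv → Fin 3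
    h = proj₁ colour-outer
    h-proper : Proper (B ∪ on C) h
    h-proper = proj₁ (proj₂ colour-outer)

    inner : ∀ {v} → Through C v → Fin nv
    inner t = hd (σ (σ (σ (proj₁ (directed t)))))

    κ : Fin 3 → Fin nv → Maybe (Fin 3)
    κ s v with through? C v
    ... | yes t = if does (add₃ s (g (inner t)) ≟ᶠ h v) then nothing else just (h v)
    ... | no _  = if f (v , 0F) then just (add₃ s (g v)) else just (h v)

    data Kind (s : Fin 3) (v : Fin nv) (k : Fin 3) : Set where
      on-C      : (t : Through C v) → h v ≡ k → add₃ s (g (inner t)) ≢ k → Kind s v k
      inside-C  : ¬ Through C v → f (v , 0F) ≡ true → add₃ s (g v) ≡ k → Kind s v k
      outside-C : B v ≡ true → h v ≡ k → Kind s v k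

    kind : ∀ s v {k} → κ s v ≡ just k → Kind s v k
    kind s v eq with through? C v
    ... | yes t with add₃ s (g (inner t)) ≟ᶠ h v
    kind s v refl | yes t | no ne = on-C t refl ne
    kind s v eq | no ¬t with f (v , 0F) in fv
    kind s v refl | no ¬t | true  = inside-C ¬t fv refl
    kind s v refl | no ¬t | false = outside-C (B⁺ {v , 0F} ¬t fv) refl

    across : ∀ {d} → ¬ Through C (tl d) → f (α d) ≡ f d
    across {d} ¬t = trans (f-α d) (off-flat ¬t)

    base-side : ∀ {d} → ¬ Through C (tl d) → f d ≡ f (tl d , 0F)
    base-side {d} ¬t = off-constant {tl d , 0F} {d} ¬t refl

    head-side : ∀ {d} → ¬ Through C (hd d) → f (α d) ≡ f (hd d , 0F)
    head-side {d} ¬t = off-constant {hd d , 0F} {α d} ¬t refl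

    on-inside : ∀ {s d k} (t : Through C (tl d)) → add₃ s (g (inner t)) ≢ k →
      ¬ Through C (hd d) → f (hd d , 0F) ≡ true → add₃ s (g (hd d)) ≢ k
    on-inside {s} {d} t ne ¬t fh eq with directed t in eqt
    ... | d₀ , t₀ , D with around d₀ d (sym t₀)
    ... | inj₁ refl = ¬t (along-on D)
    ... | inj₂ (inj₁ refl) = true≢false (trans (sym fh) (trans (sym (head-side ¬t)) (trans (f-α (σ d₀)) (f-out′ D))))
    ... | inj₂ (inj₂ (inj₁ refl)) = ¬t (against-on D)
    ... | inj₂ (inj₂ (inj₂ refl)) = ne eq

    outer : ∀ {s v k} → Kind s v k → ((B ∪ on C) v ≡ true × h v ≡ k) ⊎ (¬ Through C v × f (v , 0F) ≡ true × add₃ s (g v) ≡ k)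
    outer {v = v} (on-C t eq _) = inj₁ (∨-true {B v} (on⁺ t) , eq)
      where
      ∨-true : ∀ {a b} → b ≡ true → a ∨ b ≡ true
      ∨-true {false} eq = eq
      ∨-true {true}  _  = refl
    outer (inside-C a b c) = inj₂ (a , b , c)
    outer (outside-C b eq) = inj₁ (cong (_∨ on C _) b , eq)

    mixed : ∀ {s k} d → Kind s (tl d) k → ¬ Through C (hd d) → f (hd d , 0F) ≡ true → add₃ s (g (hd d)) ≡ k →
      (B ∪ on C) (tl d) ≡ true → ⊥
    mixed d (on-C t _ ne) ¬t fh eq _ = on-inside {d = d} t ne ¬t fh eq
    mixed d (inside-C ¬t′ ft _) _ _ _ b with ∪-true {B (tl d)} b
    ... | inj₁ b′ = true≢false (trans (sym ft) (proj₂ (B⁻ b′)))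
    ... | inj₂ o  = ¬t′ (on⁻ o)
    mixed d (outside-C b _) ¬t fh _ _ = true≢false (trans (sym fh) (trans (sym (head-side ¬t))
      (trans (across (proj₁ (B⁻ b))) (trans (base-side (proj₁ (B⁻ b))) (proj₂ (B⁻ b))))))

    κ-proper : ∀ s d k → κ s (tl d) ≡ just k → κ s (hd d) ≢ just k
    κ-proper s d k p q with outer (kind s (tl d) p) | outer (kind s (hd d) q)
    ... | inj₁ (a , x) | inj₁ (b , y) = h-proper d a b (trans x (sym y))
    ... | inj₂ (a , _ , x) | inj₂ (b , _ , y) = g-proper d (off⁺ a) (off⁺ b) (add₃-injective s (trans x (sym y)))
    ... | inj₁ (a , _) | inj₂ (b , fb , y) = mixed d (kind s (tl d) p) b fb y a
    ... | inj₂ (a , fa , x) | inj₁ (b , _) = mixed (α d) (kind s (hd d) q) (subst (λ z → ¬ Through C (tl z)) (sym (α-invol d)) a)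
            (trans (cong (λ z → f (tl z , 0F)) (α-invol d)) fa) (trans (cong (λ z → add₃ s (g (tl z))) (α-invol d)) x) b

    κ-off : ∀ s {v} → ¬ Through C v → ∃ λ k → κ s v ≡ just k
    κ-off s {v} ¬t with through? C v
    ... | yes t = ⊥-elim (¬t t)
    ... | no _ with f (v , 0F)
    ... | true  = _ , refl
    ... | false = _ , refl

    κ-on : ∀ {v} → Through C v → ∃₂ λ r s → r ≢ s × (∃ λ k → κ r v ≡ just k) × (∃ λ k → κ s v ≡ just k)
    κ-on {v} t with through? C v
    ... | no ¬t = ⊥-elim (¬t t)
    ... | yes t′ with two-shifts (g (inner t′)) (h v)
    ... | r , s , r≢s , nr , ns = r , s , r≢s , kept r nr , kept s ns
      where
      kept : ∀ s → add₃ s (g (inner t′)) ≢ h v → ∃ λ k → (if does (add₃ s (g (inner t′)) ≟ᶠ h v) then nothing else just (h v)) ≡ just k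
      kept s ne rewrite dec-false (add₃ s (g (inner t′)) ≟ᶠ h v) ne = h v , refl

    partial-colourings : PartialColourings A C
    partial-colourings = record { κ = κ ; proper = κ-proper ; total-off = κ-off ; twice-on = κ-on }

  abstract
    partial-colourings : ∀ C → PartialColourings A C
    partial-colourings C = choose (any-dart? (chord? (side C))) (any-dart? (chord? (opposite (side C))))
      where
      chord? : ∀ (s : Side C) d → Dec (Chord s d)
      chord? s d = through? C (tl d) ×-dec (¬? (curve d ≟ᶠ C) ×-dec ((Side.f s d ≟ᵇ true) ×-dec through? C (hd d)))
      choose : Dec (∃ (Chord (side C))) → Dec (∃ (Chord (opposite (side C)))) → PartialColourings A C
      choose (no none) _ = Shifts.partial-colourings (side C) (λ d c → none (d , c))
      choose (yes _) (no none) = Shifts.partial-colourings (opposite (side C)) (λ d c → none (d , c))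
      choose (yes (d , c)) (yes (e , c′)) = ⊥-elim (one-sided (side C) c c′)

-- Assembling the multicolouring

Disjoint : ∀ {m} → Subset m → Subset m → Set
Disjoint []      []      = ⊤
Disjoint (a ∷ p) (b ∷ q) = a ∧ b ≡ false × Disjoint p q

disjoint-∉ : ∀ {m} {p q : Subset m} → Disjoint p q → ∀ {x} → x ∈ p → x ∉ q
disjoint-∉ {p = true ∷ p} {true ∷ q} (() , _) Vec.here Vec.here
disjoint-∉ {p = _ ∷ p} {_ ∷ q} (_ , d) (Vec.there x∈) (Vec.there y∈) = disjoint-∉ d x∈ y∈

disjoint-++ : ∀ {m k} {p q : Subset m} {p′ q′ : Subset k} → Disjoint p q → Disjoint p′ q′ → Disjoint (p Vec.++ p′) (q Vec.++ q′)
disjoint-++ {p = []}    {[]}    _       e = e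
disjoint-++ {p = _ ∷ _} {_ ∷ _} (x , d) e = x , disjoint-++ d e

size-++ : ∀ {m k} (p : Subset m) (q : Subset k) → ∣ p Vec.++ q ∣ ≡ ∣ p ∣ + ∣ q ∣
size-++ []          q = refl
size-++ (true ∷ p)  q = cong suc (size-++ p q)
size-++ (false ∷ p) q = size-++ p q

-- A `b`-fold colouring wants exactly `b` colours at each vertex, while the construction guarantees
-- at least that many; the surplus is discarded.
trim : ∀ {m} (p : Subset m) b → b ≤ ∣ p ∣ → ∃ λ q → ∣ q ∣ ≡ b × q ⊆ p
trim []          zero    _       = [] , refl , id
trim (false ∷ p) b       b≤      with trim p b b≤
... | q , eq , sub = false ∷ q , eq , λ { (Vec.there x∈) → Vec.there (sub x∈) }
trim (true ∷ p)  zero    _       with trim p zero z≤n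
... | q , eq , sub = false ∷ q , eq , λ { (Vec.there x∈) → Vec.there (sub x∈) }
trim (true ∷ p)  (suc b) (s≤s b≤) with trim p b b≤
... | q , eq , sub = true ∷ q , cong suc eq , λ { Vec.here → Vec.here ; (Vec.there x∈) → Vec.there (sub x∈) }

sumᶠ : ∀ m → (Fin m → ℕ) → ℕ
sumᶠ zero    F = 0
sumᶠ (suc m) F = F zero + sumᶠ m (F ∘ suc)

sumᶠ-mono : ∀ m {F G : Fin m → ℕ} → (∀ i → F i ≤ G i) → sumᶠ m F ≤ sumᶠ m G
sumᶠ-mono zero    le = z≤n
sumᶠ-mono (suc m) le = +-mono-≤ (le zero) (sumᶠ-mono m (le ∘ suc))

sumᶠ-+ : ∀ m (F G : Fin m → ℕ) → sumᶠ m (λ i → F i + G i) ≡ sumᶠ m F + sumᶠ m G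
sumᶠ-+ zero    F G = refl
sumᶠ-+ (suc m) F G = trans (cong (F zero + G zero +_) (sumᶠ-+ m (F ∘ suc) (G ∘ suc))) (interchange (F zero) (G zero) _ _)
  where
  interchange : ∀ a b c d → (a + b) + (c + d) ≡ (a + c) + (b + d)
  interchange = solve 4 (λ a b c d → (a :+ b) :+ (c :+ d) := (a :+ c) :+ (b :+ d)) refl
    where open +-*-Solver

sumᶠ-const : ∀ m c → sumᶠ m (λ _ → c) ≡ m * c
sumᶠ-const zero    c = refl
sumᶠ-const (suc m) c = cong (c +_) (sumᶠ-const m c)

δ : ∀ {m} → Fin m → Fin m → ℕ
δ zero    zero    = 1
δ zero    (suc j) = 0
δ (suc i) zero    = 0
δ (suc i) (suc j) = δ i j

δ-refl : ∀ {m} (i : Fin m) → δ i i ≡ 1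
δ-refl zero    = refl
δ-refl (suc i) = δ-refl i

sumᶠ-δ : ∀ {m} (j : Fin m) → sumᶠ m (λ i → δ i j) ≡ 1
sumᶠ-δ {suc m} zero    = cong suc (trans (sumᶠ-const m 0) (*-comm m 0))
sumᶠ-δ {suc m} (suc j) = sumᶠ-δ j

blocks : ∀ m {r} → (Fin m → Subset r) → Subset (m * r)
blocks zero    F = []
blocks (suc m) F = F zero Vec.++ blocks m (F ∘ suc)

size-blocks : ∀ m {r} (F : Fin m → Subset r) → ∣ blocks m F ∣ ≡ sumᶠ m (λ i → ∣ F i ∣)
size-blocks zero    F = refl
size-blocks (suc m) F = trans (size-++ (F zero) _) (cong (∣ F zero ∣ +_) (size-blocks m (F ∘ suc)))

disjoint-blocks : ∀ m {r} {F G : Fin m → Subset r} → (∀ i → Disjoint (F i) (G i)) → Disjoint (blocks m F) (blocks m G)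
disjoint-blocks zero    d = tt
disjoint-blocks (suc m) d = disjoint-++ (d zero) (disjoint-blocks m (d ∘ suc))

singleton₃ : Maybe (Fin 3) → Subset 3
singleton₃ nothing   = false ∷ false ∷ false ∷ []
singleton₃ (just 0F) = true ∷ false ∷ false ∷ []
singleton₃ (just 1F) = false ∷ true ∷ false ∷ []
singleton₃ (just 2F) = false ∷ false ∷ true ∷ []

disjoint-singleton₃ : ∀ a b → (∀ k → a ≡ just k → b ≢ just k) → Disjoint (singleton₃ a) (singleton₃ b)
disjoint-singleton₃ nothing   nothing   ne = refl , refl , refl , tt
disjoint-singleton₃ nothing   (just 0F) ne = refl , refl , refl , tt
disjoint-singleton₃ nothing   (just 1F) ne = refl , refl , refl , tt
disjoint-singleton₃ nothing   (just 2F) ne = refl , refl , refl , tt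
disjoint-singleton₃ (just 0F) nothing   ne = refl , refl , refl , tt
disjoint-singleton₃ (just 1F) nothing   ne = refl , refl , refl , tt
disjoint-singleton₃ (just 2F) nothing   ne = refl , refl , refl , tt
disjoint-singleton₃ (just 0F) (just 0F) ne = ⊥-elim (ne 0F refl refl)
disjoint-singleton₃ (just 0F) (just 1F) ne = refl , refl , refl , tt
disjoint-singleton₃ (just 0F) (just 2F) ne = refl , refl , refl , tt
disjoint-singleton₃ (just 1F) (just 0F) ne = refl , refl , refl , tt
disjoint-singleton₃ (just 1F) (just 1F) ne = ⊥-elim (ne 1F refl refl)
disjoint-singleton₃ (just 1F) (just 2F) ne = refl , refl , refl , tt
disjoint-singleton₃ (just 2F) (just 0F) ne = refl , refl , refl , tt
disjoint-singleton₃ (just 2F) (just 1F) ne = refl , refl , refl , tt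
disjoint-singleton₃ (just 2F) (just 2F) ne = ⊥-elim (ne 2F refl refl)

size-singleton₃ : ∀ {a} → (∃ λ k → a ≡ just k) → 1 ≤ ∣ singleton₃ a ∣
size-singleton₃ (0F , refl) = s≤s z≤n
size-singleton₃ (1F , refl) = s≤s z≤n
size-singleton₃ (2F , refl) = s≤s z≤n

sum₃-two : ∀ (F : Fin 3 → ℕ) {r s} → r ≢ s → 1 ≤ F r → 1 ≤ F s → 2 ≤ sumᶠ 3 F
sum₃-two F {r} {s} r≢s pr ps = ≤-trans (≤-reflexive (sym (trans (sumᶠ-+ 3 (λ i → δ i r) (λ i → δ i s)) (cong₂ _+_ (sumᶠ-δ r) (sumᶠ-δ s)))))
  (sumᶠ-mono 3 le)
  where
  δ-≢ : ∀ {m} {i j : Fin m} → i ≢ j → δ i j ≡ 0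
  δ-≢ {i = zero}  {zero}  ne = ⊥-elim (ne refl)
  δ-≢ {i = zero}  {suc j} ne = refl
  δ-≢ {i = suc i} {zero}  ne = refl
  δ-≢ {i = suc i} {suc j} ne = δ-≢ (ne ∘ cong suc)
  le : ∀ i → δ i r + δ i s ≤ F i
  le i with i ≟ᶠ r | i ≟ᶠ s
  ... | yes refl | yes refl = ⊥-elim (r≢s refl)
  ... | yes refl | no ne    = ≤-trans (≤-reflexive (cong₂ _+_ (δ-refl i) (δ-≢ ne))) pr
  ... | no ne    | yes refl = ≤-trans (≤-reflexive (cong₂ _+_ (δ-≢ ne) (δ-refl i))) ps
  ... | no ne    | no ne′   = ≤-trans (≤-reflexive (cong₂ _+_ (δ-≢ ne) (δ-≢ ne′))) z≤n

module Assembly {m : ℕ} (A : Arrangement (suc (suc (suc m)))) where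
  n : ℕ
  n = suc (suc (suc m))
  open Walks A
  open Family A avoid-two using (other; partial-colourings)
  open Colouring A other using (through?)

  part : (C : Fin n) → Fin 3 → Fin nv → Maybe (Fin 3)
  part C = PartialColourings.κ (partial-colourings C)

  colours-of : Fin n → Fin nv → Subset (3 * 3)
  colours-of C v = blocks 3 (λ s → singleton₃ (part C s v))

  colours : Fin nv → Subset (n * (3 * 3))
  colours v = blocks n (λ C → colours-of C v)

  colours-disjoint : ∀ d → Disjoint (colours (tl d)) (colours (hd d))
  colours-disjoint d = disjoint-blocks n (λ C → disjoint-blocks 3 (λ s →
    disjoint-singleton₃ _ _ (λ k → PartialColourings.proper (partial-colourings C) s d k)))

  -- The colour that may be missing on a curve through `v` is booked as a Kronecker delta for each
  -- of the two curves there, so that the total deficit over all C is exactly 2.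
  size-colours-of : ∀ C v → 3 ≤ ∣ colours-of C v ∣ + (δ C (curve (v , 0F)) + δ C (curve (v , 1F)))
  size-colours-of C v with through? C v
  ... | no ¬t = ≤-trans (≤-trans (≤-reflexive (sym (sumᶠ-const 3 1)))
          (≤-trans (sumᶠ-mono 3 (λ s → size-singleton₃ (PartialColourings.total-off (partial-colourings C) s ¬t)))
            (≤-reflexive (sym (size-blocks 3 (λ s → singleton₃ (part C s v))))))) (m≤m+n _ _)
  ... | yes t with PartialColourings.twice-on (partial-colourings C) t
  ... | r , s , r≢s , pr , ps = +-mono-≤ (≤-trans (sum₃-two (λ s → ∣ singleton₃ (part C s v) ∣) r≢s (size-singleton₃ pr) (size-singleton₃ ps))
          (≤-reflexive (sym (size-blocks 3 (λ s → singleton₃ (part C s v)))))) (one t)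
    where
    one : Through C v → 1 ≤ δ C (curve (v , 0F)) + δ C (curve (v , 1F))
    one (d , refl , refl) with base-curve d
    ... | inj₁ eq = ≤-trans (≤-reflexive (sym (trans (cong (δ (curve d)) (sym eq)) (δ-refl (curve d))))) (m≤m+n _ _)
    ... | inj₂ eq = ≤-trans (≤-reflexive (sym (trans (cong (δ (curve d)) (sym eq)) (δ-refl (curve d))))) (m≤n+m _ _)

  size-colours : ∀ v → 3 * n ∸ 2 ≤ ∣ colours v ∣
  size-colours v = m≤n+o⇒m∸n≤o (3 * n) 2 (begin
    3 * n
      ≡⟨ *-comm 3 n ⟩
    n * 3
      ≡⟨ sym (sumᶠ-const n 3) ⟩
    sumᶠ n (λ _ → 3)
      ≤⟨ sumᶠ-mono n (λ C → size-colours-of C v) ⟩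
    sumᶠ n (λ C → ∣ colours-of C v ∣ + (δ C (curve (v , 0F)) + δ C (curve (v , 1F))))
      ≡⟨ sumᶠ-+ n (λ C → ∣ colours-of C v ∣) (λ C → δ C (curve (v , 0F)) + δ C (curve (v , 1F))) ⟩
    sumᶠ n (λ C → ∣ colours-of C v ∣) + sumᶠ n (λ C → δ C (curve (v , 0F)) + δ C (curve (v , 1F)))
      ≡⟨ cong₂ _+_ (sym (size-blocks n (λ C → colours-of C v)))
           (trans (sumᶠ-+ n (λ C → δ C (curve (v , 0F))) (λ C → δ C (curve (v , 1F)))) (cong₂ _+_ (sumᶠ-δ (curve (v , 0F))) (sumᶠ-δ (curve (v , 1F))))) ⟩
    ∣ colours v ∣ + 2
      ≡⟨ +-comm ∣ colours v ∣ 2 ⟩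
    2 + ∣ colours v ∣ ∎)
    where open ≤-Reasoning

  colouring : BFoldColouring (arrGraph A) (3 * n ∸ 2) (n * (3 * 3))
  colouring = record
    { col = λ v → proj₁ (trimmed v)
    ; col-size = λ v → proj₁ (proj₂ (trimmed v))
    ; col-disj = λ { u w (i , j , eq) x x∈ y∈ → disjoint-∉ (colours-disjoint (u , i)) (proj₂ (proj₂ (trimmed u)) x∈)
        (subst (λ z → x ∈ colours z) (sym (cong tl eq)) (proj₂ (proj₂ (trimmed w)) y∈)) } }
    where
    trimmed : ∀ v → ∃ λ q → ∣ q ∣ ≡ 3 * n ∸ 2 × q ⊆ colours v
    trimmed v = trim (colours v) (3 * n ∸ 2) (size-colours v)

-- Few curves, and the bound

-- No third curve is available for `one-sided`, but the two crossings are the only vertices, and one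
-- colour for each suffices.
two-colouring : (A : Arrangement 2) → BFoldColouring (arrGraph A) 1 2
two-colouring A = record { col = col ; col-size = size ; col-disj = λ { a b (i , j , eq) x → disjoint-∉ (disjoint (a , i) b (cong tl eq)) } }
  where
  other : ∀ (c : Fin 2) → ∃ λ c′ → c′ ≢ c
  other 0F = 1F , λ ()
  other 1F = 0F , λ ()
  open Walks A
  open Colouring A other using (loopless)
  u : Fin nv
  u = proj₁ (crosses-twice 0F 1F (λ ()))
  w : Fin nv
  w = proj₁ (proj₂ (crosses-twice 0F 1F (λ ())))
  all-meet : ∀ x → Meets curve 0F 1F x
  all-meet x with curve (x , 0F) in p | curve (x , 1F) in q
  ... | 0F | 1F = inj₁ (refl , refl)
  ... | 1F | 0F = inj₂ (refl , refl)
  ... | 0F | 0F = ⊥-elim (two-curves x (trans p (sym q)))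
  ... | 1F | 1F = ⊥-elim (two-curves x (trans p (sym q)))
  u-or-w : ∀ x → x ≡ u ⊎ x ≡ w
  u-or-w x = proj₂ (proj₂ (proj₂ (proj₂ (proj₂ (crosses-twice 0F 1F (λ ())))))) x (all-meet x)
  col : Fin nv → Subset 2
  col x with x ≟ᶠ u
  ... | yes _ = true ∷ false ∷ []
  ... | no _  = false ∷ true ∷ []
  size : ∀ x → ∣ col x ∣ ≡ 1
  size x with x ≟ᶠ u
  ... | yes _ = refl
  ... | no _  = refl
  disjoint : ∀ d b → hd d ≡ b → Disjoint (col (tl d)) (col b)
  disjoint d .(hd d) refl with tl d ≟ᶠ u | hd d ≟ᶠ u
  ... | yes a | yes b = ⊥-elim (loopless d (trans b (sym a)))
  ... | yes _ | no _  = refl , refl , tt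
  ... | no _  | yes _ = refl , refl , tt
  ... | no a  | no b with u-or-w (tl d) | u-or-w (hd d)
  ... | inj₁ p | _      = ⊥-elim (a p)
  ... | inj₂ _ | inj₁ q = ⊥-elim (b q)
  ... | inj₂ p | inj₂ q = ⊥-elim (loopless d (trans q (sym p)))

one-curve : (A : Arrangement 1) → Arrangement.nv A ≡ 0
one-curve A with any? (λ (v : Fin (Arrangement.nv A)) → yes v)
... | yes (v , _) = ⊥-elim (Arrangement.two-curves A v (unique₁ _ _))
  where
  unique₁ : (a b : Fin 1) → a ≡ b
  unique₁ 0F 0F = refl
... | no none = empty (Arrangement.nv A) none
  where
  empty : ∀ k → ¬ (∃ λ (_ : Fin k) → Fin k) → k ≡ 0
  empty zero    _ = refl
  empty (suc k) e = ⊥-elim (e (zero , zero))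

theorem5 : (n : ℕ) → 1 ≤ n → (A : Arrangement n) →
    FracChromaticAtMost (arrGraph A) (9 * n) (3 * n ∸ 2)
theorem5 1 _ A k _ = 1 , 0 , s≤s z≤n
  , record { col = λ v → ⊥-elim (none v) ; col-size = λ v → ⊥-elim (none v) ; col-disj = λ v → ⊥-elim (none v) } , z≤n
  where
  none : Fin (Arrangement.nv A) → ⊥
  none v with subst Fin (one-curve A) v
  ... | ()
theorem5 2 _ A k _ = 1 , 2 , s≤s z≤n , two-colouring A , ≤-trans (≤-trans (≤-reflexive (lhs k)) (m≤m+n (8 * k) (10 * k)))
    (≤-trans (≤-reflexive (rhs k)) (m≤m+n (18 * k * 1) 4))
  where
  open +-*-Solver
  lhs : ∀ k → 2 * k * 4 ≡ 8 * k
  lhs = solve 1 (λ k → con 2 :* k :* con 4 := con 8 :* k) refl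
  rhs : ∀ k → 8 * k + 10 * k ≡ 18 * k * 1
  rhs = solve 1 (λ k → con 8 :* k :+ con 10 :* k := con 18 :* k :* con 1) refl
-- One colouring serves every `k`: its ratio is exactly 9n / (3n - 2), and the term `b * b` is
-- slack.
theorem5 n@(suc (suc (suc m))) _ A k _ = b , n * (3 * 3) , s≤s z≤n , Assembly.colouring A
  , ≤-trans (≤-reflexive (cong (λ z → z * k * b) (*-comm n 9))) (m≤m+n (9 * n * k * b) (b * b))
  where
  b : ℕ
  b = 3 * n ∸ 2
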